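{- For every integer $n\ge 0$, \[ N^{0}(0,8;8n+r)>N^{0}(4,8;8n+r)\quad (r\in\{1,3\}),\qquad N^{0}(1,8;8n+2)>N^{0}(3,8;8n+2), \] and for every integer $n\ge 1$, $N^{0}(1,8;8n)>N^{0}(3,8;8n)$.
   Context: An odd Durfee symbol of a positive integer $n$ consists of a nonnegative integer $D$ together with two (possibly empty) non-increasing sequences of odd positive integers $a_1\ge\cdots\ge a_s$ (top row) and $b_1\ge\cdots\ge b_t$ (bottom row), all entries at most $2D+1$, such that $n=\sum a_i+\sum b_j+2D^2+2D+1$. Its odd rank is $s-t$. $N^{0}(a,M;n)$ is the number of odd Durfee symbols of $n$ whose odd rank is congruent to $a$ modulo $M$. -}

module Defs where

open import Data.Nat using (ℕ; _+_; _*_; _≤_; _≥_)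
open import Data.Integer as ℤ using (ℤ; +_; _-_)
open import Data.Integer.Divisibility as ℤd using ()
open import Data.List using (List; length)
open import Data.Nat.ListAction using (sum)
open import Data.List.Relation.Unary.All using (All)
open import Data.List.Relation.Unary.Linked using (Linked)
open import Data.List.Relation.Unary.Unique.Propositional using (Unique)
open import Data.List.Membership.Propositional using (_∈_)
open import Data.Product using (Σ; ∃; _×_; _,_)
open import Function.Bundles using (_⇔_)
open import Relation.Binary.PropositionalEquality using (_≡_)

Odd : ℕ → Set
Odd x = ∃ λ k → x ≡ 1 + 2 * k

-- raw data of an odd Durfee symbol: (D , top row , bottom row)
Symbol : Set
Symbol = ℕ × List ℕ × List ℕ

IsOddDurfeeSymbol : ℕ → Symbol → Set
IsOddDurfeeSymbol n (D , as , bs) =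
  All Odd as × All Odd bs
  × All (λ x → x ≤ 2 * D + 1) as × All (λ x → x ≤ 2 * D + 1) bs
  × Linked _≥_ as × Linked _≥_ bs
  × n ≡ sum as + sum bs + 2 * (D * D) + 2 * D + 1

oddRank : Symbol → ℤ
oddRank (D , as , bs) = + length as - + length bs

_≡_[mod_] : ℤ → ℤ → ℕ → Set
x ≡ a [mod M ] = (+ M) ℤd.∣ (x - a)

HasCount : {A : Set} → (A → Set) → ℕ → Set
HasCount {A} P k = Σ (List A) λ L → length L ≡ k × Unique L × (∀ x → (x ∈ L) ⇔ P x)

N0≡ : ℤ → ℕ → ℕ → ℕ → Set
N0≡ a M n k = HasCount (λ σ → IsOddDurfeeSymbol n σ × (oddRank σ ≡ a [mod M ])) k

{-# OPTIONS --safe #-}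
module Submission where

-- Let ζ be a primitive 8th root of unity, p = q² and u = q⁸.  Since odd ranks k and -k are equally frequent, the series
-- R(ζ) = Σ ζ^rank q^{n-1} over the odd Durfee symbols of n has coefficients N⁰(0,8;n) - N⁰(4,8;n) + √2 (N⁰(1,8;n) - N⁰(3,8;n)),
-- and the theorem follows from the identity
--   R(ζ) = (1 + 2 Σ_{k≥1} u^{k²}) / (u²;u⁴)_∞ + p Σ_{n≥0} uⁿ (-u;u²)_n + (√2/q) (a series in ℕ[[q]]),
-- in which every coefficient to be tested is visibly positive.
--
-- For a formal z, the coefficient of zᵐ in R(z) is qᵐ rₘ with rₘ = Σ_k pᵏ [m+2k choose k]_p, and telescoping Pascal's rule gives
-- rₘ + p^{m+3} rₘ₊₃ = 1/(p;p)_∞.  Hence E(z) = q(z + 1/z)(R(z) + p R₄(-z²)) + S₄(-z²), with R₄ the series R and S₄ the rank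
-- generating function of partitions, both in base u, obeys under z ↦ z q² the functional equation of
-- Θ(z) = 1/((zq, q/z; p)_∞ (-z²p², -p²/z²; p²)_∞).  The solutions of that equation are proportional, and E(i) = 1/(u;u)_∞,
-- so E(ζ) is an explicit theta product.  The triple product expands it; the mock theta functions ν(u) = R₄(-ζ²) and
-- φ(u) = S₄(-ζ²) that remain are removed by the summation of Σ_{n∈ℤ} uⁿ (-u;u²)_n and by comparison with Euler's expansion
-- of (-u;u²)_∞.

-- The shape of E is forced. The coefficients of q(z + 1/z) R(z) violate the recurrence of Θ at
-- finitely many indices only, and the remaining terms of E violate it by exactly the opposite
-- amounts. The factor z + 1/z serves twice more: at z = i it vanishes, so that only S₄(1), the
-- generating function of all partitions, is left to fix the constant of proportionality; at z = ζ
-- it is √2, which keeps the two rank differences apart. The substitution z ↦ z q² leaves the region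
-- of q-adic convergence, since q/z becomes 1/(q z). The functional equation is therefore used only
-- as a recurrence for coefficients, with negative indices folded in by the symmetry z ↔ 1/z. The
-- bilateral sum is likewise treated with quadratic weights in place of products such as (-u^{1-2n};
-- u²)_∞. In the final positivity argument one exponent is delicate: 2 is not a sum of distinct odd
-- numbers, so (-u; u²)_∞ has no term u², and each of the two places where that term would be wanted
-- is filled by another summand.

open import Level using (0ℓ)
open import Algebra.Bundles using (CommutativeRing; RawRing)
open import Data.Nat as ℕ using (ℕ; zero; suc; _≤_; _<_; _≥_; s≤s; z≤n)
import Data.Nat.Properties as ℕₚ
open import Data.Integer as ℤ using (ℤ; +_; -[1+_])
import Data.Integer.Properties as ℤₚ
open import Data.Maybe.Base using (Maybe; just; nothing)
open import Relation.Nullary using (¬_; yes; no)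
import Algebra.Properties.Semiring.Exp as Exp
import Algebra.Properties.Semiring.Mult as Mult
import Relation.Binary.PropositionalEquality as ≡
open ≡ using (_≡_)

-- A ring solver with integer coefficients for arbitrary commutative rings.

module IntegerSolver (R : CommutativeRing 0ℓ 0ℓ) where
  open CommutativeRing R
  open import Algebra.Solver.Ring.AlmostCommutativeRing
  open import Algebra.Properties.Semiring.Mult.TCOptimised semiring
  open import Algebra.Properties.Ring ring
  open import Algebra.Properties.AbelianGroup +-abelianGroup using (⁻¹-∙-comm)
  open import Relation.Binary.Reasoning.Setoid setoid

  private
    ⟦_⟧ℤ : ℤ → Carrier
    ⟦ + n ⟧ℤ = n × 1#
    ⟦ -[1+ n ] ⟧ℤ = - (suc n × 1#)

    cancel-1+ : ∀ a b → (1# + a) - (1# + b) ≈ a - b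
    cancel-1+ a b = begin
      (1# + a) - (1# + b)     ≈⟨ +-cong (+-comm 1# a) (sym (⁻¹-∙-comm 1# b)) ⟩
      (a + 1#) + (- 1# - b)   ≈⟨ +-assoc a 1# _ ⟩
      a + (1# + (- 1# - b))   ≈⟨ +-congˡ (sym (+-assoc 1# _ _)) ⟩
      a + ((1# - 1#) - b)     ≈⟨ +-congˡ (+-congʳ (-‿inverseʳ 1#)) ⟩
      a + (0# - b)            ≈⟨ +-congˡ (+-identityˡ _) ⟩
      a - b                   ∎

    ⊖-homo : ∀ m n → ⟦ m ℤ.⊖ n ⟧ℤ ≈ m × 1# - n × 1#
    ⊖-homo m zero = begin
      m × 1#      ≈⟨ +-identityʳ _ ⟨
      m × 1# + 0# ≈⟨ +-congˡ -0#≈0# ⟨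
      m × 1# - 0# ∎
    ⊖-homo zero (suc n) = sym (+-identityˡ _)
    ⊖-homo (suc m) (suc n) = begin
      ⟦ suc m ℤ.⊖ suc n ⟧ℤ        ≡⟨ ≡.cong ⟦_⟧ℤ (ℤₚ.[1+m]⊖[1+n]≡m⊖n m n) ⟩
      ⟦ m ℤ.⊖ n ⟧ℤ                ≈⟨ ⊖-homo m n ⟩
      m × 1# - n × 1#             ≈⟨ cancel-1+ _ _ ⟨
      (1# + m × 1#) - (1# + n × 1#) ≈⟨ +-cong (1+× m 1#) (-‿cong (1+× n 1#)) ⟨
      suc m × 1# - suc n × 1#     ∎

    +-homo : ∀ i j → ⟦ i ℤ.+ j ⟧ℤ ≈ ⟦ i ⟧ℤ + ⟦ j ⟧ℤ
    +-homo (+ m) (+ n) = ×-homo-+ 1# m n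
    +-homo (+ m) -[1+ n ] = ⊖-homo m (suc n)
    +-homo -[1+ m ] (+ n) = trans (⊖-homo n (suc m)) (+-comm _ _)
    +-homo -[1+ m ] -[1+ n ] = begin
      - (suc (suc (m ℕ.+ n)) × 1#)      ≡⟨ ≡.cong (λ k → - (suc k × 1#)) (≡.sym (ℕₚ.+-suc m n)) ⟩
      - ((suc m ℕ.+ suc n) × 1#)        ≈⟨ -‿cong (×-homo-+ 1# (suc m) (suc n)) ⟩
      - (suc m × 1# + suc n × 1#)       ≈⟨ ⁻¹-∙-comm _ _ ⟨
      - (suc m × 1#) - (suc n × 1#)     ∎

    -‿homo : ∀ i → ⟦ ℤ.- i ⟧ℤ ≈ - ⟦ i ⟧ℤ
    -‿homo (+ zero) = sym -0#≈0#
    -‿homo (+ suc n) = refl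
    -‿homo -[1+ n ] = sym (-‿involutive _)

    *-homo : ∀ i j → ⟦ i ℤ.* j ⟧ℤ ≈ ⟦ i ⟧ℤ * ⟦ j ⟧ℤ
    *-homo-neg : ∀ m j → ⟦ (ℤ.- (+ m)) ℤ.* j ⟧ℤ ≈ - (m × 1#) * ⟦ j ⟧ℤ
    *-homo⁺ : ∀ m j → ⟦ (+ m) ℤ.* j ⟧ℤ ≈ (m × 1#) * ⟦ j ⟧ℤ
    *-homo⁺ m (+ n) = begin
      ⟦ (+ m) ℤ.* (+ n) ⟧ℤ   ≡⟨ ≡.cong ⟦_⟧ℤ (≡.sym (ℤₚ.pos-* m n)) ⟩
      (m ℕ.* n) × 1#         ≈⟨ ×1-homo-* m n ⟩
      (m × 1#) * (n × 1#)    ∎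
    *-homo⁺ m -[1+ n ] = begin
      ⟦ (+ m) ℤ.* (ℤ.- (+ suc n)) ⟧ℤ ≡⟨ ≡.cong ⟦_⟧ℤ (≡.sym (ℤₚ.neg-distribʳ-* (+ m) (+ suc n))) ⟩
      ⟦ ℤ.- ((+ m) ℤ.* (+ suc n)) ⟧ℤ ≈⟨ -‿homo ((+ m) ℤ.* (+ suc n)) ⟩
      - ⟦ (+ m) ℤ.* (+ suc n) ⟧ℤ     ≈⟨ -‿cong (*-homo⁺ m (+ suc n)) ⟩
      - ((m × 1#) * (suc n × 1#))    ≈⟨ -‿distribʳ-* _ _ ⟩
      (m × 1#) * - (suc n × 1#)      ∎
    *-homo-neg m j = begin
      ⟦ (ℤ.- (+ m)) ℤ.* j ⟧ℤ   ≡⟨ ≡.cong ⟦_⟧ℤ (≡.sym (ℤₚ.neg-distribˡ-* (+ m) j)) ⟩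
      ⟦ ℤ.- ((+ m) ℤ.* j) ⟧ℤ   ≈⟨ -‿homo ((+ m) ℤ.* j) ⟩
      - ⟦ (+ m) ℤ.* j ⟧ℤ       ≈⟨ -‿cong (*-homo⁺ m j) ⟩
      - ((m × 1#) * ⟦ j ⟧ℤ)    ≈⟨ -‿distribˡ-* _ _ ⟩
      - (m × 1#) * ⟦ j ⟧ℤ      ∎
    *-homo (+ m) j = *-homo⁺ m j
    *-homo -[1+ m ] j = *-homo-neg (suc m) j

    ℤ-raw : RawRing 0ℓ 0ℓ
    ℤ-raw = record { Carrier = ℤ ; _≈_ = ≡._≡_ ; _+_ = ℤ._+_ ; _*_ = ℤ._*_ ; -_ = ℤ.-_ ; 0# = + 0 ; 1# = + 1 }

    morphism : ℤ-raw -Raw-AlmostCommutative⟶ fromCommutativeRing R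
    morphism = record
      { ⟦_⟧ = ⟦_⟧ℤ ; +-homo = +-homo ; *-homo = *-homo ; -‿homo = -‿homo ; 0-homo = refl ; 1-homo = refl }

    coeff≟ : ∀ i j → Maybe (⟦ i ⟧ℤ ≈ ⟦ j ⟧ℤ)
    coeff≟ i j with i ℤₚ.≟ j
    ... | yes ≡.refl = just refl
    ... | no _ = nothing

  open import Algebra.Solver.Ring ℤ-raw (fromCommutativeRing R) morphism coeff≟ public
    using (Polynomial; solve; con; _:+_; _:*_; _:-_; :-_; _:^_; _:=_)

  :0 :1 : ∀ {n} → Polynomial n
  :0 = con (+ 0)
  :1 = con (+ 1)

open import Data.Product using (Σ; ∃; _×_; _,_; proj₁; proj₂)
open import Data.Sum using (_⊎_; inj₁; inj₂)

parity : ∀ m → (∃ λ i → m ≡ i ℕ.+ i) ⊎ (∃ λ i → m ≡ suc (i ℕ.+ i))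
parity zero = inj₁ (0 , ≡.refl)
parity (suc m) with parity m
... | inj₁ (i , ≡.refl) = inj₂ (i , ≡.refl)
... | inj₂ (i , ≡.refl) = inj₁ (suc i , ≡.cong suc (≡.sym (ℕₚ.+-suc i i)))

-- A ring that is complete and separated for the q-adic topology: sum a is Σ qᵐ aₘ.
record CompleteRing : Set₁ where
  field
    ring : CommutativeRing 0ℓ 0ℓ
  open CommutativeRing ring renaming (Carrier to C) public hiding (ring)
  field
    q          : C
    sum        : (ℕ → C) → C
    sum-unfold : ∀ φ → sum φ ≈ φ 0 + q * sum (λ n → φ (suc n))
    separated  : ∀ x y → (∀ n → ∃ λ z → x ≈ y + Exp._^_ semiring q n * z) → x ≈ y

-- Congruences, power series and infinite products in a q-adically complete ring.

module Series (𝒞 : CompleteRing) where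
  open CompleteRing 𝒞 public
  open import Algebra.Properties.Semiring.Exp semiring public
  open import Algebra.Properties.CommutativeSemiring.Exp commutativeSemiring public using (^-distrib-*)
  open IntegerSolver ring public
  open import Algebra.Properties.Ring (CommutativeRing.ring ring) public
    using (-0#≈0#; -‿distribˡ-*; -‿distribʳ-*; -‿involutive)
  open import Relation.Binary.Reasoning.Setoid setoid public

  infix 4 _≈[_]_
  -- Congruence modulo `q ^ n`. Being a record and not an unfolding existential, it lets unification
  -- recover both sides and the modulus.
  record _≈[_]_ (x : C) (n : ℕ) (y : C) : Set where
    constructor _,_
    field
      quotient : C
      equation : x ≈ y + q ^ n * quotient
  open _≈[_]_

  ≈[]⇒≈ : ∀ {x y} → (∀ n → x ≈[ n ] y) → x ≈ y
  ≈[]⇒≈ {x} {y} h = separated x y (λ n → quotient (h n) , equation (h n))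

  ≈⇒≈[] : ∀ {x y} n → x ≈ y → x ≈[ n ] y
  ≈⇒≈[] {x} {y} n e = 0# , (begin
    x ≈⟨ e ⟩ y ≈⟨ solve 2 (λ y Q → y := y :+ Q :* :0) refl y (q ^ n) ⟩ y + q ^ n * 0# ∎)

  ≈[]-trans : ∀ {n x y z} → x ≈[ n ] y → y ≈[ n ] z → x ≈[ n ] z
  ≈[]-trans {n} {x} {y} {z} (a , e) (b , f) = a + b , (begin
    x ≈⟨ e ⟩ y + q ^ n * a ≈⟨ +-congʳ f ⟩ z + q ^ n * b + q ^ n * a
      ≈⟨ solve 4 (λ z Q a b → z :+ Q :* b :+ Q :* a := z :+ Q :* (a :+ b)) refl z (q ^ n) a b ⟩
    z + q ^ n * (a + b) ∎)

  ≈[]-sym : ∀ {n x y} → x ≈[ n ] y → y ≈[ n ] x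
  ≈[]-sym {n} {x} {y} (a , e) = - a , (begin
    y ≈⟨ solve 3 (λ y Q a → y := y :+ Q :* a :+ Q :* (:- a)) refl y (q ^ n) a ⟩
    y + q ^ n * a + q ^ n * - a ≈⟨ +-congʳ e ⟨ x + q ^ n * - a ∎)

  +-cong[] : ∀ {n x y x′ y′} → x ≈[ n ] y → x′ ≈[ n ] y′ → x + x′ ≈[ n ] y + y′
  +-cong[] {n} {x} {y} {x′} {y′} (a , e) (b , f) = a + b , (begin
    x + x′ ≈⟨ +-cong e f ⟩ (y + q ^ n * a) + (y′ + q ^ n * b)
     ≈⟨ solve 5 (λ y y′ Q a b → (y :+ Q :* a) :+ (y′ :+ Q :* b) := (y :+ y′) :+ Q :* (a :+ b)) refl y y′ (q ^ n) a b ⟩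
    (y + y′) + q ^ n * (a + b) ∎)

  *-cong[] : ∀ {n x y x′ y′} → x ≈[ n ] y → x′ ≈[ n ] y′ → x * x′ ≈[ n ] y * y′
  *-cong[] {n} {x} {y} {x′} {y′} (a , e) (b , f) = a * y′ + y * b + q ^ n * a * b , (begin
    x * x′ ≈⟨ *-cong e f ⟩ (y + q ^ n * a) * (y′ + q ^ n * b)
     ≈⟨ solve 5 (λ y y′ Q a b → (y :+ Q :* a) :* (y′ :+ Q :* b) := y :* y′ :+ Q :* (a :* y′ :+ y :* b :+ Q :* a :* b)) refl y y′ (q ^ n) a b ⟩
    y * y′ + q ^ n * (a * y′ + y * b + q ^ n * a * b) ∎)

  q*-cong[] : ∀ {n x y} → x ≈[ n ] y → q * x ≈[ suc n ] q * y
  q*-cong[] {n} {x} {y} (a , e) = a , (begin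
    q * x ≈⟨ *-congˡ e ⟩ q * (y + q ^ n * a)
      ≈⟨ solve 4 (λ q y Q a → q :* (y :+ Q :* a) := q :* y :+ q :* Q :* a) refl q y (q ^ n) a ⟩
    q * y + q * q ^ n * a ∎)

  ≈[]-weaken : ∀ {m n x y} → m ℕ.≤ n → x ≈[ n ] y → x ≈[ m ] y
  ≈[]-weaken {m} {n} {x} {y} m≤n (a , e) = q ^ (n ℕ.∸ m) * a , (begin
    x ≈⟨ e ⟩ y + q ^ n * a ≡⟨ ≡.cong (λ k → y + q ^ k * a) (≡.sym (ℕₚ.m+[n∸m]≡n m≤n)) ⟩
    y + q ^ (m ℕ.+ (n ℕ.∸ m)) * a ≈⟨ +-congˡ (*-congʳ (^-homo-* q m (n ℕ.∸ m))) ⟩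
    y + q ^ m * q ^ (n ℕ.∸ m) * a ≈⟨ +-congˡ (*-assoc _ _ _) ⟩
    y + q ^ m * (q ^ (n ℕ.∸ m) * a) ∎)

  -- Each unfolding of the equation gains a factor q, so F i - G i is divisible by every power of q.
  coinduction : ∀ {I : Set} (F G h k : I → C) (s : I → I) →
    (∀ i → F i ≈ h i + q * (k i * F (s i))) → (∀ i → G i ≈ h i + q * (k i * G (s i))) → ∀ i → F i ≈ G i
  coinduction F G h k s F≈ G≈ i = ≈[]⇒≈ (λ n → go n i)
    where
    go : ∀ n i → F i ≈[ n ] G i
    go zero i = F i - G i , solve 2 (λ x y → x := y :+ :1 :* (x :- y)) refl (F i) (G i)
    go (suc n) i = ≈[]-trans (≈⇒≈[] _ (F≈ i)) (≈[]-trans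
      (+-cong[] (≈⇒≈[] _ refl) (q*-cong[] (*-cong[] (≈⇒≈[] _ refl) (go n (s i)))))
      (≈[]-sym (≈⇒≈[] _ (G≈ i))))

  tail : (ℕ → C) → ℕ → C
  tail φ n = φ (suc n)

  -- Congruence is not an axiom of `CompleteRing`; it follows from the common unfolding. The
  -- coinduction runs over pairs of sequences packed with the proof that they agree.
  sum-cong : ∀ {φ ψ : ℕ → C} → (∀ n → φ n ≈ ψ n) → sum φ ≈ sum ψ
  sum-cong {φ} {ψ} φ≈ψ = coinduction {∃ λ φ → ∃ λ ψ → ∀ n → φ n ≈ ψ n}
    (λ i → sum (proj₁ i)) (λ i → sum (proj₁ (proj₂ i))) (λ i → proj₁ i 0) (λ _ → 1#)
    (λ { (φ , ψ , e) → tail φ , tail ψ , λ n → e (suc n) })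
    (λ { (φ , ψ , e) → trans (sum-unfold φ) (+-congˡ (*-congˡ (sym (*-identityˡ _)))) })
    (λ { (φ , ψ , e) → trans (sum-unfold ψ) (+-cong (sym (e 0)) (*-congˡ (sym (*-identityˡ _)))) })
    (φ , ψ , φ≈ψ)

  sum-+ : ∀ φ ψ → sum (λ n → φ n + ψ n) ≈ sum φ + sum ψ
  sum-+ φ ψ = coinduction {(ℕ → C) × (ℕ → C)}
    (λ { (φ , ψ) → sum (λ n → φ n + ψ n) }) (λ { (φ , ψ) → sum φ + sum ψ })
    (λ { (φ , ψ) → φ 0 + ψ 0 }) (λ _ → 1#) (λ { (φ , ψ) → tail φ , tail ψ })
    (λ { (φ , ψ) → trans (sum-unfold _) (+-congˡ (*-congˡ (sym (*-identityˡ _)))) })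
    (λ { (φ , ψ) → trans (+-cong (sum-unfold φ) (sum-unfold ψ))
       (solve 5 (λ a b q x y → (a :+ q :* x) :+ (b :+ q :* y) := (a :+ b) :+ q :* (:1 :* (x :+ y))) refl _ _ _ _ _) })
    (φ , ψ)

  sum-*ˡ : ∀ c φ → sum (λ n → c * φ n) ≈ c * sum φ
  sum-*ˡ c φ = coinduction {ℕ → C}
    (λ φ → sum (λ n → c * φ n)) (λ φ → c * sum φ) (λ φ → c * φ 0) (λ _ → 1#) tail
    (λ φ → trans (sum-unfold _) (+-congˡ (*-congˡ (sym (*-identityˡ _)))))
    (λ φ → trans (*-congˡ (sum-unfold φ))
       (solve 4 (λ c a q x → c :* (a :+ q :* x) := c :* a :+ q :* (:1 :* (c :* x))) refl _ _ _ _))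
    φ

  sum-swap : ∀ (φ : ℕ → ℕ → C) → sum (λ m → sum (λ n → φ m n)) ≈ sum (λ n → sum (λ m → φ m n))
  sum-swap φ = coinduction {ℕ → ℕ → C}
    (λ φ → sum (λ m → sum (λ n → φ m n))) (λ φ → sum (λ n → sum (λ m → φ m n)))
    (λ φ → sum (λ m → φ m 0)) (λ _ → 1#) (λ φ m n → φ m (suc n))
    (λ φ → begin
      sum (λ m → sum (φ m)) ≈⟨ sum-cong (λ m → sum-unfold (φ m)) ⟩
      sum (λ m → φ m 0 + q * sum (tail (φ m))) ≈⟨ sum-+ _ _ ⟩
      sum (λ m → φ m 0) + sum (λ m → q * sum (tail (φ m))) ≈⟨ +-congˡ (sum-*ˡ q _) ⟩
      sum (λ m → φ m 0) + q * sum (λ m → sum (tail (φ m))) ≈⟨ +-congˡ (*-congˡ (*-identityˡ _)) ⟨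
      sum (λ m → φ m 0) + q * (1# * sum (λ m → sum (tail (φ m)))) ∎)
    (λ φ → trans (sum-unfold _) (+-congˡ (*-congˡ (sym (*-identityˡ _)))))
    φ

  -- ev x φ is the value of the power series φ at q x.
  ev : C → (ℕ → C) → C
  ev x φ = sum (λ n → x ^ n * φ n)

  ev-cong : ∀ {x φ ψ} → (∀ n → φ n ≈ ψ n) → ev x φ ≈ ev x ψ
  ev-cong e = sum-cong (λ n → *-congˡ (e n))

  ev-congˣ : ∀ {x y} φ → x ≈ y → ev x φ ≈ ev y φ
  ev-congˣ φ e = sum-cong (λ n → *-congʳ (^-congˡ n e))

  ev-unfold : ∀ x φ → ev x φ ≈ φ 0 + q * x * ev x (tail φ)
  ev-unfold x φ = begin
    ev x φ ≈⟨ sum-unfold _ ⟩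
    1# * φ 0 + q * sum (λ n → x * x ^ n * φ (suc n)) ≈⟨ +-cong (*-identityˡ _) (*-congˡ (sum-cong (λ n → *-assoc _ _ _))) ⟩
    φ 0 + q * sum (λ n → x * (x ^ n * φ (suc n))) ≈⟨ +-congˡ (*-congˡ (sum-*ˡ x _)) ⟩
    φ 0 + q * (x * ev x (tail φ)) ≈⟨ +-congˡ (*-assoc _ _ _) ⟨
    φ 0 + q * x * ev x (tail φ) ∎

  ev-+ : ∀ x φ ψ → ev x (λ n → φ n + ψ n) ≈ ev x φ + ev x ψ
  ev-+ x φ ψ = trans (sum-cong (λ n → distribˡ _ _ _)) (sum-+ _ _)

  ev-*ˡ : ∀ x c φ → ev x (λ n → c * φ n) ≈ c * ev x φ
  ev-*ˡ x c φ = trans (sum-cong (λ n → solve 3 (λ a c f → a :* (c :* f) := c :* (a :* f)) refl _ _ _)) (sum-*ˡ c _)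

  ev-neg : ∀ x φ → ev x (λ n → - φ n) ≈ - ev x φ
  ev-neg x φ = begin
    ev x (λ n → - φ n) ≈⟨ ev-cong (λ n → solve 1 (λ a → :- a := (:- :1) :* a) refl (φ n)) ⟩
    ev x (λ n → - 1# * φ n) ≈⟨ ev-*ˡ x (- 1#) φ ⟩
    - 1# * ev x φ ≈⟨ solve 1 (λ a → (:- :1) :* a := :- a) refl (ev x φ) ⟩
    - ev x φ ∎

  ev-- : ∀ x φ ψ → ev x (λ n → φ n - ψ n) ≈ ev x φ - ev x ψ
  ev-- x φ ψ = trans (ev-+ x φ (λ n → - ψ n)) (+-congˡ (ev-neg x ψ))

  ev-scale : ∀ b x φ → ev (b * x) φ ≈ ev x (λ n → b ^ n * φ n)
  ev-scale b x φ = sum-cong (λ n → begin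
    (b * x) ^ n * φ n ≈⟨ *-congʳ (^-distrib-* b x n) ⟩
    b ^ n * x ^ n * φ n ≈⟨ solve 3 (λ a b c → a :* b :* c := b :* (a :* c)) refl _ _ _ ⟩
    x ^ n * (b ^ n * φ n) ∎)

  ev-swap : ∀ x y (φ : ℕ → ℕ → C) → ev x (λ m → ev y (λ n → φ m n)) ≈ ev y (λ n → ev x (λ m → φ m n))
  ev-swap x y φ = begin
    sum (λ m → x ^ m * sum (λ n → y ^ n * φ m n)) ≈⟨ sum-cong (λ m → sum-*ˡ _ _) ⟨
    sum (λ m → sum (λ n → x ^ m * (y ^ n * φ m n))) ≈⟨ sum-swap _ ⟩
    sum (λ n → sum (λ m → x ^ m * (y ^ n * φ m n)))
      ≈⟨ sum-cong (λ n → sum-cong (λ m → solve 3 (λ a b c → a :* (b :* c) := b :* (a :* c)) refl _ _ _)) ⟩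
    sum (λ n → sum (λ m → y ^ n * (x ^ m * φ m n))) ≈⟨ sum-cong (λ n → sum-*ˡ _ _) ⟩
    sum (λ n → y ^ n * sum (λ m → x ^ m * φ m n)) ∎

  shift : (ℕ → C) → ℕ → C
  shift φ zero = 0#
  shift φ (suc n) = φ n

  ev-shift : ∀ x φ → ev x (shift φ) ≈ q * x * ev x φ
  ev-shift x φ = trans (ev-unfold x (shift φ)) (+-identityˡ _)

  -- With X = `q * x`, the argument `q * x * x` stands for X², because `ev` supplies one factor `q`
  -- itself.
  ev-even-odd : ∀ x φ → ev x φ ≈ ev (q * x * x) (λ n → φ (n ℕ.+ n)) + q * x * ev (q * x * x) (λ n → φ (suc (n ℕ.+ n)))
  ev-even-odd x φ = coinduction {ℕ → C} (ev x)
    (λ φ → ev (q * x * x) (λ n → φ (n ℕ.+ n)) + q * x * ev (q * x * x) (λ n → φ (suc (n ℕ.+ n))))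
    (λ φ → φ 0 + q * x * φ 1) (λ _ → x * (q * x)) (λ φ n → φ (suc (suc n)))
    (λ φ → begin
      ev x φ ≈⟨ trans (ev-unfold x φ) (+-congˡ (*-congˡ (ev-unfold x (tail φ)))) ⟩
      φ 0 + q * x * (φ 1 + q * x * ev x (tail (tail φ)))
        ≈⟨ solve 5 (λ a b q x e → a :+ q :* x :* (b :+ q :* x :* e) := a :+ q :* x :* b :+ q :* (x :* (q :* x) :* e)) refl _ _ _ _ _ ⟩
      φ 0 + q * x * φ 1 + q * (x * (q * x) * ev x (tail (tail φ))) ∎)
    (λ φ → begin
      ev X (λ n → φ (n ℕ.+ n)) + q * x * ev X (λ n → φ (suc (n ℕ.+ n)))
        ≈⟨ +-cong (ev-unfold X _) (*-congˡ (ev-unfold X _)) ⟩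
      (φ 0 + q * X * ev X (λ n → φ (suc n ℕ.+ suc n))) + q * x * (φ 1 + q * X * ev X (λ n → φ (suc (suc n ℕ.+ suc n))))
        ≈⟨ +-cong (+-congˡ (*-congˡ (ev-cong (λ n → reflexive (≡.cong (λ k → φ (suc k)) (ℕₚ.+-suc n n))))))
                  (*-congˡ (+-congˡ (*-congˡ (ev-cong (λ n → reflexive (≡.cong (λ k → φ (suc (suc k))) (ℕₚ.+-suc n n))))))) ⟩
      (φ 0 + q * X * ev X (λ n → φ (suc (suc (n ℕ.+ n))))) + q * x * (φ 1 + q * X * ev X (λ n → φ (suc (suc (suc (n ℕ.+ n))))))
        ≈⟨ solve 6 (λ a b q x e f → (a :+ q :* (q :* x :* x) :* e) :+ q :* x :* (b :+ q :* (q :* x :* x) :* f)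
             := a :+ q :* x :* b :+ q :* (x :* (q :* x) :* (e :+ q :* x :* f))) refl _ _ _ _ _ _ ⟩
      φ 0 + q * x * φ 1 + q * (x * (q * x) * (ev X (λ n → φ (suc (suc (n ℕ.+ n)))) + q * x * ev X (λ n → φ (suc (suc (suc (n ℕ.+ n))))))) ∎)
    φ
    where X = q * x * x

  geom : C → C
  geom x = ev x (λ _ → 1#)

  geom-inverse : ∀ x → (1# - q * x) * geom x ≈ 1#
  geom-inverse x = begin
    (1# - q * x) * geom x ≈⟨ solve 3 (λ q x g → (:1 :- q :* x) :* g := g :- q :* x :* g) refl q x (geom x) ⟩
    geom x - q * x * geom x ≈⟨ +-congʳ (ev-unfold x _) ⟩
    1# + q * x * geom x - q * x * geom x ≈⟨ solve 1 (λ a → :1 :+ a :- a := :1) refl (q * x * geom x) ⟩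
    1# ∎

  geom-cong : ∀ {x y} → x ≈ y → geom x ≈ geom y
  geom-cong = ev-congˣ _

  partial : C → (ℕ → C) → ℕ → C
  partial x φ zero = 0#
  partial x φ (suc n) = partial x φ n + (q * x) ^ n * φ n

  ev-partial : ∀ x φ n → ev x φ ≈ partial x φ n + (q * x) ^ n * ev x (λ k → φ (n ℕ.+ k))
  ev-partial x φ zero = solve 1 (λ a → a := :0 :+ :1 :* a) refl _
  ev-partial x φ (suc n) = begin
    ev x φ ≈⟨ ev-partial x φ n ⟩
    A + B * ev x (λ k → φ (n ℕ.+ k)) ≈⟨ +-congˡ (*-congˡ (ev-unfold x _)) ⟩
    A + B * (φ (n ℕ.+ 0) + q * x * ev x (λ k → φ (n ℕ.+ suc k)))
      ≈⟨ +-congˡ (*-congˡ (+-cong (reflexive (≡.cong φ (ℕₚ.+-identityʳ n)))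
           (*-congˡ (ev-cong (λ k → reflexive (≡.cong φ (ℕₚ.+-suc n k))))))) ⟩
    A + B * (φ n + q * x * ev x (λ k → φ (suc (n ℕ.+ k))))
      ≈⟨ solve 5 (λ A B f X e → A :+ B :* (f :+ X :* e) := A :+ B :* f :+ X :* B :* e) refl _ _ _ _ _ ⟩
    A + B * φ n + q * x * B * ev x (λ k → φ (suc (n ℕ.+ k))) ∎
    where
    A = partial x φ n
    B = (q * x) ^ n

  [qx]^n : ∀ x n → (q * x) ^ n ≈ q ^ n * x ^ n
  [qx]^n x n = ^-distrib-* q x n

  ev-≈[] : ∀ x φ n → ev x φ ≈[ n ] partial x φ n
  ev-≈[] x φ n = x ^ n * ev x (λ k → φ (n ℕ.+ k)) , (begin
    ev x φ ≈⟨ ev-partial x φ n ⟩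
    _ ≈⟨ +-congˡ (trans (*-congʳ ([qx]^n x n)) (*-assoc _ _ _)) ⟩
    partial x φ n + q ^ n * (x ^ n * ev x (λ k → φ (n ℕ.+ k))) ∎)

  IsLimit : (ℕ → C) → C → Set
  IsLimit s L = ∀ n → L ≈[ n ] s n

  limit-unique : ∀ {s t L M} → (∀ n → s n ≈ t n) → IsLimit s L → IsLimit t M → L ≈ M
  limit-unique s≈t sL tM = ≈[]⇒≈ (λ n → ≈[]-trans (sL n) (≈[]-trans (≈⇒≈[] n (s≈t n)) (≈[]-sym (tM n))))

  limit-* : ∀ {s t L M} → IsLimit s L → IsLimit t M → IsLimit (λ n → s n * t n) (L * M)
  limit-* sL tM n = *-cong[] (sL n) (tM n)

  -- The partial products of (-qx ; qb)_∞.
  poch : C → C → ℕ → C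
  poch x b zero = 1#
  poch x b (suc n) = poch x b n * (1# + q * x * (q * b) ^ n)

  -- The product as 1 plus the sum of the successive differences of its partial products. The
  -- resulting form `1# + q * _` is also what makes it invertible by `geom`.
  poch∞ : C → C → C
  poch∞ x b = 1# + q * (x * ev b (poch x b))

  poch-partial : ∀ x b n → poch x b n ≈ 1# + q * x * partial b (poch x b) n
  poch-partial x b zero = solve 1 (λ a → :1 := :1 :+ a :* :0) refl _
  poch-partial x b (suc n) = begin
    A * (1# + q * x * B) ≈⟨ solve 3 (λ A X B → A :* (:1 :+ X :* B) := A :+ X :* (B :* A)) refl A (q * x) B ⟩
    A + q * x * (B * A) ≈⟨ +-congʳ (poch-partial x b n) ⟩
    1# + q * x * D + q * x * (B * A) ≈⟨ solve 4 (λ X D B A → :1 :+ X :* D :+ X :* (B :* A) := :1 :+ X :* (D :+ B :* A)) refl _ _ _ _ ⟩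
    1# + q * x * (D + B * A) ∎
    where
    A = poch x b n
    B = (q * b) ^ n
    D = partial b (poch x b) n

  poch-limit : ∀ x b → IsLimit (poch x b) (poch∞ x b)
  poch-limit x b n = ≈[]-trans
    (+-cong[] (≈⇒≈[] _ refl) (≈[]-trans (≈⇒≈[] _ (sym (*-assoc q x _))) (*-cong[] (≈⇒≈[] _ refl) (ev-≈[] b _ n))))
    (≈⇒≈[] _ (sym (poch-partial x b n)))

  poch⁻¹ : C → C → C
  poch⁻¹ x b = geom (- (x * ev b (poch x b)))

  poch-inverse : ∀ x b → poch∞ x b * poch⁻¹ x b ≈ 1#
  poch-inverse x b = trans (*-congʳ (solve 2 (λ q a → :1 :+ q :* a := :1 :- q :* (:- a)) refl _ _)) (geom-inverse _)

  unit-cancel : ∀ {a a⁻¹ x y} → a * a⁻¹ ≈ 1# → a * x ≈ a * y → x ≈ y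
  unit-cancel {a} {a⁻¹} {x} {y} inv e = begin
    x ≈⟨ *-identityˡ x ⟨ 1# * x ≈⟨ *-congʳ inv ⟨ a * a⁻¹ * x ≈⟨ solve 3 (λ a b x → a :* b :* x := b :* (a :* x)) refl a a⁻¹ x ⟩
    a⁻¹ * (a * x) ≈⟨ *-congˡ e ⟩ a⁻¹ * (a * y) ≈⟨ solve 3 (λ a b x → b :* (a :* x) := a :* b :* x) refl a a⁻¹ y ⟩
    a * a⁻¹ * y ≈⟨ *-congʳ inv ⟩ 1# * y ≈⟨ *-identityˡ y ⟩ y ∎

  poch-cancel : ∀ x b {y z} → poch∞ x b * y ≈ poch∞ x b * z → y ≈ z
  poch-cancel x b = unit-cancel (poch-inverse x b)

-- Two-sided series that are symmetric under z ↔ 1/z.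

module Grouping (𝒞 : CompleteRing) where
  open Series 𝒞

  -- sym-ev x y c = c₀ + Σ_{m ≥ 1} (Xᵐ + Yᵐ) cₘ with X = q x and Y = q y.
  sym-ev : C → C → (ℕ → C) → C
  sym-ev x y c = c 0 + (q * x * ev x (tail c) + q * y * ev y (tail c))

  sym-ev-cong : ∀ {x y c d} → (∀ m → c m ≈ d m) → sym-ev x y c ≈ sym-ev x y d
  sym-ev-cong e = +-cong (e 0) (+-cong (*-congˡ (ev-cong (λ m → e (suc m)))) (*-congˡ (ev-cong (λ m → e (suc m)))))

  sym-ev-+ : ∀ x y c d → sym-ev x y (λ m → c m + d m) ≈ sym-ev x y c + sym-ev x y d
  sym-ev-+ x y c d = begin
    _ ≈⟨ +-congˡ (+-cong (*-congˡ (ev-+ x _ _)) (*-congˡ (ev-+ y _ _))) ⟩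
    _ ≈⟨ solve 8 (λ a b X e f Y g h → (a :+ b) :+ (X :* (e :+ f) :+ Y :* (g :+ h))
           := (a :+ (X :* e :+ Y :* g)) :+ (b :+ (X :* f :+ Y :* h))) refl _ _ _ _ _ _ _ _ ⟩
    _ ∎

  sym-ev-*ˡ : ∀ x y k c → sym-ev x y (λ m → k * c m) ≈ k * sym-ev x y c
  sym-ev-*ˡ x y k c = begin
    _ ≈⟨ +-congˡ (+-cong (*-congˡ (ev-*ˡ x k _)) (*-congˡ (ev-*ˡ y k _))) ⟩
    _ ≈⟨ solve 6 (λ k a X e Y f → k :* a :+ (X :* (k :* e) :+ Y :* (k :* f)) := k :* (a :+ (X :* e :+ Y :* f))) refl _ _ _ _ _ _ ⟩
    _ ∎

  diagonal : C → (ℕ → ℕ → C) → ℕ → C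
  diagonal w G m = ev w (λ k → G (k ℕ.+ m) k)

  step : (ℕ → ℕ → C) → ℕ → ℕ → C
  step G a c = G (suc a) (suc c)

  -- The terms with a = 0 or c = 0 are the k = 0 terms of the diagonals. What remains is the same
  -- double series for `step G`, with a factor X Y, so the coinduction applies. The terms with a < c
  -- are reflected by the symmetry of `G`.
  group-by-difference : ∀ x y (G : ℕ → ℕ → C) → (∀ a c → G a c ≈ G c a) →
    ev x (λ a → ev y (λ c → G a c)) ≈ sym-ev x y (diagonal (q * x * y) G)
  group-by-difference x y G G-sym = coinduction {∃ λ G → ∀ a c → G a c ≈ G c a}
    (λ { (G , _) → ev x (λ a → ev y (λ c → G a c)) })
    (λ { (G , _) → sym-ev x y (diagonal (q * x * y) G) })
    (λ { (G , _) → sym-ev x y (λ m → G m 0) }) (λ _ → x * (q * y))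
    (λ { (G , s) → step G , λ a c → s (suc a) (suc c) })
    (λ { (G , s) → begin
      ev x (λ a → ev y (G a)) ≈⟨ ev-unfold x _ ⟩
      ev y (G 0) + q * x * ev x (λ a → ev y (G (suc a)))
        ≈⟨ +-cong (ev-unfold y _) (*-congˡ (ev-cong (λ a → ev-unfold y _))) ⟩
      (G 0 0 + q * y * ev y (λ c → G 0 (suc c))) + q * x * ev x (λ a → G (suc a) 0 + q * y * ev y (step G a))
        ≈⟨ +-cong (+-congˡ (*-congˡ (ev-cong (λ c → s 0 (suc c))))) (*-congˡ (trans (ev-+ x _ _) (+-congˡ (ev-*ˡ x _ _)))) ⟩
      (G 0 0 + q * y * ev y (λ c → G (suc c) 0)) + q * x * (ev x (λ a → G (suc a) 0) + q * y * ev x (λ a → ev y (step G a)))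
        ≈⟨ solve 7 (λ g q x y e f r → (g :+ q :* y :* e) :+ q :* x :* (f :+ q :* y :* r)
             := g :+ (q :* x :* f :+ q :* y :* e) :+ q :* (x :* (q :* y) :* r)) refl _ _ _ _ _ _ _ ⟩
      sym-ev x y (λ m → G m 0) + q * (x * (q * y) * ev x (λ a → ev y (step G a))) ∎ })
    (λ { (G , s) → begin
      sym-ev x y (diagonal (q * x * y) G) ≈⟨ sym-ev-cong {d = λ m → G m 0 + q * (q * x * y) * diagonal (q * x * y) (step G) m} (λ m → ev-unfold (q * x * y) (λ k → G (k ℕ.+ m) k)) ⟩
      sym-ev x y (λ m → G m 0 + q * (q * x * y) * diagonal (q * x * y) (step G) m) ≈⟨ sym-ev-+ x y (λ m → G m 0) (λ m → q * (q * x * y) * diagonal (q * x * y) (step G) m) ⟩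
      sym-ev x y (λ m → G m 0) + sym-ev x y (λ m → q * (q * x * y) * diagonal (q * x * y) (step G) m) ≈⟨ +-congˡ (sym-ev-*ˡ x y _ (diagonal (q * x * y) (step G))) ⟩
      sym-ev x y (λ m → G m 0) + q * (q * x * y) * sym-ev x y (diagonal (q * x * y) (step G))
        ≈⟨ +-congˡ (solve 4 (λ q x y r → q :* (q :* x :* y) :* r := q :* (x :* (q :* y) :* r)) refl _ _ _ _) ⟩
      sym-ev x y (λ m → G m 0) + q * (x * (q * y) * sym-ev x y (diagonal (q * x * y) (step G))) ∎ })
    (G , G-sym)

  norm : ∀ x y φ → ev x φ * ev y φ ≈ sym-ev x y (diagonal (q * x * y) (λ a c → φ a * φ c))
  norm x y φ = begin
    ev x φ * ev y φ ≈⟨ trans (*-comm _ _) (sym (ev-*ˡ x _ _)) ⟩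
    ev x (λ a → ev y φ * φ a) ≈⟨ ev-cong (λ a → trans (*-comm _ _) (sym (ev-*ˡ y _ _))) ⟩
    ev x (λ a → ev y (λ c → φ a * φ c)) ≈⟨ group-by-difference x y _ (λ a c → *-comm _ _) ⟩
    _ ∎

  -- The coefficients of (X + Y) · sym-ev x y c when X Y = p.
  neighbours : C → (ℕ → C) → ℕ → C
  neighbours p c zero = p * c 1 + p * c 1
  neighbours p c (suc m) = c m + p * c (suc (suc m))

  sym-ev-neighbours : ∀ x y c → (q * x + q * y) * sym-ev x y c ≈ sym-ev x y (neighbours (q * x * (q * y)) c)
  sym-ev-neighbours x y c = sym (begin
    p * c 1 + p * c 1 + (q * x * ev x (λ m → c m + p * c (suc (suc m))) + q * y * ev y (λ m → c m + p * c (suc (suc m))))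
      ≈⟨ +-congˡ (+-cong (*-congˡ (part x)) (*-congˡ (part y))) ⟩
    p * c 1 + p * c 1 + (q * x * (c 0 + q * x * Ex₁ + p * Ex₂) + q * y * (c 0 + q * y * Ey₁ + p * Ey₂))
      ≈⟨ solve 9 (λ q x y c₀ c₁ Ex₁ Ex₂ Ey₁ Ey₂ → let p = q :* x :* (q :* y) in
           p :* c₁ :+ p :* c₁ :+ (q :* x :* (c₀ :+ q :* x :* Ex₁ :+ p :* Ex₂) :+ q :* y :* (c₀ :+ q :* y :* Ey₁ :+ p :* Ey₂))
           := (q :* x :+ q :* y) :* c₀ :+ (q :* x :* (q :* x) :* Ex₁ :+ q :* y :* (q :* y) :* Ey₁)
              :+ p :* ((c₁ :+ q :* x :* Ex₂) :+ (c₁ :+ q :* y :* Ey₂))) refl _ _ _ _ _ _ _ _ _ ⟩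
    (q * x + q * y) * c 0 + (q * x * (q * x) * Ex₁ + q * y * (q * y) * Ey₁)
        + p * ((c 1 + q * x * Ex₂) + (c 1 + q * y * Ey₂))
      ≈⟨ +-congˡ (*-congˡ (+-cong (ev-unfold x _) (ev-unfold y _))) ⟨
    (q * x + q * y) * c 0 + (q * x * (q * x) * Ex₁ + q * y * (q * y) * Ey₁) + p * (Ex₁ + Ey₁)
      ≈⟨ solve 6 (λ q x y c₀ Ex₁ Ey₁ →
           (q :* x :+ q :* y) :* c₀ :+ (q :* x :* (q :* x) :* Ex₁ :+ q :* y :* (q :* y) :* Ey₁) :+ q :* x :* (q :* y) :* (Ex₁ :+ Ey₁)
           := (q :* x :+ q :* y) :* (c₀ :+ (q :* x :* Ex₁ :+ q :* y :* Ey₁))) refl _ _ _ _ _ _ ⟩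
    (q * x + q * y) * sym-ev x y c ∎)
    where
    p = q * x * (q * y)
    Ex₁ = ev x (tail c)
    Ex₂ = ev x (tail (tail c))
    Ey₁ = ev y (tail c)
    Ey₂ = ev y (tail (tail c))
    part : ∀ x → ev x (λ m → c m + p * c (suc (suc m))) ≈ c 0 + q * x * ev x (tail c) + p * ev x (tail (tail c))
    part x = trans (ev-+ x _ _) (+-cong (ev-unfold x c) (ev-*ˡ x p _))

-- q-binomial coefficients and the coefficients of R(z).

module Gaussian (𝒞 : CompleteRing) (b : CompleteRing.C 𝒞) where
  open Series 𝒞
  open Grouping 𝒞

  -- gauss a c is the q-binomial coefficient [a+c choose c] in base b.
  gauss : ℕ → ℕ → C
  gauss zero c = 1#
  gauss (suc a) zero = 1#
  gauss (suc a) (suc c) = b ^ suc c * gauss a (suc c) + gauss (suc a) c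

  gauss-0ʳ : ∀ a → gauss a 0 ≈ 1#
  gauss-0ʳ zero = refl
  gauss-0ʳ (suc a) = refl

  -- The quotient formula for q-binomial coefficients, free of division. The induction step of
  -- either ratio needs both ratios at the previous index, hence the mutual recursion.
  gauss-ratioʳ : ∀ a c → (1# - b ^ suc c) * gauss a (suc c) ≈ (1# - b ^ (a ℕ.+ suc c)) * gauss a c
  gauss-ratioˡ : ∀ a c → (1# - b ^ suc a) * gauss (suc a) c ≈ (1# - b ^ (a ℕ.+ suc c)) * gauss a c
  gauss-ratioʳ zero c = refl
  gauss-ratioʳ (suc a) c = begin
    (1# - b ^ suc c) * (b ^ suc c * gauss a (suc c) + gauss (suc a) c)
      ≈⟨ solve 3 (λ B g h → (:1 :- B) :* (B :* g :+ h) := B :* ((:1 :- B) :* g) :+ (:1 :- B) :* h) refl (b ^ suc c) _ _ ⟩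
    b ^ suc c * ((1# - b ^ suc c) * gauss a (suc c)) + (1# - b ^ suc c) * gauss (suc a) c
      ≈⟨ +-congʳ (*-congˡ (trans (gauss-ratioʳ a c) (sym (gauss-ratioˡ a c)))) ⟩
    b ^ suc c * ((1# - b ^ suc a) * gauss (suc a) c) + (1# - b ^ suc c) * gauss (suc a) c
      ≈⟨ solve 3 (λ B A g → B :* ((:1 :- A) :* g) :+ (:1 :- B) :* g := (:1 :- A :* B) :* g) refl (b ^ suc c) (b ^ suc a) _ ⟩
    (1# - b ^ suc a * b ^ suc c) * gauss (suc a) c ≈⟨ *-congʳ (+-congˡ (-‿cong (^-homo-* b (suc a) (suc c)))) ⟨
    (1# - b ^ (suc a ℕ.+ suc c)) * gauss (suc a) c ∎
  gauss-ratioˡ a zero = begin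
    (1# - b ^ suc a) * 1# ≈⟨ *-congʳ (+-congˡ (-‿cong (reflexive (≡.cong (b ^_) (ℕₚ.+-comm 1 a))))) ⟩
    (1# - b ^ (a ℕ.+ 1)) * 1# ≈⟨ *-congˡ (gauss-0ʳ a) ⟨
    (1# - b ^ (a ℕ.+ 1)) * gauss a 0 ∎
  gauss-ratioˡ a (suc c) = begin
    (1# - b ^ suc a) * (b ^ suc c * gauss a (suc c) + gauss (suc a) c)
      ≈⟨ solve 4 (λ A B g h → (:1 :- A) :* (B :* g :+ h) := (:1 :- A) :* B :* g :+ (:1 :- A) :* h) refl _ _ _ _ ⟩
    (1# - b ^ suc a) * b ^ suc c * gauss a (suc c) + (1# - b ^ suc a) * gauss (suc a) c
      ≈⟨ +-congˡ (trans (gauss-ratioˡ a c) (sym (gauss-ratioʳ a c))) ⟩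
    (1# - b ^ suc a) * b ^ suc c * gauss a (suc c) + (1# - b ^ suc c) * gauss a (suc c)
      ≈⟨ solve 3 (λ A B g → (:1 :- A) :* B :* g :+ (:1 :- B) :* g := (:1 :- A :* B) :* g) refl _ _ _ ⟩
    (1# - b ^ suc a * b ^ suc c) * gauss a (suc c) ≈⟨ *-congʳ (+-congˡ (-‿cong (^-homo-* b (suc a) (suc c)))) ⟨
    (1# - b ^ (suc a ℕ.+ suc c)) * gauss a (suc c) ≈⟨ *-congʳ (+-congˡ (-‿cong (reflexive (≡.cong (b ^_) (≡.sym (ℕₚ.+-suc a (suc c))))))) ⟩
    (1# - b ^ (a ℕ.+ suc (suc c))) * gauss a (suc c) ∎

  gauss-exchange : ∀ a c → (1# - b ^ suc a) * gauss (suc a) c ≈ (1# - b ^ suc c) * gauss a (suc c)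
  gauss-exchange a c = trans (gauss-ratioˡ a c) (sym (gauss-ratioʳ a c))

  gauss-pascalʳ : ∀ a c → gauss (suc a) (suc c) ≈ gauss a (suc c) + b ^ suc a * gauss (suc a) c
  gauss-pascalʳ a c = begin
    B * g + h ≈⟨ solve 4 (λ A B g h → B :* g :+ h := (:1 :- A) :* h :+ (A :* h :+ B :* g)) refl A B g h ⟩
    (1# - A) * h + (A * h + B * g) ≈⟨ +-congʳ (gauss-exchange a c) ⟩
    (1# - B) * g + (A * h + B * g) ≈⟨ solve 4 (λ A B g h → (:1 :- B) :* g :+ (A :* h :+ B :* g) := g :+ A :* h) refl A B g h ⟩
    g + A * h ∎
    where
    A = b ^ suc a
    B = b ^ suc c
    g = gauss a (suc c)
    h = gauss (suc a) c

  gauss-sym : ∀ a c → gauss a c ≈ gauss c a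
  gauss-sym zero c = sym (gauss-0ʳ c)
  gauss-sym (suc a) zero = refl
  gauss-sym (suc a) (suc c) = begin
    b ^ suc c * gauss a (suc c) + gauss (suc a) c ≈⟨ +-cong (*-congˡ (gauss-sym a (suc c))) (gauss-sym (suc a) c) ⟩
    b ^ suc c * gauss (suc c) a + gauss c (suc a) ≈⟨ +-comm _ _ ⟩
    gauss c (suc a) + b ^ suc c * gauss (suc c) a ≈⟨ gauss-pascalʳ c a ⟨
    gauss (suc c) (suc a) ∎

  -- The mixed difference [a+c+2] - [a+c+1] - [a+c+1] + [a+c] only sees the corner.
  gauss-mixed : ∀ a c → gauss (suc a) (suc c) ≈ gauss a (suc c) + gauss (suc a) c - gauss a c + b ^ (a ℕ.+ suc c) * gauss a c
  gauss-mixed a c = begin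
    B * g + h ≈⟨ solve 3 (λ B g h → B :* g :+ h := g :+ h :- (:1 :- B) :* g) refl B g h ⟩
    g + h - (1# - B) * g ≈⟨ +-congˡ (-‿cong (gauss-ratioʳ a c)) ⟩
    g + h - (1# - E) * gauss a c ≈⟨ solve 4 (λ g h E k → g :+ h :- (:1 :- E) :* k := g :+ h :- k :+ E :* k) refl g h E _ ⟩
    g + h - gauss a c + E * gauss a c ∎
    where
    B = b ^ suc c
    E = b ^ (a ℕ.+ suc c)
    g = gauss a (suc c)
    h = gauss (suc a) c

  -- row x D = 1 / (X ; b)_{D+1} with X = q x.
  row : C → ℕ → C
  row x zero = geom x
  row x (suc D) = row x D * geom (x * b ^ suc D)

  row-cong : ∀ {x y} D → x ≈ y → row x D ≈ row y D
  row-cong zero e = geom-cong e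
  row-cong (suc D) e = *-cong (row-cong D e) (geom-cong (*-congʳ e))

  row-step : ∀ x D → row x (suc D) ≈ geom x * row (b * x) D
  row-step x zero = *-congˡ (geom-cong (solve 2 (λ x b → x :* (b :* :1) := b :* x) refl x b))
  row-step x (suc D) = begin
    row x (suc D) * geom (x * b ^ suc (suc D)) ≈⟨ *-cong (row-step x D) (geom-cong (solve 3 (λ x b B → x :* (b :* B) := b :* x :* B) refl x b (b ^ suc D))) ⟩
    geom x * row (b * x) D * geom (b * x * b ^ suc D) ≈⟨ *-assoc _ _ _ ⟩
    geom x * row (b * x) (suc D) ∎

  -- Σ_D (X Y)^D b^{D²} / ((X; b)_{D+1} (Y; b)_{D+1}) with X = `q * x` and Y = `q * y`. The
  -- arguments stay independent of each other because the recursion replaces them by `b * x` and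
  -- `b * y`.
  symbols : C → C → C
  symbols x y = ev (q * x * y) (λ D → b ^ (D ℕ.* D) * (row x D * row y D))

  symbols-step : ∀ x y → symbols x y ≈ geom x * geom y + q * (geom x * geom y * b * (q * x * y) * symbols (b * x) (b * y))
  symbols-step x y = begin
    symbols x y ≈⟨ ev-unfold (q * x * y) _ ⟩
    1# * (geom x * geom y) + q * (q * x * y) * ev (q * x * y) (λ D → b ^ (suc D ℕ.* suc D) * (row x (suc D) * row y (suc D)))
      ≈⟨ +-cong (*-identityˡ _) (*-congˡ (trans (ev-cong term) (trans (ev-*ˡ _ _ _) (*-congˡ (sym (ev-scale (b * b) _ _)))))) ⟩
    geom x * geom y + q * (q * x * y) * (b * (geom x * geom y) * ev (b * b * (q * x * y)) (λ D → b ^ (D ℕ.* D) * (row (b * x) D * row (b * y) D)))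
      ≈⟨ +-congˡ (*-congˡ (*-congˡ (ev-congˣ _ (solve 4 (λ b q x y → b :* b :* (q :* x :* y) := q :* (b :* x) :* (b :* y)) refl b q x y)))) ⟩
    geom x * geom y + q * (q * x * y) * (b * (geom x * geom y) * symbols (b * x) (b * y))
      ≈⟨ solve 7 (λ g h q x y b s → g :* h :+ q :* (q :* x :* y) :* (b :* (g :* h) :* s) := g :* h :+ q :* (g :* h :* b :* (q :* x :* y) :* s)) refl _ _ _ _ _ _ _ ⟩
    geom x * geom y + q * (geom x * geom y * b * (q * x * y) * symbols (b * x) (b * y)) ∎
    where
    power : ∀ D → b ^ (suc D ℕ.* suc D) ≈ b * ((b * b) ^ D * b ^ (D ℕ.* D))
    power D = *-congˡ (begin
      b ^ (D ℕ.+ D ℕ.* suc D) ≡⟨ ≡.cong (λ k → b ^ (D ℕ.+ k)) (ℕₚ.*-suc D D) ⟩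
      b ^ (D ℕ.+ (D ℕ.+ D ℕ.* D)) ≈⟨ trans (^-homo-* b D _) (*-congˡ (^-homo-* b D _)) ⟩
      b ^ D * (b ^ D * b ^ (D ℕ.* D)) ≈⟨ *-assoc _ _ _ ⟨
      b ^ D * b ^ D * b ^ (D ℕ.* D) ≈⟨ *-congʳ (^-distrib-* b b D) ⟨
      (b * b) ^ D * b ^ (D ℕ.* D) ∎)
    term : ∀ D → b ^ (suc D ℕ.* suc D) * (row x (suc D) * row y (suc D))
      ≈ b * (geom x * geom y) * ((b * b) ^ D * (b ^ (D ℕ.* D) * (row (b * x) D * row (b * y) D)))
    term D = begin
      _ ≈⟨ *-cong (power D) (*-cong (row-step x D) (row-step y D)) ⟩
      _ ≈⟨ solve 7 (λ b B S g r h s → b :* (B :* S) :* (g :* r :* (h :* s)) := b :* (g :* h) :* (B :* (S :* (r :* s)))) refl _ _ _ _ _ _ _ ⟩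
      _ ∎

  double : C → C → C
  double x y = ev x (λ a → ev y (λ c → gauss a c))

  -- The mixed difference of the coefficients turns into (1 - X)(1 - Y) double = 1 + b X Y double(bX , bY).
  double-step : ∀ x y → double x y ≈ geom x * geom y + q * (geom x * geom y * b * (q * x * y) * double (b * x) (b * y))
  double-step x y = begin
    D ≈⟨ sym (*-identityˡ D) ⟩
    1# * D ≈⟨ *-congʳ units ⟨
    geom x * geom y * ((1# - X) * (1# - Y)) * D ≈⟨ *-assoc _ _ _ ⟩
    geom x * geom y * ((1# - X) * (1# - Y) * D) ≈⟨ *-congˡ key ⟩
    geom x * geom y * (1# + X * Y * (b * D′))
      ≈⟨ solve 7 (λ g h q x y b d → g :* h :* (:1 :+ q :* x :* (q :* y) :* (b :* d)) := g :* h :+ q :* (g :* h :* b :* (q :* x :* y) :* d)) refl _ _ _ _ _ _ _ ⟩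
    geom x * geom y + q * (geom x * geom y * b * (q * x * y) * D′) ∎
    where
    X = q * x
    Y = q * y
    D = double x y
    D′ = double (b * x) (b * y)
    Dˣ = ev x (λ a → ev y (λ c → gauss a (suc c)))
    Dʸ = ev x (λ a → ev y (λ c → gauss (suc a) c))
    D² = ev x (λ a → ev y (λ c → gauss (suc a) (suc c)))
    units : geom x * geom y * ((1# - X) * (1# - Y)) ≈ 1#
    units = begin
      _ ≈⟨ solve 4 (λ g h u v → g :* h :* (u :* v) := u :* g :* (v :* h)) refl _ _ _ _ ⟩
      _ ≈⟨ *-cong (geom-inverse x) (geom-inverse y) ⟩ 1# * 1# ≈⟨ *-identityˡ _ ⟩ 1# ∎
    D≈ˣ : D ≈ geom x + Y * Dˣ
    D≈ˣ = begin
      D ≈⟨ ev-cong (λ a → trans (ev-unfold y _) (+-congʳ (gauss-0ʳ a))) ⟩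
      ev x (λ a → 1# + Y * ev y (λ c → gauss a (suc c))) ≈⟨ trans (ev-+ x _ _) (+-congˡ (ev-*ˡ x _ _)) ⟩
      geom x + Y * Dˣ ∎
    D≈ʸ : D ≈ geom y + X * Dʸ
    D≈ʸ = ev-unfold x _
    Dʸ≈ : Dʸ ≈ geom x + Y * D²
    Dʸ≈ = begin
      Dʸ ≈⟨ ev-cong (λ a → ev-unfold y _) ⟩
      ev x (λ a → 1# + Y * ev y (λ c → gauss (suc a) (suc c))) ≈⟨ trans (ev-+ x _ _) (+-congˡ (ev-*ˡ x _ _)) ⟩
      geom x + Y * D² ∎
    corner : ev x (λ a → ev y (λ c → b ^ (a ℕ.+ suc c) * gauss a c)) ≈ b * D′
    corner = begin
      _ ≈⟨ ev-cong (λ a → trans (ev-cong (λ c → trans (*-congʳ (^-homo-* b a (suc c)))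
             (solve 4 (λ b A B g → A :* (b :* B) :* g := b :* A :* (B :* g)) refl b (b ^ a) (b ^ c) (gauss a c)))) (ev-*ˡ y _ _)) ⟩
      ev x (λ a → b * b ^ a * ev y (λ c → b ^ c * gauss a c))
        ≈⟨ ev-cong (λ a → trans (*-assoc _ _ _) (*-congˡ (*-congˡ (sym (ev-scale b y _))))) ⟩
      ev x (λ a → b * (b ^ a * ev (b * y) (λ c → gauss a c))) ≈⟨ trans (ev-*ˡ x b _) (*-congˡ (sym (ev-scale b x _))) ⟩
      b * D′ ∎
    D²≈ : D² ≈ Dˣ + Dʸ - D + b * D′
    D²≈ = begin
      D² ≈⟨ ev-cong (λ a → trans (ev-cong (gauss-mixed a)) (trans (ev-+ y _ _) (+-congʳ (trans (ev-- y _ _) (+-congʳ (ev-+ y _ _)))))) ⟩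
      _ ≈⟨ trans (ev-+ x _ _) (+-congʳ (trans (ev-- x _ _) (+-congʳ (ev-+ x _ _)))) ⟩
      _ ≈⟨ +-congˡ corner ⟩
      Dˣ + Dʸ - D + b * D′ ∎
    key : (1# - X) * (1# - Y) * D ≈ 1# + X * Y * (b * D′)
    key = begin
      (1# - X) * (1# - Y) * D ≈⟨ solve 3 (λ X Y D → (:1 :- X) :* (:1 :- Y) :* D := D :- X :* D :- Y :* D :+ X :* Y :* D) refl X Y D ⟩
      D - X * D - Y * D + X * Y * D ≈⟨ +-congʳ (+-cong (+-cong (trans D≈ʸ (+-congˡ (*-congˡ (trans Dʸ≈ (+-congˡ (*-congˡ D²≈)))))) (-‿cong (*-congˡ D≈ˣ))) (-‿cong (*-congˡ D≈ʸ))) ⟩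
      geom y + X * (geom x + Y * (Dˣ + Dʸ - D + b * D′)) - X * (geom x + Y * Dˣ) - Y * (geom y + X * Dʸ) + X * Y * D
        ≈⟨ solve 8 (λ g h X Y a c D B → h :+ X :* (g :+ Y :* (a :+ c :- D :+ B)) :- X :* (g :+ Y :* a) :- Y :* (h :+ X :* c) :+ X :* Y :* D
              := (:1 :- Y) :* h :+ X :* Y :* B) refl _ _ _ _ _ _ _ _ ⟩
      (1# - Y) * geom y + X * Y * (b * D′) ≈⟨ +-congʳ (geom-inverse y) ⟩
      1# + X * Y * (b * D′) ∎

  -- ladder w m = Σ_k Wᵏ [m+2k choose k] with W = q w.
  ladder : C → ℕ → C
  ladder w = diagonal w gauss

  -- `symbols` and `double` unfold by the same step. Combinatorially this is the Durfee square
  -- decomposition of the partitions inside an a × c box: [a+c choose c] = Σ_D b^{D²} [a choose D]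
  -- [c choose D].
  symbols-ladder : ∀ x y → symbols x y ≈ sym-ev x y (ladder (q * x * y))
  symbols-ladder x y = trans
    (coinduction {C × C} (λ { (x , y) → symbols x y }) (λ { (x , y) → double x y })
      (λ { (x , y) → geom x * geom y }) (λ { (x , y) → geom x * geom y * b * (q * x * y) }) (λ { (x , y) → b * x , b * y })
      (λ { (x , y) → symbols-step x y }) (λ { (x , y) → double-step x y }) (x , y))
    (group-by-difference x y gauss gauss-sym)

-- The telescoping recurrence of the coefficients rₘ.

module Partitions (𝒞 : CompleteRing) (β : CompleteRing.C 𝒞) where
  open Series 𝒞
  open Grouping 𝒞

  b : C
  b = q * β

  open Gaussian 𝒞 b public

  euler : C
  euler = poch∞ (- β) β

  parts : C
  parts = poch⁻¹ (- β) β

  euler*parts : euler * parts ≈ 1#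
  euler*parts = poch-inverse (- β) β

  poch-gauss : ∀ a c → poch (- β) β c * gauss a c ≈ poch (- β * b ^ a) β c
  poch-gauss a zero = trans (*-identityˡ _) (gauss-0ʳ a)
  poch-gauss a (suc c) = begin
    poch (- β) β c * (1# + q * - β * b ^ c) * gauss a (suc c)
      ≈⟨ solve 5 (λ Π q β B g → Π :* (:1 :+ q :* (:- β) :* B) :* g := Π :* ((:1 :- q :* β :* B) :* g)) refl _ _ _ _ _ ⟩
    poch (- β) β c * ((1# - b ^ suc c) * gauss a (suc c)) ≈⟨ *-congˡ (gauss-ratioʳ a c) ⟩
    poch (- β) β c * ((1# - b ^ (a ℕ.+ suc c)) * gauss a c) ≈⟨ solve 3 (λ x y z → x :* (y :* z) := x :* z :* y) refl _ _ _ ⟩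
    poch (- β) β c * gauss a c * (1# - b ^ (a ℕ.+ suc c)) ≈⟨ *-cong (poch-gauss a c) (+-congˡ (-‿cong (^-homo-* b a (suc c)))) ⟩
    poch (- β * b ^ a) β c * (1# - b ^ a * (b * b ^ c))
      ≈⟨ *-congˡ (solve 4 (λ q β A B → :1 :- A :* (q :* β :* B) := :1 :+ q :* (:- β :* A) :* B) refl q β (b ^ a) (b ^ c)) ⟩
    poch (- β * b ^ a) β c * (1# + q * (- β * b ^ a) * b ^ c) ∎

  poch≈[]1 : ∀ a c → poch (- β * b ^ a) β c ≈[ a ] 1#
  poch≈[]1 a zero = ≈⇒≈[] a refl
  poch≈[]1 a (suc c) = ≈[]-trans
    (*-cong[] (poch≈[]1 a c) (- β * q * β ^ a * b ^ c , (begin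
      1# + q * (- β * b ^ a) * b ^ c ≈⟨ +-congˡ (*-congʳ (*-congˡ (*-congˡ ([qx]^n β a)))) ⟩
      1# + q * (- β * (q ^ a * β ^ a)) * b ^ c
        ≈⟨ solve 5 (λ q β A E B → :1 :+ q :* (:- β :* (A :* E)) :* B := :1 :+ A :* (:- β :* q :* E :* B)) refl _ _ _ _ _ ⟩
      1# + q ^ a * (- β * q * β ^ a * b ^ c) ∎)))
    (≈⇒≈[] a (*-identityˡ 1#))

  -- Modulo qⁿ the product (b; b)_∞ may be cut off after c factors. Multiplied by [a+c choose c] it
  -- becomes (b^{a+1}; b)_c, which is 1 modulo qⁿ as well.
  gauss-limit : ∀ {n a c} → n ℕ.≤ a → n ℕ.≤ c → gauss a c ≈[ n ] parts
  gauss-limit {n} {a} {c} n≤a n≤c = ≈[]-trans (≈⇒≈[] n (begin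
      gauss a c ≈⟨ *-identityˡ _ ⟨ 1# * gauss a c ≈⟨ *-congʳ euler*parts ⟨
      euler * parts * gauss a c ≈⟨ solve 3 (λ e p g → e :* p :* g := p :* (e :* g)) refl _ _ _ ⟩
      parts * (euler * gauss a c) ∎))
    (≈[]-trans (*-cong[] (≈⇒≈[] n refl) (≈[]-trans (*-cong[] (≈[]-weaken n≤c (poch-limit _ _ c)) (≈⇒≈[] n refl))
       (≈[]-trans (≈⇒≈[] n (poch-gauss a c)) (≈[]-weaken n≤a (poch≈[]1 a c)))))
      (≈⇒≈[] n (*-identityʳ _)))

  r : ℕ → C
  r = ladder β

  private
    terms : ℕ → ℕ → C
    terms m k = gauss (k ℕ.+ m) k

  -- Cutting the first sum two terms later than the second makes everything collapse: each increment
  -- of `K` is absorbed by one use of each of the two Pascal rules, and a single q-binomial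
  -- coefficient survives, whose limit is 1/(b; b)_∞.
  r-partial : ∀ m K → partial β (terms m) (2 ℕ.+ K) + b ^ (3 ℕ.+ m) * partial β (terms (3 ℕ.+ m)) K ≈ gauss (2 ℕ.+ (K ℕ.+ m)) (suc K)
  r-partial m zero = begin
    0# + 1# * gauss m 0 + b * 1# * gauss (suc m) 1 + b ^ (3 ℕ.+ m) * 0#
      ≈⟨ solve 4 (λ g b h B → :0 :+ :1 :* g :+ b :* :1 :* h :+ B :* :0 := b :* :1 :* h :+ g) refl _ _ _ _ ⟩
    b * 1# * gauss (suc m) 1 + gauss m 0 ≈⟨ +-congˡ (gauss-0ʳ m) ⟩
    b * 1# * gauss (suc m) 1 + 1# ∎
  r-partial m (suc K) = begin
    A + b ^ (2 ℕ.+ K) * g + b ^ (3 ℕ.+ m) * (B + b ^ K * gauss (K ℕ.+ (3 ℕ.+ m)) K)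
      ≈⟨ solve 6 (λ A x B M k h → A :+ x :+ M :* (B :+ k :* h) := (A :+ M :* B) :+ k :* M :* h :+ x) refl _ _ _ _ _ _ ⟩
    (A + b ^ (3 ℕ.+ m) * B) + b ^ K * b ^ (3 ℕ.+ m) * gauss (K ℕ.+ (3 ℕ.+ m)) K + b ^ (2 ℕ.+ K) * g
      ≈⟨ +-congʳ (+-cong (r-partial m K) (*-cong (trans (sym (^-homo-* b K _)) (reflexive (≡.cong (b ^_) index)))
            (reflexive (≡.cong (λ n → gauss n K) index)))) ⟩
    gauss (2 ℕ.+ (K ℕ.+ m)) (suc K) + b ^ (3 ℕ.+ (K ℕ.+ m)) * gauss (3 ℕ.+ (K ℕ.+ m)) K + b ^ (2 ℕ.+ K) * g
      ≈⟨ +-congʳ (gauss-pascalʳ (2 ℕ.+ (K ℕ.+ m)) K) ⟨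
    gauss (3 ℕ.+ (K ℕ.+ m)) (suc K) + b ^ (2 ℕ.+ K) * g ≈⟨ +-comm _ _ ⟩
    gauss (3 ℕ.+ (K ℕ.+ m)) (2 ℕ.+ K) ∎
    where
    A = partial β (terms m) (2 ℕ.+ K)
    B = partial β (terms (3 ℕ.+ m)) K
    g = gauss (2 ℕ.+ (K ℕ.+ m)) (2 ℕ.+ K)
    index : K ℕ.+ (3 ℕ.+ m) ≡ 3 ℕ.+ (K ℕ.+ m)
    index = ≡.trans (ℕₚ.+-suc K (2 ℕ.+ m)) (≡.cong suc (≡.trans (ℕₚ.+-suc K (1 ℕ.+ m)) (≡.cong suc (ℕₚ.+-suc K m))))

  r-recurrence : ∀ m → r m + b ^ (3 ℕ.+ m) * r (3 ℕ.+ m) ≈ parts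
  r-recurrence m = ≈[]⇒≈ (λ n → ≈[]-trans
    (+-cong[] (≈[]-weaken (ℕₚ.m≤n+m n 2) (ev-≈[] β (terms m) (2 ℕ.+ n))) (*-cong[] (≈⇒≈[] n refl) (ev-≈[] β (terms (3 ℕ.+ m)) n)))
    (≈[]-trans (≈⇒≈[] n (r-partial m n)) (gauss-limit (ℕₚ.≤-trans (ℕₚ.m≤m+n n m) (ℕₚ.m≤n+m _ 2)) (ℕₚ.n≤1+n n))))

  r-partial₀ : ∀ K → 1# + b * partial β (terms 1) (suc K) + b * b * partial β (terms 2) K ≈ gauss (suc K) (suc K)
  r-partial₀ zero = solve 1 (λ b → :1 :+ b :* (:0 :+ :1 :* :1) :+ b :* b :* :0
    := b :* :1 :* :1 :+ :1) refl b
  r-partial₀ (suc K) = begin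
    1# + b * (A + b ^ suc K * gauss (suc K ℕ.+ 1) (suc K)) + b * b * (B + b ^ K * gauss (K ℕ.+ 2) K)
      ≈⟨ solve 6 (λ b A S g B h → :1 :+ b :* (A :+ b :* S :* g) :+ b :* b :* (B :+ S :* h)
           := b :* (b :* S) :* g :+ ((:1 :+ b :* A :+ b :* b :* B) :+ b :* (b :* S) :* h)) refl _ _ _ _ _ _ ⟩
    b ^ (2 ℕ.+ K) * gauss (suc K ℕ.+ 1) (suc K) + ((1# + b * A + b * b * B) + b ^ (2 ℕ.+ K) * gauss (K ℕ.+ 2) K)
      ≈⟨ +-cong (*-congˡ (trans (reflexive (≡.cong (λ n → gauss n (suc K)) (ℕₚ.+-comm (suc K) 1))) (gauss-sym (2 ℕ.+ K) (suc K))))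
            (+-cong (r-partial₀ K) (*-congˡ (reflexive (≡.cong (λ n → gauss n K) (ℕₚ.+-comm K 2))))) ⟩
    b ^ (2 ℕ.+ K) * gauss (suc K) (2 ℕ.+ K) + (gauss (suc K) (suc K) + b ^ (2 ℕ.+ K) * gauss (2 ℕ.+ K) K)
      ≈⟨ +-congˡ (gauss-pascalʳ (suc K) K) ⟨
    gauss (2 ℕ.+ K) (2 ℕ.+ K) ∎
    where
    A = partial β (terms 1) (suc K)
    B = partial β (terms 2) K

  -- The case m = -1 of `r-recurrence`: in Σ_k bᵏ [2k-1 choose k] the term k = 0 is 1 and the others
  -- add up to `b * r 1`.
  r-recurrence₀ : 1# + b * r 1 + b * b * r 2 ≈ parts
  r-recurrence₀ = ≈[]⇒≈ (λ n → ≈[]-trans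
    (+-cong[] (+-cong[] (≈⇒≈[] n refl) (*-cong[] (≈⇒≈[] n refl) (≈[]-weaken (ℕₚ.n≤1+n n) (ev-≈[] β (terms 1) (suc n)))))
              (*-cong[] (≈⇒≈[] n refl) (ev-≈[] β (terms 2) n)))
    (≈[]-trans (≈⇒≈[] n (r-partial₀ n)) (gauss-limit (ℕₚ.n≤1+n n) (ℕₚ.n≤1+n n))))

  -- σ j = Σ_k b²ᵏ [j+2k choose k]; b^{j+1} σ j counts the partitions of rank j.
  σ : ℕ → C
  σ = ladder (b * β)

  -- Pascal's rule applied to every term k ≥ 1 of `r (suc j)`. It expresses the rank coefficients of
  -- partitions through `r`, so that S₄ is governed by the same recurrence as R₄.
  σ-r : ∀ j → σ j + b * r (2 ℕ.+ j) ≈ r (suc j)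
  σ-r j = begin
    ev (b * β) (terms j) + b * r (2 ℕ.+ j) ≈⟨ +-congʳ (trans (ev-unfold _ _) (+-cong (gauss-0ʳ j) (*-congˡ (ev-scale b β _)))) ⟩
    1# + q * (b * β) * ev β (λ k → b ^ k * gauss (suc k ℕ.+ j) (suc k)) + b * ev β (λ k → gauss (k ℕ.+ (2 ℕ.+ j)) k)
      ≈⟨ +-congʳ (+-congˡ (solve 3 (λ q β e → q :* (q :* β :* β) :* e := q :* β :* (q :* β :* e)) refl _ _ _)) ⟩
    1# + b * (b * ev β (λ k → b ^ k * gauss (suc k ℕ.+ j) (suc k))) + b * ev β (λ k → gauss (k ℕ.+ (2 ℕ.+ j)) k)
      ≈⟨ trans (+-assoc _ _ _) (+-congˡ (sym (distribˡ b _ _))) ⟩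
    1# + b * (b * ev β (λ k → b ^ k * gauss (suc k ℕ.+ j) (suc k)) + ev β (λ k → gauss (k ℕ.+ (2 ℕ.+ j)) k))
      ≈⟨ +-congˡ (*-congˡ (trans (+-congʳ (sym (ev-*ˡ β b _))) (sym (ev-+ β _ _)))) ⟩
    1# + b * ev β (λ k → b * (b ^ k * gauss (suc k ℕ.+ j) (suc k)) + gauss (k ℕ.+ (2 ℕ.+ j)) k)
      ≈⟨ +-congˡ (*-congˡ (ev-cong (λ k → +-cong (sym (*-assoc _ _ _)) (reflexive (≡.cong (λ n → gauss n k) (index k)))))) ⟩
    1# + b * ev β (λ k → gauss (2 ℕ.+ (k ℕ.+ j)) (suc k))
      ≈⟨ +-congˡ (*-congˡ (ev-cong (λ k → reflexive (≡.cong (λ n → gauss (suc n) (suc k)) (≡.sym (ℕₚ.+-suc k j)))))) ⟩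
    1# + b * ev β (λ k → gauss (suc k ℕ.+ suc j) (suc k)) ≈⟨ ev-unfold β (terms (suc j)) ⟨
    r (suc j) ∎
    where
    index : ∀ k → k ℕ.+ (2 ℕ.+ j) ≡ 2 ℕ.+ (k ℕ.+ j)
    index k = ≡.trans (ℕₚ.+-suc k (1 ℕ.+ j)) (≡.cong suc (ℕₚ.+-suc k j))

-- The functional equation of Θ as a recurrence with a unique solution up to a factor.

module Recurrence (𝒞 : CompleteRing) where
  open Series 𝒞
  open Grouping 𝒞

  p : C
  p = q * q

  -cong[] : ∀ {n x y} → x ≈[ n ] y → - x ≈[ n ] - y
  -cong[] {n} {x} {y} (a , e) = - a , trans (-‿cong e) (solve 3 (λ y Q a → :- (y :+ Q :* a) := :- y :+ Q :* :- a) refl y (q ^ n) a)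

  -- With c₋ₖ = pᵏ cₖ the equation cₘ₊₁ = cₘ + q · drift c m reads
  -- cₙ - cₙ₋₁ + p cₙ₋₂ - p cₙ₋₃ = pⁿ (cₙ - p cₙ₊₁ + p³ cₙ₊₂ - p⁴ cₙ₊₃), n = m + 1;
  -- it is the coefficient form of the functional equation of Θ under z ↦ z q².
  drift : (ℕ → C) → ℕ → C
  drift c zero = q * (c 1 - p * c 2 + p ^ 3 * c 3 - p ^ 4 * c 4 - p * c 1 + p ^ 2 * c 2)
  drift c (suc zero) = q * (p * c 1 - c 0 + p * (c 2 - p * c 3 + p ^ 3 * c 4 - p ^ 4 * c 5))
  drift c (suc (suc m)) = q * (c m - c (1 ℕ.+ m)
    + p ^ (2 ℕ.+ m) * (c (3 ℕ.+ m) - p * c (4 ℕ.+ m) + p ^ 3 * c (5 ℕ.+ m) - p ^ 4 * c (6 ℕ.+ m)))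

  defect : (ℕ → C) → ℕ → C
  defect c m = c (suc m) - c m - q * drift c m

  Solution : (ℕ → C) → Set
  Solution c = ∀ m → defect c m ≈ 0#

  solution-step : ∀ {c} → Solution c → ∀ m → c (suc m) ≈ c m + q * drift c m
  solution-step {c} sol m = begin
    c (suc m) ≈⟨ solve 3 (λ a b d → a := (a :- b :- d) :+ (b :+ d)) refl _ (c m) (q * drift c m) ⟩
    defect c m + (c m + q * drift c m) ≈⟨ +-congʳ (sol m) ⟩
    0# + (c m + q * drift c m) ≈⟨ +-identityˡ _ ⟩
    c m + q * drift c m ∎

  drift-cong[] : ∀ {n c d} → (∀ m → c m ≈[ n ] d m) → ∀ m → drift c m ≈[ n ] drift d m
  drift-cong[] {n} {c} {d} h m = go m
    where
    infixl 6 _⊕_ _⊝_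
    infixl 7 _⊛_
    _⊕_ = +-cong[] {n}
    _⊝_ : ∀ {x y x′ y′} → x ≈[ n ] y → x′ ≈[ n ] y′ → x - x′ ≈[ n ] y - y′
    a ⊝ b = +-cong[] a (-cong[] b)
    _⊛_ : ∀ k {x y} → x ≈[ n ] y → k * x ≈[ n ] k * y
    k ⊛ a = *-cong[] (≈⇒≈[] n refl) a
    go : ∀ m → drift c m ≈[ n ] drift d m
    go zero = q ⊛ (h 1 ⊝ p ⊛ h 2 ⊕ p ^ 3 ⊛ h 3 ⊝ p ^ 4 ⊛ h 4 ⊝ p ⊛ h 1 ⊕ p ^ 2 ⊛ h 2)
    go (suc zero) = q ⊛ (p ⊛ h 1 ⊝ h 0 ⊕ p ⊛ (h 2 ⊝ p ⊛ h 3 ⊕ p ^ 3 ⊛ h 4 ⊝ p ^ 4 ⊛ h 5))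
    go (suc (suc m)) = q ⊛ (h m ⊝ h (1 ℕ.+ m)
      ⊕ p ^ (2 ℕ.+ m) ⊛ (h (3 ℕ.+ m) ⊝ p ⊛ h (4 ℕ.+ m) ⊕ p ^ 3 ⊛ h (5 ℕ.+ m) ⊝ p ^ 4 ⊛ h (6 ℕ.+ m)))

  -- A solution is determined by its 0th term, because modulo qⁿ⁺¹ its terms are all equal once it vanishes modulo qⁿ.
  solution-unique : ∀ {c d} → Solution c → Solution d → c 0 ≈ d 0 → ∀ m → c m ≈ d m
  solution-unique {c} {d} sc sd e₀ m = ≈[]⇒≈ (λ n → go n m)
    where
    go : ∀ n m → c m ≈[ n ] d m
    go zero m = c m - d m , solve 2 (λ x y → x := y :+ :1 :* (x :- y)) refl (c m) (d m)
    go (suc n) zero = ≈⇒≈[] _ e₀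
    go (suc n) (suc m) = ≈[]-trans (≈⇒≈[] _ (solution-step sc m)) (≈[]-trans
      (+-cong[] (go (suc n) m) (q*-cong[] (drift-cong[] (go n) m)))
      (≈[]-sym (≈⇒≈[] _ (solution-step sd m))))

  defect-* : ∀ k c m → defect (λ m → c m * k) m ≈ defect c m * k
  defect-* k c zero = solve 8 (λ k q p c0 c1 c2 c3 c4 →
    c1 :* k :- c0 :* k :- q :* (q :* (c1 :* k :- p :* (c2 :* k) :+ p :^ 3 :* (c3 :* k) :- p :^ 4 :* (c4 :* k) :- p :* (c1 :* k) :+ p :^ 2 :* (c2 :* k)))
    := (c1 :- c0 :- q :* (q :* (c1 :- p :* c2 :+ p :^ 3 :* c3 :- p :^ 4 :* c4 :- p :* c1 :+ p :^ 2 :* c2))) :* k) refl k q p _ _ _ _ _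
  defect-* k c (suc zero) = solve 9 (λ k q p c0 c1 c2 c3 c4 c5 →
    c2 :* k :- c1 :* k :- q :* (q :* (p :* (c1 :* k) :- c0 :* k :+ p :* (c2 :* k :- p :* (c3 :* k) :+ p :^ 3 :* (c4 :* k) :- p :^ 4 :* (c5 :* k))))
    := (c2 :- c1 :- q :* (q :* (p :* c1 :- c0 :+ p :* (c2 :- p :* c3 :+ p :^ 3 :* c4 :- p :^ 4 :* c5)))) :* k) refl k q p _ _ _ _ _ _
  defect-* k c (suc (suc m)) = solve 11 (λ k q p M c0 c1 c2 c3 c4 c5 c6 →
    c3 :* k :- c2 :* k :- q :* (q :* (c0 :* k :- c1 :* k :+ M :* (c3 :* k :- p :* (c4 :* k) :+ p :^ 3 :* (c5 :* k) :- p :^ 4 :* (c6 :* k))))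
    := (c3 :- c2 :- q :* (q :* (c0 :- c1 :+ M :* (c3 :- p :* c4 :+ p :^ 3 :* c5 :- p :^ 4 :* c6)))) :* k) refl k q p (p ^ (2 ℕ.+ m)) _ _ _ _ _ _ _

  defect-+ : ∀ c d m → defect (λ m → c m + d m) m ≈ defect c m + defect d m
  defect-+ c d zero = solve 12 (λ q p c0 c1 c2 c3 c4 d0 d1 d2 d3 d4 →
    (c1 :+ d1) :- (c0 :+ d0) :- q :* (q :* ((c1 :+ d1) :- p :* (c2 :+ d2) :+ p :^ 3 :* (c3 :+ d3) :- p :^ 4 :* (c4 :+ d4) :- p :* (c1 :+ d1) :+ p :^ 2 :* (c2 :+ d2)))
    := (c1 :- c0 :- q :* (q :* (c1 :- p :* c2 :+ p :^ 3 :* c3 :- p :^ 4 :* c4 :- p :* c1 :+ p :^ 2 :* c2)))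
    :+ (d1 :- d0 :- q :* (q :* (d1 :- p :* d2 :+ p :^ 3 :* d3 :- p :^ 4 :* d4 :- p :* d1 :+ p :^ 2 :* d2)))) refl q p _ _ _ _ _ _ _ _ _ _
  defect-+ c d (suc zero) = solve 14 (λ q p c0 c1 c2 c3 c4 c5 d0 d1 d2 d3 d4 d5 →
    (c2 :+ d2) :- (c1 :+ d1) :- q :* (q :* (p :* (c1 :+ d1) :- (c0 :+ d0) :+ p :* ((c2 :+ d2) :- p :* (c3 :+ d3) :+ p :^ 3 :* (c4 :+ d4) :- p :^ 4 :* (c5 :+ d5))))
    := (c2 :- c1 :- q :* (q :* (p :* c1 :- c0 :+ p :* (c2 :- p :* c3 :+ p :^ 3 :* c4 :- p :^ 4 :* c5))))
    :+ (d2 :- d1 :- q :* (q :* (p :* d1 :- d0 :+ p :* (d2 :- p :* d3 :+ p :^ 3 :* d4 :- p :^ 4 :* d5))))) refl q p _ _ _ _ _ _ _ _ _ _ _ _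
  defect-+ c d (suc (suc m)) = solve 17 (λ q p M c0 c1 c2 c3 c4 c5 c6 d0 d1 d2 d3 d4 d5 d6 →
    (c3 :+ d3) :- (c2 :+ d2) :- q :* (q :* ((c0 :+ d0) :- (c1 :+ d1) :+ M :* ((c3 :+ d3) :- p :* (c4 :+ d4) :+ p :^ 3 :* (c5 :+ d5) :- p :^ 4 :* (c6 :+ d6))))
    := (c3 :- c2 :- q :* (q :* (c0 :- c1 :+ M :* (c3 :- p :* c4 :+ p :^ 3 :* c5 :- p :^ 4 :* c6))))
    :+ (d3 :- d2 :- q :* (q :* (d0 :- d1 :+ M :* (d3 :- p :* d4 :+ p :^ 3 :* d5 :- p :^ 4 :* d6))))) refl q p (p ^ (2 ℕ.+ m)) _ _ _ _ _ _ _ _ _ _ _ _ _ _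

  -- By linearity both sides are solutions, and their 0th terms agree. Cross-multiplying avoids a
  -- division by an initial term.
  solution-proportional : ∀ {c d} → Solution c → Solution d → ∀ m → c m * d 0 ≈ d m * c 0
  solution-proportional {c} {d} sc sd = solution-unique
    (λ m → trans (defect-* (d 0) c m) (trans (*-congʳ (sc m)) (zeroˡ _)))
    (λ m → trans (defect-* (c 0) d m) (trans (*-congʳ (sd m)) (zeroˡ _)))
    (*-comm _ _)

-- Coefficients of products of a series in X and a series in Y with X Y = p.

module Pairing (𝒞 : CompleteRing) (β : CompleteRing.C 𝒞) where
  open Series 𝒞

  private
    p : C
    p = q * β

  -- The coefficient of Xᵐ in φ(X) ψ(Y); `k` is the number of cancelled pairs X Y = `p`.
  pair : (ℕ → C) → (ℕ → C) → ℕ → C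
  pair φ ψ m = ev β (λ k → φ (k ℕ.+ m) * ψ k)

  pair-shiftˡ : ∀ φ ψ m → pair (shift φ) ψ (suc m) ≈ pair φ ψ m
  pair-shiftˡ φ ψ m = ev-cong (λ k → *-congʳ (reflexive (≡.cong (shift φ) (ℕₚ.+-suc k m))))

  -- Multiplication by X brings the coefficient of index -1 to index 0. That coefficient is the one
  -- of Y, found by exchanging the two factors, and X Y contributes the `p`.
  pair-shiftˡ₀ : ∀ φ ψ → pair (shift φ) ψ 0 ≈ p * pair ψ φ 1
  pair-shiftˡ₀ φ ψ = begin
    pair (shift φ) ψ 0 ≈⟨ ev-unfold β _ ⟩
    0# * ψ 0 + p * ev β (λ k → φ (k ℕ.+ 0) * ψ (suc k)) ≈⟨ trans (+-congʳ (zeroˡ _)) (+-identityˡ _) ⟩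
    p * ev β (λ k → φ (k ℕ.+ 0) * ψ (suc k))
      ≈⟨ *-congˡ (ev-cong (λ k → trans (*-comm _ _) (*-cong (reflexive (≡.cong ψ (ℕₚ.+-comm 1 k))) (reflexive (≡.cong φ (ℕₚ.+-identityʳ k)))))) ⟩
    p * pair ψ φ 1 ∎

  pair-shiftʳ : ∀ φ ψ m → pair φ (shift ψ) m ≈ p * pair φ ψ (suc m)
  pair-shiftʳ φ ψ m = begin
    pair φ (shift ψ) m ≈⟨ ev-unfold β _ ⟩
    φ m * 0# + p * ev β (λ k → φ (suc k ℕ.+ m) * ψ k) ≈⟨ trans (+-congʳ (zeroʳ _)) (+-identityˡ _) ⟩
    p * ev β (λ k → φ (suc k ℕ.+ m) * ψ k) ≈⟨ *-congˡ (ev-cong (λ k → *-congʳ (reflexive (≡.cong φ (≡.sym (ℕₚ.+-suc k m)))))) ⟩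
    p * pair φ ψ (suc m) ∎

  pair-twist : ∀ φ ψ m → pair (λ a → p ^ a * φ a) ψ m ≈ p ^ m * pair φ (λ a → p ^ a * ψ a) m
  pair-twist φ ψ m = trans (ev-cong (λ k → trans (*-congʳ (*-congʳ (^-homo-* p k m)))
    (solve 4 (λ K M f g → K :* M :* f :* g := M :* (f :* (K :* g))) refl _ _ _ _))) (ev-*ˡ β _ _)

  pair-linˡ : ∀ φ₀ φ₁ φ₂ φ₃ ψ m → pair (λ a → φ₀ a - φ₁ a + p * φ₂ a - p * φ₃ a) ψ m
    ≈ pair φ₀ ψ m - pair φ₁ ψ m + p * pair φ₂ ψ m - p * pair φ₃ ψ m
  pair-linˡ φ₀ φ₁ φ₂ φ₃ ψ m = begin
    _ ≈⟨ ev-cong (λ k → solve 6 (λ a b c d p y → (a :- b :+ p :* c :- p :* d) :* y := a :* y :- b :* y :+ p :* (c :* y) :- p :* (d :* y)) refl _ _ _ _ _ _) ⟩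
    _ ≈⟨ trans (ev-- β _ _) (+-cong (trans (ev-+ β _ _) (+-cong (ev-- β _ _) (ev-*ˡ β p _))) (-‿cong (ev-*ˡ β p _))) ⟩
    _ ∎

  pair-linʳ : ∀ φ₀ φ₁ φ₂ φ₃ ψ m → pair ψ (λ a → φ₀ a - φ₁ a + p * φ₂ a - p * φ₃ a) m
    ≈ pair ψ φ₀ m - pair ψ φ₁ m + p * pair ψ φ₂ m - p * pair ψ φ₃ m
  pair-linʳ φ₀ φ₁ φ₂ φ₃ ψ m = begin
    _ ≈⟨ ev-cong (λ k → solve 6 (λ a b c d p y → y :* (a :- b :+ p :* c :- p :* d) := y :* a :- y :* b :+ p :* (y :* c) :- p :* (y :* d)) refl _ _ _ _ _ _) ⟩
    _ ≈⟨ trans (ev-- β _ _) (+-cong (trans (ev-+ β _ _) (+-cong (ev-- β _ _) (ev-*ˡ β p _))) (-‿cong (ev-*ˡ β p _))) ⟩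
    _ ∎

-- The coefficients of Θ solve the recurrence.

module Theta (𝒞 : CompleteRing) where
  open Series 𝒞
  open Grouping 𝒞
  open Recurrence 𝒞
  open Pairing 𝒞 q

  private
    inv : ℕ → C
    inv a = geom (q * p ^ a)

    inv-inverse : ∀ a → (1# - p ^ suc a) * inv a ≈ 1#
    inv-inverse a = trans (*-congʳ (+-congˡ (-‿cong (*-assoc q q (p ^ a))))) (geom-inverse (q * p ^ a))

  -- The coefficients of 1 / ((x ; p)_∞ (-p x² ; p²)_∞).
  f : ℕ → C
  f 0 = 1#
  f 1 = inv 0 * f 0
  f 2 = inv 1 * (f 1 - p * f 0)
  f (suc (suc (suc a))) = inv (2 ℕ.+ a) * (f (suc (suc a)) - p * f (suc a) + p * f a)

  -- Coefficient form of F(p X) = (1 - X)(1 + p X²) F(X); `f` was defined by solving it for its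
  -- leading coefficient, dividing by 1 - pᵃ.
  f-law : ∀ a → p ^ a * f a ≈ f a - shift f a + p * shift (shift f) a - p * shift (shift (shift f)) a
  f-law 0 = solve 1 (λ p → :1 :* :1 := :1 :- :0 :+ p :* :0 :- p :* :0) refl p
  f-law 1 = begin
    p ^ 1 * (inv 0 * 1#) ≈⟨ solve 2 (λ P i → P :* (i :* :1) := i :- (:1 :- P) :* i) refl (p ^ 1) (inv 0) ⟩
    inv 0 - (1# - p ^ 1) * inv 0 ≈⟨ +-congˡ (-‿cong (inv-inverse 0)) ⟩
    inv 0 - 1# ≈⟨ solve 2 (λ i p → i :- :1 := i :* :1 :- :1 :+ p :* :0 :- p :* :0) refl (inv 0) p ⟩
    inv 0 * 1# - 1# + p * 0# - p * 0# ∎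
  f-law 2 = begin
    p ^ 2 * (inv 1 * X) ≈⟨ solve 3 (λ P i X → P :* (i :* X) := i :* X :- (:1 :- P) :* i :* X) refl (p ^ 2) (inv 1) X ⟩
    inv 1 * X - (1# - p ^ 2) * inv 1 * X ≈⟨ +-congˡ (-‿cong (*-congʳ (inv-inverse 1))) ⟩
    inv 1 * X - 1# * X ≈⟨ solve 4 (λ Y a p c → Y :- :1 :* (a :- p :* c) := Y :- a :+ p :* c :- p :* :0) refl (inv 1 * X) (f 1) p (f 0) ⟩
    inv 1 * X - f 1 + p * f 0 - p * 0# ∎
    where X = f 1 - p * f 0
  f-law (suc (suc (suc a))) = begin
    p ^ (3 ℕ.+ a) * (i * X) ≈⟨ solve 3 (λ P i X → P :* (i :* X) := i :* X :- (:1 :- P) :* i :* X) refl (p ^ (3 ℕ.+ a)) i X ⟩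
    i * X - (1# - p ^ (3 ℕ.+ a)) * i * X ≈⟨ +-congˡ (-‿cong (*-congʳ (inv-inverse (2 ℕ.+ a)))) ⟩
    i * X - 1# * X ≈⟨ solve 5 (λ Y x p y z → Y :- :1 :* (x :- p :* y :+ p :* z) := Y :- x :+ p :* y :- p :* z) refl (i * X) (f (2 ℕ.+ a)) p (f (1 ℕ.+ a)) (f a) ⟩
    i * X - f (2 ℕ.+ a) + p * f (1 ℕ.+ a) - p * f a ∎
    where
    i = inv (2 ℕ.+ a)
    X = f (2 ℕ.+ a) - p * f (1 ℕ.+ a) + p * f a

  t : ℕ → C
  t = diagonal q (λ a c → f a * f c)

  private
    f¹ f² f³ : ℕ → C
    f¹ = shift f
    f² = shift f¹
    f³ = shift f²

    -- The pairing of `p ^ a * f a` with `f` is computed in two ways: `f-law` in the left factor, or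
    -- the twist moved across by `pair-twist` and `f-law` in the right factor. The equality of the
    -- two is the functional equation of Θ = F(X) F(Y).
    t-relation : ∀ m → pair f f m - pair f¹ f m + p * pair f² f m - p * pair f³ f m
      ≈ p ^ m * (t m - p * t (1 ℕ.+ m) + p * (p * (p * t (2 ℕ.+ m))) - p * (p * (p * (p * t (3 ℕ.+ m)))))
    t-relation m = begin
      _ ≈⟨ pair-linˡ f f¹ f² f³ f m ⟨
      pair (λ a → f a - f¹ a + p * f² a - p * f³ a) f m ≈⟨ ev-cong (λ k → *-congʳ (f-law (k ℕ.+ m))) ⟨
      pair (λ a → p ^ a * f a) f m ≈⟨ pair-twist f f m ⟩
      p ^ m * pair f (λ a → p ^ a * f a) m ≈⟨ *-congˡ (ev-cong (λ k → *-congˡ (f-law k))) ⟩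
      p ^ m * pair f (λ a → f a - f¹ a + p * f² a - p * f³ a) m ≈⟨ *-congˡ (pair-linʳ f f¹ f² f³ f m) ⟩
      p ^ m * (t m - pair f f¹ m + p * pair f f² m - p * pair f f³ m)
        ≈⟨ *-congˡ (+-cong (+-cong (+-congˡ (-‿cong s₁)) (*-congˡ s₂)) (-‿cong (*-congˡ s₃))) ⟩
      _ ∎
      where
      s₁ : pair f f¹ m ≈ p * t (1 ℕ.+ m)
      s₁ = pair-shiftʳ f f m
      s₂ : pair f f² m ≈ p * (p * t (2 ℕ.+ m))
      s₂ = trans (pair-shiftʳ f f¹ m) (*-congˡ (pair-shiftʳ f f (1 ℕ.+ m)))
      s₃ : pair f f³ m ≈ p * (p * (p * t (3 ℕ.+ m)))
      s₃ = trans (pair-shiftʳ f f² m) (*-congˡ (trans (pair-shiftʳ f f¹ (1 ℕ.+ m)) (*-congˡ (pair-shiftʳ f f (2 ℕ.+ m)))))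

    vanish : ∀ {x y} → x ≈ y → x - y ≈ 0#
    vanish e = trans (+-congʳ e) (-‿inverseʳ _)

  t-solution : Solution t
  t-solution zero = begin
    defect t 0 ≈⟨ solve 6 (λ q t0 t1 t2 t3 t4 → let p = q :* q in
        t1 :- t0 :- q :* (q :* (t1 :- p :* t2 :+ p :^ 3 :* t3 :- p :^ 4 :* t4 :- p :* t1 :+ p :^ 2 :* t2))
        := (t1 :- t0 :+ p :* (p :* t1) :- p :* (p :* (p :* t2)))
           :- p :^ 1 :* (t1 :- p :* t2 :+ p :* (p :* (p :* t3)) :- p :* (p :* (p :* (p :* t4))))) refl q _ _ _ _ _ ⟩
    _ ≈⟨ vanish (trans (sym (+-cong (+-cong (+-congˡ (-‿cong (pair-shiftˡ f f 0)))
            (*-congˡ (trans (pair-shiftˡ f¹ f 0) (pair-shiftˡ₀ f f))))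
            (-‿cong (*-congˡ (trans (pair-shiftˡ f² f 0) (trans (pair-shiftˡ₀ f¹ f) (*-congˡ (pair-shiftʳ f f 1)))))))) (t-relation 1)) ⟩
    0# ∎
  t-solution (suc zero) = begin
    defect t 1 ≈⟨ solve 7 (λ q t0 t1 t2 t3 t4 t5 → let p = q :* q in
        t2 :- t1 :- q :* (q :* (p :* t1 :- t0 :+ p :* (t2 :- p :* t3 :+ p :^ 3 :* t4 :- p :^ 4 :* t5)))
        := (t2 :- t1 :+ p :* t0 :- p :* (p :* t1))
           :- p :^ 2 :* (t2 :- p :* t3 :+ p :* (p :* (p :* t4)) :- p :* (p :* (p :* (p :* t5))))) refl q _ _ _ _ _ _ ⟩
    _ ≈⟨ vanish (trans (sym (+-cong (+-cong (+-congˡ (-‿cong (pair-shiftˡ f f 1)))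
            (*-congˡ (trans (pair-shiftˡ f¹ f 1) (pair-shiftˡ f f 0))))
            (-‿cong (*-congˡ (trans (pair-shiftˡ f² f 1) (trans (pair-shiftˡ f¹ f 0) (pair-shiftˡ₀ f f))))))) (t-relation 2)) ⟩
    0# ∎
  t-solution (suc (suc m)) = begin
    defect t (2 ℕ.+ m) ≈⟨ solve 9 (λ q M t0 t1 t2 t3 t4 t5 t6 → let p = q :* q in
        t3 :- t2 :- q :* (q :* (t0 :- t1 :+ M :* (t3 :- p :* t4 :+ p :^ 3 :* t5 :- p :^ 4 :* t6)))
        := (t3 :- t2 :+ p :* t1 :- p :* t0)
           :- p :* M :* (t3 :- p :* t4 :+ p :* (p :* (p :* t5)) :- p :* (p :* (p :* (p :* t6))))) refl q (p ^ (2 ℕ.+ m)) _ _ _ _ _ _ _ ⟩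
    _ ≈⟨ vanish (trans (sym (+-cong (+-cong (+-congˡ (-‿cong (pair-shiftˡ f f (2 ℕ.+ m))))
            (*-congˡ (trans (pair-shiftˡ f¹ f (2 ℕ.+ m)) (pair-shiftˡ f f (1 ℕ.+ m)))))
            (-‿cong (*-congˡ (trans (pair-shiftˡ f² f (2 ℕ.+ m)) (trans (pair-shiftˡ f¹ f (1 ℕ.+ m)) (pair-shiftˡ f f m))))))) (t-relation (3 ℕ.+ m))) ⟩
    0# ∎

-- The coefficients of E solve the recurrence.

module Combination (𝒞 : CompleteRing) where
  open Series 𝒞
  open Grouping 𝒞
  open Recurrence 𝒞

  -- `u` is q⁸, and `υ` is q⁷ because `ev`, `poch` and `Partitions` each supply one factor `q`. The
  -- names `β₂` and `β₄` below follow the same convention for u² and u⁴.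
  υ u : C
  υ = q * (p * p * p)
  u = q * υ

  module Pp = Partitions 𝒞 q
  module Pu = Partitions 𝒞 υ

  u≈p⁴ : u ≈ p ^ 4
  u≈p⁴ = solve 1 (λ q → let p = q :* q in q :* (q :* (p :* p :* p)) := p :^ 4) refl q

  private
    r a : ℕ → C
    r = Pp.r
    a = Pu.r
    P Q : C
    P = Pp.parts
    Q = Pu.parts

    -- Carries the sign of (-z²)ʲ. Since p²ʲ = y² and uʲ = y⁴, the variable powers of `p` in the
    -- even and odd coefficients become polynomials in the single unknown `y j`, which the solver
    -- can handle.
    y : ℕ → C
    y j = (- p) ^ j

    y² : ∀ i → p ^ (i ℕ.+ i) ≈ y i * y i
    y² zero = sym (*-identityˡ _)
    y² (suc i) = begin
      p * p ^ (i ℕ.+ suc i) ≡⟨ ≡.cong (λ k → p * p ^ k) (ℕₚ.+-suc i i) ⟩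
      p * (p * p ^ (i ℕ.+ i)) ≈⟨ *-congˡ (*-congˡ (y² i)) ⟩
      p * (p * (y i * y i)) ≈⟨ solve 2 (λ p y → p :* (p :* (y :* y)) := (:- p) :* y :* ((:- p) :* y)) refl p (y i) ⟩
      y (suc i) * y (suc i) ∎

    y⁴ : ∀ i → u ^ i ≈ y i * y i * (y i * y i)
    y⁴ zero = solve 0 (:1 := :1 :* :1 :* (:1 :* :1)) refl
    y⁴ (suc i) = begin
      u * u ^ i ≈⟨ *-cong u≈p⁴ (y⁴ i) ⟩
      p ^ 4 * (y i * y i * (y i * y i))
        ≈⟨ solve 2 (λ p y → let y′ = (:- p) :* y in p :^ 4 :* (y :* y :* (y :* y)) := y′ :* y′ :* (y′ :* y′)) refl p (y i) ⟩
      y (suc i) * y (suc i) * (y (suc i) * y (suc i)) ∎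

    relation : ∀ i → a i + p ^ 12 * (y i * y i * (y i * y i)) * a (3 ℕ.+ i) - Q ≈ 0#
    relation i = trans (+-congʳ (trans (+-congˡ (*-congʳ power)) (Pu.r-recurrence i))) (-‿inverseʳ Q)
      where
      power : p ^ 12 * (y i * y i * (y i * y i)) ≈ u ^ (3 ℕ.+ i)
      power = sym (begin
        u * (u * (u * u ^ i)) ≈⟨ *-cong u≈p⁴ (*-cong u≈p⁴ (*-cong u≈p⁴ (y⁴ i))) ⟩
        p ^ 4 * (p ^ 4 * (p ^ 4 * (y i * y i * (y i * y i)))) ≈⟨ solve 2 (λ p Y → p :^ 4 :* (p :^ 4 :* (p :^ 4 :* Y)) := p :^ 12 :* Y) refl p _ ⟩
        p ^ 12 * (y i * y i * (y i * y i)) ∎)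

    relation₀ : 1# + p ^ 4 * a 1 + p ^ 8 * a 2 - Q ≈ 0#
    relation₀ = trans (+-congʳ (trans (+-cong (+-congˡ (*-congʳ (sym u≈p⁴)))
      (*-congʳ (trans (solve 1 (λ p → p :^ 8 := p :^ 4 :* p :^ 4) refl p) (*-cong (sym u≈p⁴) (sym u≈p⁴))))) Pu.r-recurrence₀)) (-‿inverseʳ Q)

  s : ℕ → C
  s = neighbours p r

  -- The coefficients of S₄(-z²) - 1 at z²ʲ and of p q(z + 1/z) R₄(-z²) at z²ʲ⁺¹, without the power
  -- q²ʲ or q²ʲ⁺¹. In the even part the rank coefficient is already rewritten by `σ-r`.
  even-part odd-part : ℕ → C
  even-part j = y j * y j * y j * (p ^ 4 * (a (1 ℕ.+ j) - p ^ 4 * a (2 ℕ.+ j)))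
  odd-part j = y j * (p * (a j - p ^ 2 * a (1 ℕ.+ j)))

  interleave : (ℕ → C) → (ℕ → C) → ℕ → C
  interleave E O zero = E 0
  interleave E O (suc zero) = O 0
  interleave E O (suc (suc m)) = interleave (tail E) (tail O) m

  interleave-even : ∀ E O i → interleave E O (i ℕ.+ i) ≡ E i
  interleave-even E O zero = ≡.refl
  interleave-even E O (suc i) = ≡.trans (≡.cong (λ k → interleave E O (suc k)) (ℕₚ.+-suc i i)) (interleave-even (tail E) (tail O) i)

  interleave-odd : ∀ E O i → interleave E O (suc (i ℕ.+ i)) ≡ O i
  interleave-odd E O zero = ≡.refl
  interleave-odd E O (suc i) = ≡.trans (≡.cong (λ k → interleave E O (suc (suc k))) (ℕₚ.+-suc i i)) (interleave-odd (tail E) (tail O) i)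

  w : ℕ → C
  w = interleave even-part odd-part

  δ : ℕ → C
  δ zero = 1#
  δ (suc _) = 0#

  e : ℕ → C
  e m = s m + (w m + δ m)

  private
    P₀ : ℕ → C
    P₀ k = r k + p ^ (3 ℕ.+ k) * r (3 ℕ.+ k)

    -- This defect and the following ones are combinations of the relations `P₀ k ≈ P` and
    -- `r-recurrence₀` whose weights add up to zero, so that `P` drops out. A polynomial is left
    -- over only where `r-recurrence₀` takes part, from its constant term.
    s-defect₀ : defect s 0 ≈ 1# - p + p ^ 2
    s-defect₀ = begin
      defect s 0 ≈⟨ solve 7 (λ q r0 r1 r2 r3 r4 r5 → let p = q :* q in
        (r0 :+ p :* r2) :- (p :* r1 :+ p :* r1) :- q :* (q :* ((r0 :+ p :* r2) :- p :* (r1 :+ p :* r3) :+ p :^ 3 :* (r2 :+ p :* r4)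
          :- p :^ 4 :* (r3 :+ p :* r5) :- p :* (r0 :+ p :* r2) :+ p :^ 2 :* (r1 :+ p :* r3)))
        := (:1 :- p :+ p :^ 2) :* (r0 :+ p :^ 3 :* r3) :- (:1 :- p :+ p :^ 2) :* (:1 :+ p :* r1 :+ p :* p :* r2)
          :- p :* (r1 :+ p :^ 4 :* r4) :+ p :* (r2 :+ p :^ 5 :* r5) :+ (:1 :- p :+ p :^ 2)) refl q _ _ _ _ _ _ ⟩
      (1# - p + p ^ 2) * P₀ 0 - (1# - p + p ^ 2) * (1# + p * r 1 + p * p * r 2) - p * P₀ 1 + p * P₀ 2 + (1# - p + p ^ 2)
        ≈⟨ +-congʳ (+-cong (+-cong (+-cong (*-congˡ (Pp.r-recurrence 0)) (-‿cong (*-congˡ Pp.r-recurrence₀))) (-‿cong (*-congˡ (Pp.r-recurrence 1)))) (*-congˡ (Pp.r-recurrence 2))) ⟩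
      (1# - p + p ^ 2) * P - (1# - p + p ^ 2) * P - p * P + p * P + (1# - p + p ^ 2)
        ≈⟨ solve 2 (λ p P → let k = :1 :- p :+ p :^ 2 in k :* P :- k :* P :- p :* P :+ p :* P :+ k := k) refl p P ⟩
      1# - p + p ^ 2 ∎

    s-defect₁ : defect s 1 ≈ 0#
    s-defect₁ = begin
      defect s 1 ≈⟨ solve 8 (λ q r0 r1 r2 r3 r4 r5 r6 → let p = q :* q in
        (r1 :+ p :* r3) :- (r0 :+ p :* r2) :- q :* (q :* (p :* (r0 :+ p :* r2) :- (p :* r1 :+ p :* r1) :+ p :* ((r1 :+ p :* r3) :- p :* (r2 :+ p :* r4)
          :+ p :^ 3 :* (r3 :+ p :* r5) :- p :^ 4 :* (r4 :+ p :* r6))))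
        := (:1 :+ p :^ 2) :* (r1 :+ p :^ 4 :* r4) :- (:1 :+ p :^ 2) :* (r0 :+ p :^ 3 :* r3)
          :- p :* (r2 :+ p :^ 5 :* r5) :+ p :* (r3 :+ p :^ 6 :* r6)) refl q _ _ _ _ _ _ _ ⟩
      (1# + p ^ 2) * P₀ 1 - (1# + p ^ 2) * P₀ 0 - p * P₀ 2 + p * P₀ 3
        ≈⟨ +-cong (+-cong (+-cong (*-congˡ (Pp.r-recurrence 1)) (-‿cong (*-congˡ (Pp.r-recurrence 0)))) (-‿cong (*-congˡ (Pp.r-recurrence 2)))) (*-congˡ (Pp.r-recurrence 3)) ⟩
      (1# + p ^ 2) * P - (1# + p ^ 2) * P - p * P + p * P
        ≈⟨ solve 2 (λ p P → let k = :1 :+ p :^ 2 in k :* P :- k :* P :- p :* P :+ p :* P := :0) refl p P ⟩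
      0# ∎

    s-defect₂ : defect s 2 ≈ p
    s-defect₂ = begin
      defect s 2 ≈⟨ solve 9 (λ q r0 r1 r2 r3 r4 r5 r6 r7 → let p = q :* q in
        (r2 :+ p :* r4) :- (r1 :+ p :* r3) :- q :* (q :* ((p :* r1 :+ p :* r1) :- (r0 :+ p :* r2)
          :+ p :^ 2 :* ((r2 :+ p :* r4) :- p :* (r3 :+ p :* r5) :+ p :^ 3 :* (r4 :+ p :* r6) :- p :^ 4 :* (r5 :+ p :* r7))))
        := (:1 :+ p :^ 2) :* (r2 :+ p :^ 5 :* r5) :- (:1 :+ p :^ 2) :* (r1 :+ p :^ 4 :* r4)
          :+ p :* (r0 :+ p :^ 3 :* r3) :- p :* (:1 :+ p :* r1 :+ p :* p :* r2)
          :- p :* (r3 :+ p :^ 6 :* r6) :+ p :* (r4 :+ p :^ 7 :* r7) :+ p) refl q _ _ _ _ _ _ _ _ ⟩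
      (1# + p ^ 2) * P₀ 2 - (1# + p ^ 2) * P₀ 1 + p * P₀ 0 - p * (1# + p * r 1 + p * p * r 2) - p * P₀ 3 + p * P₀ 4 + p
        ≈⟨ +-congʳ (+-cong (+-cong (+-cong (+-cong (+-cong (*-congˡ (Pp.r-recurrence 2)) (-‿cong (*-congˡ (Pp.r-recurrence 1)))) (*-congˡ (Pp.r-recurrence 0)))
             (-‿cong (*-congˡ Pp.r-recurrence₀))) (-‿cong (*-congˡ (Pp.r-recurrence 3)))) (*-congˡ (Pp.r-recurrence 4))) ⟩
      (1# + p ^ 2) * P - (1# + p ^ 2) * P + p * P - p * P - p * P + p * P + p
        ≈⟨ solve 2 (λ p P → let k = :1 :+ p :^ 2 in k :* P :- k :* P :+ p :* P :- p :* P :- p :* P :+ p :* P :+ p := p) refl p P ⟩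
      p ∎

    s-defect₃ : ∀ m → defect s (3 ℕ.+ m) ≈ 0#
    s-defect₃ m = begin
      defect s (3 ℕ.+ m) ≈⟨ solve 11 (λ q M r0 r1 r2 r3 r4 r5 r6 r7 r8 → let p = q :* q in
        (r3 :+ p :* r5) :- (r2 :+ p :* r4) :- q :* (q :* ((r0 :+ p :* r2) :- (r1 :+ p :* r3)
          :+ p :* (p :* (p :* M)) :* ((r3 :+ p :* r5) :- p :* (r4 :+ p :* r6) :+ p :^ 3 :* (r5 :+ p :* r7) :- p :^ 4 :* (r6 :+ p :* r8))))
        := let p3 = p :* (p :* (p :* M)) ; p4 = p :* p3 ; p5 = p :* p4 ; p6 = p :* p5 ; p7 = p :* p6 ; p8 = p :* p7 in
           (:1 :+ p :^ 2) :* (r3 :+ p6 :* r6) :- (:1 :+ p :^ 2) :* (r2 :+ p5 :* r5)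
          :+ p :* (r1 :+ p4 :* r4) :- p :* (r0 :+ p3 :* r3)
          :- p :* (r4 :+ p7 :* r7) :+ p :* (r5 :+ p8 :* r8)) refl q (p ^ m) _ _ _ _ _ _ _ _ _ ⟩
      (1# + p ^ 2) * P₀ (3 ℕ.+ m) - (1# + p ^ 2) * P₀ (2 ℕ.+ m) + p * P₀ (1 ℕ.+ m) - p * P₀ m - p * P₀ (4 ℕ.+ m) + p * P₀ (5 ℕ.+ m)
        ≈⟨ +-cong (+-cong (+-cong (+-cong (+-cong (*-congˡ (Pp.r-recurrence (3 ℕ.+ m))) (-‿cong (*-congˡ (Pp.r-recurrence (2 ℕ.+ m))))) (*-congˡ (Pp.r-recurrence (1 ℕ.+ m))))
             (-‿cong (*-congˡ (Pp.r-recurrence m)))) (-‿cong (*-congˡ (Pp.r-recurrence (4 ℕ.+ m))))) (*-congˡ (Pp.r-recurrence (5 ℕ.+ m))) ⟩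
      (1# + p ^ 2) * P - (1# + p ^ 2) * P + p * P - p * P - p * P + p * P
        ≈⟨ solve 2 (λ p P → let k = :1 :+ p :^ 2 in k :* P :- k :* P :+ p :* P :- p :* P :- p :* P :+ p :* P := :0) refl p P ⟩
      0# ∎

    combine : ∀ {k₀ k₁ k₂ x₀ x₁ x₂} c → x₀ ≈ 0# → x₁ ≈ 0# → x₂ ≈ 0# → k₀ * x₀ + k₁ * x₁ + k₂ * x₂ + c ≈ c
    combine {k₀} {k₁} {k₂} c e₀ e₁ e₂ = trans (+-congʳ (+-cong (+-cong (*-congˡ e₀) (*-congˡ e₁)) (*-congˡ e₂)))
      (solve 4 (λ x y z c → x :* :0 :+ y :* :0 :+ z :* :0 :+ c := c) refl k₀ k₁ k₂ c)

    w-defect₀ : defect w 0 ≈ p - p ^ 2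
    w-defect₀ = trans (solve 7 (λ q Q a0 a1 a2 a3 a4 →
        let p = q :* q ; one = :1 ; n = :- p
            E = λ y a1 a2 → y :* y :* y :* (p :^ 4 :* (a1 :- p :^ 4 :* a2))
            O = λ y a0 a1 → y :* (p :* (a0 :- p :^ 2 :* a1))
            c0 = E one a1 a2 ; c1 = O one a0 a1 ; c2 = E (n :* one) a2 a3 ; c3 = O (n :* one) a1 a2 ; c4 = E (n :* (n :* one)) a3 a4
            R = λ y a0 a3 → a0 :+ p :^ 12 :* (y :* y :* (y :* y)) :* a3 :- Q
        in c1 :- c0 :- q :* (q :* (c1 :- p :* c2 :+ p :^ 3 :* c3 :- p :^ 4 :* c4 :- p :* c1 :+ p :^ 2 :* c2))
        := (p :- p :^ 2 :+ p :^ 3) :* R one a0 a3 :+ (p :^ 2 :- p) :* (one :+ p :^ 4 :* a1 :+ p :^ 8 :* a2 :- Q)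
           :+ (:- p :^ 3) :* R (n :* one) a1 a4 :+ (p :- p :^ 2)) refl q Q _ _ _ _ _)
      (combine _ (relation 0) relation₀ (relation 1))

    w-defect₁ : defect w 1 ≈ - p
    w-defect₁ = trans (solve 7 (λ q Q a0 a1 a2 a3 a4 →
        let p = q :* q ; one = :1 ; n = :- p
            E = λ y a1 a2 → y :* y :* y :* (p :^ 4 :* (a1 :- p :^ 4 :* a2))
            O = λ y a0 a1 → y :* (p :* (a0 :- p :^ 2 :* a1))
            c0 = E one a1 a2 ; c1 = O one a0 a1 ; c2 = E (n :* one) a2 a3 ; c3 = O (n :* one) a1 a2 ; c4 = E (n :* (n :* one)) a3 a4
            c5 = O (n :* (n :* one)) a2 a3
            R = λ y a0 a3 → a0 :+ p :^ 12 :* (y :* y :* (y :* y)) :* a3 :- Q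
        in c2 :- c1 :- q :* (q :* (p :* c1 :- c0 :+ p :* (c2 :- p :* c3 :+ p :^ 3 :* c4 :- p :^ 4 :* c5)))
        := (:- p :- p :^ 3) :* R one a0 a3 :+ p :* (one :+ p :^ 4 :* a1 :+ p :^ 8 :* a2 :- Q)
           :+ p :^ 3 :* R (n :* one) a1 a4 :+ :- p) refl q Q _ _ _ _ _)
      (combine _ (relation 0) relation₀ (relation 1))

    -- `interleave` does not reduce at the open indices `i + i` and `suc (i + i)`. Abstracting the
    -- seven entries lets them be replaced by propositional equalities.
    formula : C → C → C → C → C → C → C → C → C
    formula M c0 c1 c2 c3 c4 c5 c6 = c3 - c2 - q * (q * (c0 - c1 + M * (c3 - p * c4 + p ^ 3 * c5 - p ^ 4 * c6)))

    formula-cong : ∀ {M c0 c1 c2 c3 c4 c5 c6 M′ d0 d1 d2 d3 d4 d5 d6} → M ≈ M′ →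
      c0 ≡ d0 → c1 ≡ d1 → c2 ≡ d2 → c3 ≡ d3 → c4 ≡ d4 → c5 ≡ d5 → c6 ≡ d6 →
      formula M c0 c1 c2 c3 c4 c5 c6 ≈ formula M′ d0 d1 d2 d3 d4 d5 d6
    formula-cong M≈ ≡.refl ≡.refl ≡.refl ≡.refl ≡.refl ≡.refl ≡.refl = +-congˡ (-‿cong (*-congˡ (*-congˡ (+-congˡ (*-congʳ M≈)))))

    even-at : ∀ k i → interleave (λ n → even-part (k ℕ.+ n)) (λ n → odd-part (k ℕ.+ n)) (i ℕ.+ i) ≡ even-part (k ℕ.+ i)
    even-at k i = interleave-even _ _ i

    odd-at : ∀ k i → interleave (λ n → even-part (k ℕ.+ n)) (λ n → odd-part (k ℕ.+ n)) (suc (i ℕ.+ i)) ≡ odd-part (k ℕ.+ i)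
    odd-at k i = interleave-odd _ _ i

    w-defect-even : ∀ i → defect w (2 ℕ.+ (i ℕ.+ i)) ≈ 0#
    w-defect-even i = begin
      defect w (2 ℕ.+ (i ℕ.+ i)) ≈⟨ formula-cong (*-congˡ (*-congˡ (y² i)))
        (even-at 0 i) (odd-at 0 i) (even-at 1 i) (odd-at 1 i) (even-at 2 i) (odd-at 2 i) (even-at 3 i) ⟩
      formula (p * (p * (y i * y i))) (even-part i) (odd-part i) (even-part (1 ℕ.+ i)) (odd-part (1 ℕ.+ i))
        (even-part (2 ℕ.+ i)) (odd-part (2 ℕ.+ i)) (even-part (3 ℕ.+ i))
        ≈⟨ solve 9 (λ q Q y a0 a1 a2 a3 a4 a5 →
          let p = q :* q ; n = :- p ; y1 = n :* y ; y2 = n :* y1 ; y3 = n :* y2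
              E = λ y a1 a2 → y :* y :* y :* (p :^ 4 :* (a1 :- p :^ 4 :* a2))
              O = λ y a0 a1 → y :* (p :* (a0 :- p :^ 2 :* a1))
              c0 = E y a1 a2 ; c1 = O y a0 a1 ; c2 = E y1 a2 a3 ; c3 = O y1 a1 a2 ; c4 = E y2 a3 a4 ; c5 = O y2 a2 a3 ; c6 = E y3 a4 a5
              R = λ y a0 a3 → a0 :+ p :^ 12 :* (y :* y :* (y :* y)) :* a3 :- Q
          in c3 :- c2 :- q :* (q :* (c0 :- c1 :+ p :* (p :* (y :* y)) :* (c3 :- p :* c4 :+ p :^ 3 :* c5 :- p :^ 4 :* c6)))
          := (:- p :* y1) :* R y a0 a3 :+ ((p :+ p :^ 3) :* y1) :* R y1 a1 a4 :+ (:- p :^ 3 :* y1) :* R y2 a2 a5 :+ :0)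
          refl q Q (y i) _ _ _ _ _ _ ⟩
      _ ≈⟨ combine 0# (relation i) (relation (1 ℕ.+ i)) (relation (2 ℕ.+ i)) ⟩
      0# ∎

    w-defect-odd : ∀ i → defect w (3 ℕ.+ (i ℕ.+ i)) ≈ 0#
    w-defect-odd i = begin
      defect w (3 ℕ.+ (i ℕ.+ i)) ≈⟨ formula-cong (*-congˡ (*-congˡ (*-congˡ (y² i))))
        (odd-at 0 i) (even-at 1 i) (odd-at 1 i) (even-at 2 i) (odd-at 2 i) (even-at 3 i) (odd-at 3 i) ⟩
      formula (p * (p * (p * (y i * y i)))) (odd-part i) (even-part (1 ℕ.+ i)) (odd-part (1 ℕ.+ i)) (even-part (2 ℕ.+ i))
        (odd-part (2 ℕ.+ i)) (even-part (3 ℕ.+ i)) (odd-part (3 ℕ.+ i))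
        ≈⟨ solve 9 (λ q Q y a0 a1 a2 a3 a4 a5 →
          let p = q :* q ; n = :- p ; y1 = n :* y ; y2 = n :* y1 ; y3 = n :* y2
              E = λ y a1 a2 → y :* y :* y :* (p :^ 4 :* (a1 :- p :^ 4 :* a2))
              O = λ y a0 a1 → y :* (p :* (a0 :- p :^ 2 :* a1))
              c0 = O y a0 a1 ; c1 = E y1 a2 a3 ; c2 = O y1 a1 a2 ; c3 = E y2 a3 a4 ; c4 = O y2 a2 a3 ; c5 = E y3 a4 a5 ; c6 = O y3 a3 a4
              R = λ y a0 a3 → a0 :+ p :^ 12 :* (y :* y :* (y :* y)) :* a3 :- Q
          in c3 :- c2 :- q :* (q :* (c0 :- c1 :+ p :* (p :* (p :* (y :* y))) :* (c3 :- p :* c4 :+ p :^ 3 :* c5 :- p :^ 4 :* c6)))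
          := (:- y2) :* R y a0 a3 :+ ((:1 :+ p :^ 2) :* y2) :* R y1 a1 a4 :+ (:- p :^ 2 :* y2) :* R y2 a2 a5 :+ :0)
          refl q Q (y i) _ _ _ _ _ _ ⟩
      _ ≈⟨ combine 0# (relation i) (relation (1 ℕ.+ i)) (relation (2 ℕ.+ i)) ⟩
      0# ∎

    w-defect₂ : ∀ m → defect w (2 ℕ.+ m) ≈ 0#
    w-defect₂ m with parity m
    ... | inj₁ (i , ≡.refl) = w-defect-even i
    ... | inj₂ (i , ≡.refl) = w-defect-odd i

    δ-defect : ∀ m → defect δ (3 ℕ.+ m) ≈ 0#
    δ-defect m = solve 3 (λ q p M → let z = :0 in z :- z :- q :* (q :* (z :- z :+ M :* (z :- p :* z :+ p :^ 3 :* z :- p :^ 4 :* z))) := z) refl q p (p ^ (3 ℕ.+ m))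

    total : ∀ m {x y z} → defect s m ≈ x → defect w m ≈ y → defect δ m ≈ z → x + (y + z) ≈ 0# → defect e m ≈ 0#
    total m ex ey ez h = trans (defect-+ s (λ m → w m + δ m) m) (trans (+-cong ex (trans (defect-+ w δ m) (+-cong ey ez))) h)

  -- At the indices 0, 1, 2 the defects are 1 - p + p², 0, p for `s`, then p - p², -p, 0 for `w`,
  -- and -1, p, -p for `δ`. Each column adds up to zero, and all later defects vanish separately.
  e-solution : Solution e
  e-solution 0 = total 0 s-defect₀ w-defect₀ refl
    (solve 1 (λ q → let p = q :* q ; z = :0 in (:1 :- p :+ p :^ 2) :+ ((p :- p :^ 2)
      :+ (z :- :1 :- q :* (q :* (z :- p :* z :+ p :^ 3 :* z :- p :^ 4 :* z :- p :* z :+ p :^ 2 :* z)))) := z) refl q)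
  e-solution 1 = total 1 s-defect₁ w-defect₁ refl
    (solve 1 (λ q → let p = q :* q ; z = :0 in z :+ (:- p
      :+ (z :- z :- q :* (q :* (p :* z :- :1 :+ p :* (z :- p :* z :+ p :^ 3 :* z :- p :^ 4 :* z))))) := z) refl q)
  e-solution 2 = total 2 s-defect₂ (w-defect₂ 0) refl
    (solve 1 (λ q → let p = q :* q ; z = :0 in p :+ (z
      :+ (z :- z :- q :* (q :* (:1 :- z :+ p :^ 2 :* (z :- p :* z :+ p :^ 3 :* z :- p :^ 4 :* z))))) := z) refl q)
  e-solution (suc (suc (suc m))) = total (3 ℕ.+ m) (s-defect₃ m) (w-defect₂ (1 ℕ.+ m)) (δ-defect m)
    (solve 0 (:0 :+ (:0 :+ :0) := :0) refl)

-- Manipulation of infinite products through their partial products.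

module Products (𝒞 : CompleteRing) where
  open Series 𝒞

  factor : C → C → ℕ → C
  factor x b n = 1# + q * x * (q * b) ^ n

  poch-cong : ∀ {x y b c} → x ≈ y → b ≈ c → ∀ n → poch x b n ≈ poch y c n
  poch-cong x≈y b≈c zero = refl
  poch-cong x≈y b≈c (suc n) = *-cong (poch-cong x≈y b≈c n) (+-congˡ (*-cong (*-congˡ x≈y) (^-congˡ n (*-congˡ b≈c))))

  poch∞-cong : ∀ {x y b c} → x ≈ y → b ≈ c → poch∞ x b ≈ poch∞ y c
  poch∞-cong x≈y b≈c = limit-unique (poch-cong x≈y b≈c) (poch-limit _ _) (poch-limit _ _)

  poch∞-mul : ∀ x b y c w d → (∀ n → factor x b n * factor y c n ≈ factor w d n) → poch∞ x b * poch∞ y c ≈ poch∞ w d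
  poch∞-mul x b y c w d h = limit-unique go (limit-* (poch-limit x b) (poch-limit y c)) (poch-limit w d)
    where
    go : ∀ n → poch x b n * poch y c n ≈ poch w d n
    go zero = *-identityˡ _
    go (suc n) = trans (solve 4 (λ a b c d → a :* b :* (c :* d) := a :* c :* (b :* d)) refl _ _ _ _) (*-cong (go n) (h n))

  poch-split : ∀ x b n → poch x b (n ℕ.+ n) ≈ poch x (q * b * b) n * poch (x * (q * b)) (q * b * b) n
  poch-split x b zero = sym (*-identityˡ _)
  poch-split x b (suc n) = begin
    poch x b (suc n ℕ.+ suc n) ≡⟨ ≡.cong (λ k → poch x b (suc k)) (ℕₚ.+-suc n n) ⟩
    poch x b (n ℕ.+ n) * (1# + q * x * B ^ (n ℕ.+ n)) * (1# + q * x * (B * B ^ (n ℕ.+ n)))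
      ≈⟨ *-cong (*-cong (poch-split x b n) (+-congˡ (*-congˡ power))) (+-congˡ (trans (*-congˡ (*-congˡ power))
           (solve 4 (λ q x B D → q :* x :* (B :* D) := q :* (x :* B) :* D) refl _ _ _ _))) ⟩
    poch x b′ n * poch (x * B) b′ n * (1# + q * x * (q * b′) ^ n) * (1# + q * (x * B) * (q * b′) ^ n)
      ≈⟨ solve 4 (λ a b c d → a :* b :* c :* d := a :* c :* (b :* d)) refl _ _ _ _ ⟩
    poch x b′ (suc n) * poch (x * B) b′ (suc n) ∎
    where
    B = q * b
    b′ = q * b * b
    power : B ^ (n ℕ.+ n) ≈ (q * b′) ^ n
    power = begin
      B ^ (n ℕ.+ n) ≈⟨ ^-homo-* B n n ⟩ B ^ n * B ^ n ≈⟨ ^-distrib-* B B n ⟨ (B * B) ^ n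
        ≈⟨ ^-congˡ n (solve 2 (λ q b → q :* b :* (q :* b) := q :* (q :* b :* b)) refl q b) ⟩ (q * b′) ^ n ∎

  poch∞-split : ∀ x b → poch∞ x b ≈ poch∞ x (q * b * b) * poch∞ (x * (q * b)) (q * b * b)
  poch∞-split x b = limit-unique (poch-split x b) (λ n → ≈[]-weaken (ℕₚ.m≤m+n n n) (poch-limit x b (n ℕ.+ n)))
    (limit-* (poch-limit _ _) (poch-limit _ _))

  -- Product expansions are obtained by iterating a functional equation. After n steps the argument
  -- has shrunk by `(q * b) ^ n`, and modulo qⁿ only the constant term is left.
  ev-≈[]1 : ∀ b x φ n → φ 0 ≈ 1# → ev ((q * b) ^ n * x) φ ≈[ n ] 1#
  ev-≈[]1 b x φ n e₀ = q * (b ^ n * x) * R , (begin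
    ev (B * x) φ ≈⟨ ev-unfold _ φ ⟩
    φ 0 + q * (B * x) * R ≈⟨ +-cong e₀ (*-congʳ (*-congˡ (*-congʳ ([qx]^n b n)))) ⟩
    1# + q * (q ^ n * b ^ n * x) * R ≈⟨ solve 5 (λ q Q b x R → :1 :+ q :* (Q :* b :* x) :* R := :1 :+ Q :* (q :* (b :* x) :* R)) refl _ _ _ _ _ ⟩
    1# + q ^ n * (q * (b ^ n * x) * R) ∎)
    where
    B = (q * b) ^ n
    R = ev (B * x) (tail φ)

-- Euler's expansions, Durfee's identity and Jacobi's triple product.

module Jacobi (𝒞 : CompleteRing) (β : CompleteRing.C 𝒞) where
  open Series 𝒞
  open Grouping 𝒞
  open Products 𝒞
  open Partitions 𝒞 β
  open Pairing 𝒞 β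

  recip : ℕ → C
  recip zero = 1#
  recip (suc a) = recip a * geom (β * b ^ a)

  recip-inverse : ∀ a → (1# - b ^ suc a) * recip (suc a) ≈ recip a
  recip-inverse a = begin
    (1# - q * β * b ^ a) * (recip a * geom (β * b ^ a))
      ≈⟨ solve 5 (λ q β B r g → (:1 :- q :* β :* B) :* (r :* g) := r :* ((:1 :- q :* (β :* B)) :* g)) refl _ _ _ _ _ ⟩
    recip a * ((1# - q * (β * b ^ a)) * geom (β * b ^ a)) ≈⟨ *-congˡ (geom-inverse _) ⟩
    recip a * 1# ≈⟨ *-identityʳ _ ⟩ recip a ∎

  recip-law : ∀ a → recip a ≈ shift recip a + b ^ a * recip a
  recip-law zero = solve 0 (:1 := :0 :+ :1 :* :1) refl
  recip-law (suc a) = begin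
    recip (suc a) ≈⟨ solve 2 (λ B r → r := (:1 :- B) :* r :+ B :* r) refl (b ^ suc a) _ ⟩
    (1# - b ^ suc a) * recip (suc a) + b ^ suc a * recip (suc a) ≈⟨ +-congʳ (recip-inverse a) ⟩
    recip a + b ^ suc a * recip (suc a) ∎

  -- b^{m(m-1)/2}, defined by its ratio so that no triangular numbers are needed in exponents.
  tri : ℕ → C
  tri zero = 1#
  tri (suc m) = b ^ m * tri m

  g : ℕ → C
  g a = tri a * recip a

  private
    g′ : ℕ → C
    g′ a = b ^ a * g a

  -- Coefficient form of G(X) = (1 + X) G(b X), the equation satisfied by (-X; b)_∞.
  g-law : ∀ a → g a ≈ g′ a + shift g′ a
  g-law zero = solve 0 (:1 :* :1 := :1 :* (:1 :* :1) :+ :0) refl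
  g-law (suc a) = begin
    T * recip (suc a) ≈⟨ *-congˡ (recip-law (suc a)) ⟩
    b ^ a * tri a * (recip a + b ^ suc a * recip (suc a))
      ≈⟨ solve 5 (λ B t r D s → B :* t :* (r :+ D :* s) := D :* (B :* t :* s) :+ B :* (t :* r)) refl _ _ _ _ _ ⟩
    b ^ suc a * (T * recip (suc a)) + b ^ a * (tri a * recip a) ∎
    where T = tri (suc a)

  private
    ev-g-step : ∀ x → ev x g ≈ (1# + q * x) * ev (b * x) g
    ev-g-step x = begin
      ev x g ≈⟨ trans (ev-cong g-law) (ev-+ x _ _) ⟩
      ev x g′ + ev x (shift g′) ≈⟨ +-congˡ (ev-shift x g′) ⟩
      ev x g′ + q * x * ev x g′ ≈⟨ solve 2 (λ X e → e :+ X :* e := (:1 :+ X) :* e) refl _ _ ⟩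
      (1# + q * x) * ev x g′ ≈⟨ *-congˡ (ev-scale b x g) ⟨
      (1# + q * x) * ev (b * x) g ∎

    ev-recip-step : ∀ x → (1# - q * x) * ev x recip ≈ ev (b * x) recip
    ev-recip-step x = begin
      (1# - q * x) * ev x recip ≈⟨ solve 2 (λ X e → (:1 :- X) :* e := e :- X :* e) refl _ _ ⟩
      ev x recip - q * x * ev x recip ≈⟨ +-cong (trans (ev-cong recip-law) (ev-+ x _ _)) (-‿cong (sym (ev-shift x recip))) ⟩
      (ev x (shift recip) + ev x (λ a → b ^ a * recip a)) - ev x (shift recip) ≈⟨ solve 2 (λ a b → (a :+ b) :- a := b) refl _ _ ⟩
      ev x (λ a → b ^ a * recip a) ≈⟨ ev-scale b x recip ⟨
      ev (b * x) recip ∎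

    ev-g-poch : ∀ x n → ev x g ≈ poch x β n * ev (b ^ n * x) g
    ev-g-poch x zero = trans (ev-congˣ g (sym (*-identityˡ x))) (sym (*-identityˡ _))
    ev-g-poch x (suc n) = begin
      ev x g ≈⟨ ev-g-poch x n ⟩
      poch x β n * ev (b ^ n * x) g ≈⟨ *-congˡ (ev-g-step _) ⟩
      poch x β n * ((1# + q * (b ^ n * x)) * ev (b * (b ^ n * x)) g)
        ≈⟨ trans (sym (*-assoc _ _ _)) (*-cong (*-congˡ (+-congˡ (solve 3 (λ q B x → q :* (B :* x) := q :* x :* B) refl _ _ _))) (ev-congˣ g (sym (*-assoc _ _ _)))) ⟩
      poch x β n * (1# + q * x * b ^ n) * ev (b ^ suc n * x) g ∎

    ev-recip-poch : ∀ x n → poch (- x) β n * ev x recip ≈ ev (b ^ n * x) recip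
    ev-recip-poch x zero = trans (*-identityˡ _) (ev-congˣ recip (sym (*-identityˡ x)))
    ev-recip-poch x (suc n) = begin
      poch (- x) β n * (1# + q * - x * b ^ n) * ev x recip
        ≈⟨ solve 5 (λ Π q x B e → Π :* (:1 :+ q :* (:- x) :* B) :* e := (:1 :- q :* (B :* x)) :* (Π :* e)) refl _ _ _ _ _ ⟩
      (1# - q * (b ^ n * x)) * (poch (- x) β n * ev x recip) ≈⟨ *-congˡ (ev-recip-poch x n) ⟩
      (1# - q * (b ^ n * x)) * ev (b ^ n * x) recip ≈⟨ ev-recip-step _ ⟩
      ev (b * (b ^ n * x)) recip ≈⟨ ev-congˣ recip (sym (*-assoc _ _ _)) ⟩
      ev (b ^ suc n * x) recip ∎

  -- Euler: (-X ; b)_∞ = Σ b^{a(a-1)/2} Xᵃ / (b ; b)_a.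
  ev-g : ∀ x → ev x g ≈ poch∞ x β
  ev-g x = limit-unique (λ n → refl)
    (λ n → ≈[]-trans (≈⇒≈[] n (ev-g-poch x n)) (≈[]-trans (*-cong[] (≈⇒≈[] n refl) (ev-≈[]1 β x g n (*-identityˡ 1#))) (≈⇒≈[] n (*-identityʳ _))))
    (poch-limit x β)

  -- Euler: 1 / (X ; b)_∞ = Σ Xᵃ / (b ; b)_a.
  ev-recip : ∀ x → poch∞ (- x) β * ev x recip ≈ 1#
  ev-recip x = ≈[]⇒≈ (λ n → ≈[]-trans (*-cong[] (poch-limit (- x) β n) (≈⇒≈[] n refl))
    (≈[]-trans (≈⇒≈[] n (ev-recip-poch x n)) (ev-≈[]1 β x recip n refl)))

  private
    j v : ℕ → C
    j = pair g g
    v = pair g g′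

    j≈ˡ : ∀ m → j (suc m) ≈ b ^ suc m * v (suc m) + b ^ m * v m
    j≈ˡ m = begin
      j (suc m) ≈⟨ ev-cong (λ k → trans (*-congʳ (g-law (k ℕ.+ suc m))) (distribʳ _ _ _)) ⟩
      _ ≈⟨ ev-+ β _ _ ⟩
      pair g′ g (suc m) + pair (shift g′) g (suc m) ≈⟨ +-cong (pair-twist g g (suc m)) (trans (pair-shiftˡ g′ g m) (pair-twist g g m)) ⟩
      b ^ suc m * v (suc m) + b ^ m * v m ∎

    j≈ʳ : ∀ m → j m ≈ v m + b * v (suc m)
    j≈ʳ m = begin
      j m ≈⟨ ev-cong (λ k → trans (*-congˡ (g-law k)) (distribˡ _ _ _)) ⟩
      _ ≈⟨ ev-+ β _ _ ⟩
      v m + pair g (shift g′) m ≈⟨ +-congˡ (pair-shiftʳ g g′ m) ⟩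
      v m + b * v (suc m) ∎

    -- `g-law` in the left factor expands `j (suc m)`, and in the right factor `j m`. Both become
    -- the same combination of `v m` and `v (suc m)`, up to `b ^ m`.
    j-step : ∀ m → j (suc m) ≈ b ^ m * j m
    j-step m = begin
      j (suc m) ≈⟨ j≈ˡ m ⟩
      b ^ suc m * v (suc m) + b ^ m * v m ≈⟨ solve 4 (λ b B x y → b :* B :* x :+ B :* y := B :* (y :+ b :* x)) refl _ _ _ _ ⟩
      b ^ m * (v m + b * v (suc m)) ≈⟨ *-congˡ (j≈ʳ m) ⟨
      b ^ m * j m ∎

  ev-telescope : ∀ c → ev β (λ m → c m - b * c (suc m)) ≈ c 0
  ev-telescope c = begin
    ev β (λ m → c m - b * c (suc m)) ≈⟨ trans (ev-- β _ _) (+-cong (ev-unfold β c) (-‿cong (ev-*ˡ β b _))) ⟩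
    c 0 + b * ev β (tail c) - b * ev β (tail c) ≈⟨ solve 2 (λ a x → a :+ x :- x := a) refl _ _ ⟩
    c 0 ∎

  σ-sum : sym-ev β β σ ≈ r 1 + b * r 2
  σ-sum = begin
    σ 0 + (q * β * ev β (tail σ) + q * β * ev β (tail σ)) ≈⟨ +-cong (σ≈ 0) (+-cong (*-congˡ tails) (*-congˡ tails)) ⟩
    r 1 - b * r 2 + (b * r 2 + b * r 2) ≈⟨ solve 2 (λ x y → x :- y :+ (y :+ y) := x :+ y) refl _ _ ⟩
    r 1 + b * r 2 ∎
    where
    σ≈ : ∀ m → σ m ≈ r (suc m) - b * r (suc (suc m))
    σ≈ m = trans (solve 2 (λ x y → x := x :+ y :- y) refl (σ m) _) (+-congʳ (σ-r m))
    tails : ev β (tail σ) ≈ r 2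
    tails = trans (ev-cong (λ m → σ≈ (suc m))) (ev-telescope (λ m → r (suc (suc m))))

  -- Durfee's identity 1 + Σ_{D≥1} b^{D²} / (b; b)_D² = 1/(b; b)_∞, that is, the rank series of
  -- partitions at z = 1. By `σ-r` the sum over all ranks telescopes to the left side of
  -- `r-recurrence₀`. It normalises the triple product and evaluates E(i).
  rank-sum : 1# + b * symbols β β ≈ parts
  rank-sum = begin
    1# + b * symbols β β ≈⟨ +-congˡ (*-congˡ (symbols-ladder β β)) ⟩
    1# + b * sym-ev β β σ ≈⟨ +-congˡ (*-congˡ σ-sum) ⟩
    1# + b * (r 1 + b * r 2) ≈⟨ solve 3 (λ b x y → :1 :+ b :* (x :+ b :* y) := :1 :+ b :* x :+ b :* b :* y) refl _ _ _ ⟩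
    1# + b * r 1 + b * b * r 2 ≈⟨ r-recurrence₀ ⟩
    parts ∎

  private
    recip-row : ∀ a → recip (suc a) ≈ row β a
    recip-row zero = trans (*-identityˡ _) (geom-cong (*-identityʳ β))
    recip-row (suc a) = *-congʳ (recip-row a)

    j₀ : j 0 ≈ parts
    j₀ = begin
      j 0 ≈⟨ trans (ev-cong (λ k → *-congʳ (reflexive (≡.cong g (ℕₚ.+-identityʳ k))))) (ev-unfold β _) ⟩
      1# * 1# * (1# * 1#) + b * ev β (λ k → g (suc k) * g (suc k))
        ≈⟨ +-cong (solve 0 (:1 :* :1 :* (:1 :* :1) := :1) refl) (*-congˡ shape) ⟩
      1# + b * symbols β β ≈⟨ rank-sum ⟩
      parts ∎
      where
      square : ∀ k → g (suc k) * g (suc k) ≈ b ^ k * (b ^ (k ℕ.* k) * (row β k * row β k))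
      square k = begin
        tri (suc k) * recip (suc k) * (tri (suc k) * recip (suc k)) ≈⟨ solve 2 (λ t r → t :* r :* (t :* r) := t :* t :* (r :* r)) refl _ _ ⟩
        tri (suc k) * tri (suc k) * (recip (suc k) * recip (suc k)) ≈⟨ *-cong (tri² k) (*-cong (recip-row k) (recip-row k)) ⟩
        b ^ k * b ^ (k ℕ.* k) * (row β k * row β k) ≈⟨ *-assoc _ _ _ ⟩
        b ^ k * (b ^ (k ℕ.* k) * (row β k * row β k)) ∎
        where
        tri² : ∀ a → tri (suc a) * tri (suc a) ≈ b ^ a * b ^ (a ℕ.* a)
        tri² zero = solve 0 (:1 :* :1 :* (:1 :* :1) := :1 :* :1) refl
        tri² (suc a) = begin
          b ^ suc a * T * (b ^ suc a * T) ≈⟨ solve 3 (λ b B T → b :* B :* T :* (b :* B :* T) := b :* b :* (B :* B) :* (T :* T)) refl _ _ _ ⟩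
          b * b * (b ^ a * b ^ a) * (T * T) ≈⟨ *-congˡ (tri² a) ⟩
          b * b * (b ^ a * b ^ a) * (b ^ a * b ^ (a ℕ.* a)) ≈⟨ solve 3 (λ b B S → b :* b :* (B :* B) :* (B :* S) := b :* B :* (b :* (B :* (B :* S)))) refl _ _ _ ⟩
          b ^ suc a * (b * (b ^ a * (b ^ a * b ^ (a ℕ.* a))))
            ≈⟨ *-congˡ (*-congˡ (trans (*-congˡ (sym (^-homo-* b a _))) (trans (sym (^-homo-* b a _)) (reflexive (≡.cong (λ k → b ^ (a ℕ.+ k)) (≡.sym (ℕₚ.*-suc a a))))))) ⟩
          b ^ suc a * b ^ (suc a ℕ.* suc a) ∎
          where T = tri (suc a)
      shape : ev β (λ k → g (suc k) * g (suc k)) ≈ symbols β β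
      shape = trans (ev-cong square) (sym (ev-scale b β _))

    j-tri : ∀ m → j m ≈ parts * tri m
    j-tri zero = trans j₀ (sym (*-identityʳ _))
    j-tri (suc m) = trans (j-step m) (trans (*-congˡ (j-tri m)) (solve 3 (λ B P t → B :* (P :* t) := P :* (B :* t)) refl _ _ _))

  -- The hypothesis says X Y = b. Hence Yᵐ b^{m(m-1)/2} is the term of index -m of Σ_{n∈ℤ}
  -- b^{n(n-1)/2} Xⁿ, and `sym-ev` is the whole bilateral series.
  jacobi : ∀ x y → q * x * y ≈ β → poch∞ x β * poch∞ y β ≈ parts * sym-ev x y tri
  jacobi x y h = begin
    poch∞ x β * poch∞ y β ≈⟨ *-cong (ev-g x) (ev-g y) ⟨
    ev x g * ev y g ≈⟨ norm x y g ⟩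
    sym-ev x y (diagonal (q * x * y) (λ a c → g a * g c)) ≈⟨ sym-ev-cong {x} {y} (λ m → trans (ev-congˣ (λ k → g (k ℕ.+ m) * g k) h) (j-tri m)) ⟩
    sym-ev x y (λ m → parts * tri m) ≈⟨ sym-ev-*ˡ x y parts tri ⟩
    parts * sym-ev x y tri ∎

-- From coefficient sequences back to the values of E and Θ.

module Evaluation (𝒞 : CompleteRing) where
  open Series 𝒞
  open Grouping 𝒞
  open Products 𝒞
  open Recurrence 𝒞
  open Theta 𝒞
  open Combination 𝒞

  sym-ev-scale : ∀ c x y d → sym-ev x y (λ m → c ^ m * d m) ≈ sym-ev (c * x) (c * y) d
  sym-ev-scale c x y d = +-cong (*-identityˡ _) (+-cong (part x) (part y))
    where
    part : ∀ x → q * x * ev x (λ m → c ^ suc m * d (suc m)) ≈ q * (c * x) * ev (c * x) (tail d)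
    part x = begin
      q * x * ev x (λ m → c * c ^ m * d (suc m)) ≈⟨ *-congˡ (trans (ev-cong (λ m → *-assoc _ _ _)) (ev-*ˡ x c _)) ⟩
      q * x * (c * ev x (λ m → c ^ m * d (suc m))) ≈⟨ *-congˡ (*-congˡ (ev-scale c x _)) ⟨
      q * x * (c * ev (c * x) (tail d)) ≈⟨ solve 4 (λ q x c e → q :* x :* (c :* e) := q :* (c :* x) :* e) refl _ _ _ _ ⟩
      q * (c * x) * ev (c * x) (tail d) ∎

  private
    none : ℕ → C
    none _ = 0#

  sym-ev-interleave : ∀ x y c → sym-ev x y (interleave c none) ≈ sym-ev (q * x * x) (q * y * y) c
  sym-ev-interleave x y c = +-congˡ (+-cong (part x) (part y))
    where
    part : ∀ x → q * x * ev x (tail (interleave c none)) ≈ q * (q * x * x) * ev (q * x * x) (tail c)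
    part x = begin
      q * x * ev x (tail (interleave c none)) ≈⟨ *-congˡ (ev-even-odd x _) ⟩
      q * x * (ev X (λ n → interleave c none (suc (n ℕ.+ n))) + q * x * ev X (λ n → interleave (tail c) none (n ℕ.+ n)))
        ≈⟨ *-congˡ (+-cong (ev-cong (λ n → reflexive (interleave-odd c none n))) (*-congˡ (ev-cong (λ n → reflexive (interleave-even (tail c) none n))))) ⟩
      q * x * (ev X none + q * x * ev X (tail c)) ≈⟨ *-congˡ (+-congʳ zero-ev) ⟩
      q * x * (0# + q * x * ev X (tail c)) ≈⟨ solve 3 (λ q x e → q :* x :* (:0 :+ q :* x :* e) := q :* (q :* x :* x) :* e) refl _ _ _ ⟩
      q * X * ev X (tail c) ∎
      where
      X = q * x * x
      zero-ev : ev X none ≈ 0#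
      zero-ev = trans (ev-cong {ψ = λ _ → 0# * 0#} (λ _ → sym (zeroˡ 0#))) (trans (ev-*ˡ X 0# (λ _ → 0#)) (zeroˡ _))

  private
    n : ℕ → C
    n j = (- p) ^ j * Pu.r j

    -- The odd entries are the coefficients of (z + 1/z) times a series in z², which is what
    -- `neighbours` produces. Arbitrary `E`, `O` and `n` are allowed so that the induction can drop
    -- their heads.
    w-split : ∀ E O (n : ℕ → C) → (∀ j → O j ≈ p * (n j + p * n (suc j))) →
      ∀ m → interleave E O m ≈ interleave E none m + p * neighbours p (interleave n none) m
    w-split E O n h zero = solve 2 (λ e p → e := e :+ p :* (p :* :0 :+ p :* :0)) refl _ _
    w-split E O n h (suc m) = go E O n h m
      where
      go : ∀ E O (n : ℕ → C) → (∀ j → O j ≈ p * (n j + p * n (suc j))) →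
        ∀ m → interleave E O (suc m) ≈ interleave E none (suc m) + p * (interleave n none m + p * interleave n none (suc (suc m)))
      go E O n h zero = trans (h 0) (sym (+-identityˡ _))
      go E O n h (suc zero) = solve 2 (λ e p → e := e :+ p :* (:0 :+ p :* :0)) refl _ _
      go E O n h (suc (suc m)) = go (tail E) (tail O) (tail n) (λ j → h (suc j)) m

    odd-n : ∀ j → odd-part j ≈ p * (n j + p * n (suc j))
    odd-n j = solve 4 (λ p y a a′ → y :* (p :* (a :- p :^ 2 :* a′)) := p :* (y :* a :+ p :* ((:- p) :* y :* a′))) refl p _ _ _

    c³ : C
    c³ = - (p * p * p)

    cube : ∀ j → (- p) ^ j * (- p) ^ j * (- p) ^ j ≈ c³ ^ j
    cube zero = solve 0 (:1 :* :1 :* :1 := :1) refl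
    cube (suc j) = trans (solve 2 (λ p y → let y′ = (:- p) :* y in y′ :* y′ :* y′ := (:- (p :* p :* p)) :* (y :* y :* y)) refl p _) (*-congˡ (cube j))

    even-σ : ∀ j → even-part j ≈ u * (c³ ^ j * Pu.σ j)
    even-σ j = begin
      Y * (p ^ 4 * (Pu.r (1 ℕ.+ j) - p ^ 4 * Pu.r (2 ℕ.+ j)))
        ≈⟨ *-cong (cube j) (*-cong (sym u≈p⁴) (+-congˡ (-‿cong (*-congʳ (sym u≈p⁴))))) ⟩
      c³ ^ j * (u * (Pu.r (1 ℕ.+ j) - u * Pu.r (2 ℕ.+ j)))
        ≈⟨ *-congˡ (*-congˡ (trans (+-congʳ (sym (Pu.σ-r j))) (solve 2 (λ s x → s :+ x :- x := s) refl _ _))) ⟩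
      c³ ^ j * (u * Pu.σ j) ≈⟨ solve 3 (λ a u s → a :* (u :* s) := u :* (a :* s)) refl _ _ _ ⟩
      u * (c³ ^ j * Pu.σ j) ∎
      where Y = (- p) ^ j * (- p) ^ j * (- p) ^ j

  -- Chosen so that `q * x¹ x` is -q⁴ x², the argument of R₄(-z²), and `q * x³ x` is -u x², the
  -- argument of S₄(-z²).
  x¹ x³ : C → C
  x¹ x = - p * (q * x * x)
  x³ x = - (p * p * p) * (q * x * x)

  e-value : ∀ x y → x * y ≈ 1# → sym-ev x y e ≈
    (q * x + q * y) * (Pp.symbols x y + p * Pu.symbols (x¹ x) (x¹ y)) + (1# + u * Pu.symbols (x³ x) (x³ y))
  e-value x y xy = begin
    sym-ev x y e ≈⟨ trans (sym-ev-+ x y s (λ m → w m + δ m)) (+-congˡ (sym-ev-+ x y w δ)) ⟩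
    sym-ev x y s + (sym-ev x y w + sym-ev x y δ) ≈⟨ +-cong s-part (+-cong w-part δ-part) ⟩
    (q * x + q * y) * R + ((u * S + p * ((q * x + q * y) * N)) + 1#)
      ≈⟨ solve 6 (λ k r u s p n → k :* r :+ ((u :* s :+ p :* (k :* n)) :+ :1) := k :* (r :+ p :* n) :+ (:1 :+ u :* s)) refl _ _ _ _ _ _ ⟩
    (q * x + q * y) * (R + p * N) + (1# + u * S) ∎
    where
    R = Pp.symbols x y
    N = Pu.symbols (x¹ x) (x¹ y)
    S = Pu.symbols (x³ x) (x³ y)
    pxy : q * x * (q * y) ≈ p
    pxy = trans (solve 3 (λ q x y → q :* x :* (q :* y) := q :* q :* (x :* y)) refl _ _ _) (trans (*-congˡ xy) (*-identityʳ _))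
    neighbours-cong : ∀ {k l} c → k ≈ l → ∀ m → neighbours k c m ≈ neighbours l c m
    neighbours-cong c h zero = +-cong (*-congʳ h) (*-congʳ h)
    neighbours-cong c h (suc m) = +-congˡ (*-congʳ h)
    times : ∀ c → sym-ev x y (neighbours p c) ≈ (q * x + q * y) * sym-ev x y c
    times c = trans (sym-ev-cong {x} {y} (neighbours-cong c (sym pxy))) (sym (sym-ev-neighbours x y c))
    s-part : sym-ev x y s ≈ (q * x + q * y) * R
    s-part = trans (times Pp.r) (*-congˡ (trans
      (sym-ev-cong {x} {y} (λ m → ev-congˣ (λ k → Pp.gauss (k ℕ.+ m) k) (sym (trans (*-assoc q x y) (trans (*-congˡ xy) (*-identityʳ q))))))
      (sym (Pp.symbols-ladder x y))))
    δ-part : sym-ev x y δ ≈ 1#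
    δ-part = trans (+-congˡ (+-cong (zero-part x) (zero-part y))) (solve 0 (:1 :+ (:0 :+ :0) := :1) refl)
      where
      zero-part : ∀ x → q * x * ev x (λ _ → 0#) ≈ 0#
      zero-part x = trans (*-congˡ (trans (ev-cong {ψ = λ _ → 0# * 0#} (λ _ → sym (zeroˡ 0#))) (trans (ev-*ˡ x 0# (λ _ → 0#)) (zeroˡ _)))) (zeroʳ _)
    N-part : sym-ev x y (interleave n none) ≈ N
    N-part = begin
      sym-ev x y (interleave n none) ≈⟨ sym-ev-interleave x y n ⟩
      sym-ev (q * x * x) (q * y * y) n ≈⟨ sym-ev-scale (- p) _ _ Pu.r ⟩
      sym-ev (x¹ x) (x¹ y) Pu.r
        ≈⟨ sym-ev-cong {x¹ x} {x¹ y} (λ m → ev-congˣ (λ k → Pu.gauss (k ℕ.+ m) k) (sym base)) ⟩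
      sym-ev (x¹ x) (x¹ y) (Pu.ladder (q * x¹ x * x¹ y)) ≈⟨ Pu.symbols-ladder _ _ ⟨
      N ∎
      where
      base : q * x¹ x * x¹ y ≈ υ
      base = begin
        q * (- p * (q * x * x)) * (- p * (q * y * y))
          ≈⟨ solve 3 (λ q x y → let p = q :* q in q :* (:- p :* (q :* x :* x)) :* (:- p :* (q :* y :* y)) := q :* (p :* p :* p) :* (x :* y :* (x :* y))) refl q x y ⟩
        υ * (x * y * (x * y)) ≈⟨ *-congˡ (trans (*-cong xy xy) (*-identityˡ _)) ⟩
        υ * 1# ≈⟨ *-identityʳ υ ⟩ υ ∎
    S-part : sym-ev x y (interleave even-part none) ≈ u * S
    S-part = begin
      sym-ev x y (interleave even-part none) ≈⟨ sym-ev-interleave x y even-part ⟩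
      sym-ev (q * x * x) (q * y * y) even-part ≈⟨ sym-ev-cong {q * x * x} {q * y * y} even-σ ⟩
      sym-ev (q * x * x) (q * y * y) (λ j → u * (c³ ^ j * Pu.σ j)) ≈⟨ sym-ev-*ˡ _ _ u (λ j → c³ ^ j * Pu.σ j) ⟩
      u * sym-ev (q * x * x) (q * y * y) (λ j → c³ ^ j * Pu.σ j) ≈⟨ *-congˡ (sym-ev-scale c³ _ _ Pu.σ) ⟩
      u * sym-ev (x³ x) (x³ y) Pu.σ
        ≈⟨ *-congˡ (sym-ev-cong {x³ x} {x³ y} (λ m → ev-congˣ (λ k → Pu.gauss (k ℕ.+ m) k) (sym base))) ⟩
      u * sym-ev (x³ x) (x³ y) (Pu.ladder (q * x³ x * x³ y)) ≈⟨ *-congˡ (Pu.symbols-ladder _ _) ⟨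
      u * S ∎
      where
      base : q * x³ x * x³ y ≈ u * υ
      base = begin
        q * (- (p * p * p) * (q * x * x)) * (- (p * p * p) * (q * y * y))
          ≈⟨ solve 3 (λ q x y → let p = q :* q ; c = :- (p :* p :* p) ; υ = q :* (p :* p :* p) in
               q :* (c :* (q :* x :* x)) :* (c :* (q :* y :* y)) := q :* υ :* υ :* (x :* y :* (x :* y))) refl q x y ⟩
        u * υ * (x * y * (x * y)) ≈⟨ *-congˡ (trans (*-cong xy xy) (*-identityˡ _)) ⟩
        u * υ * 1# ≈⟨ *-identityʳ _ ⟩ u * υ ∎
    w-part : sym-ev x y w ≈ u * S + p * ((q * x + q * y) * N)
    w-part = begin
      sym-ev x y w ≈⟨ sym-ev-cong {x} {y} (w-split even-part odd-part n odd-n) ⟩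
      sym-ev x y (λ m → interleave even-part none m + p * neighbours p (interleave n none) m)
        ≈⟨ trans (sym-ev-+ x y (interleave even-part none) (λ m → p * neighbours p (interleave n none) m)) (+-congˡ (sym-ev-*ˡ x y p (neighbours p (interleave n none)))) ⟩
      sym-ev x y (interleave even-part none) + p * sym-ev x y (neighbours p (interleave n none))
        ≈⟨ +-cong S-part (*-congˡ (trans (times _) (*-congˡ N-part))) ⟩
      u * S + p * ((q * x + q * y) * N) ∎

  x² : C → C
  x² x = q * (q * x) * (q * x)

  -- (X; p)_∞ (-p X²; p²)_∞ with X = `q * x`, so that Θ(z) is the inverse of `Π z * Π z̄` when z̄ =
  -- 1/z.
  Π : C → C
  Π x = poch∞ (- x) q * poch∞ (x² x) (q * p)

  private
    f-step : ∀ x → ev (p * x) f ≈ (1# - q * x) * (1# + q * x² x) * ev x f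
    f-step x = begin
      ev (p * x) f ≈⟨ trans (ev-scale p x f) (ev-cong f-law) ⟩
      ev x (λ a → f a - f¹ a + p * f² a - p * f³ a)
        ≈⟨ trans (ev-- x _ _) (+-cong (trans (ev-+ x _ _) (+-cong (ev-- x _ _) (ev-*ˡ x p _))) (-‿cong (ev-*ˡ x p _))) ⟩
      F - ev x f¹ + p * ev x f² - p * ev x f³ ≈⟨ +-cong (+-cong (+-congˡ (-‿cong e¹)) (*-congˡ e²)) (-‿cong (*-congˡ e³)) ⟩
      F - q * x * F + p * (q * x * (q * x * F)) - p * (q * x * (q * x * (q * x * F)))
        ≈⟨ solve 3 (λ q x F → let p = q :* q ; X = q :* x in F :- X :* F :+ p :* (X :* (X :* F)) :- p :* (X :* (X :* (X :* F)))
             := (:1 :- X) :* (:1 :+ q :* (q :* X :* X)) :* F) refl q x F ⟩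
      (1# - q * x) * (1# + q * x² x) * F ∎
      where
      F = ev x f
      f¹ = shift f
      f² = shift f¹
      f³ = shift f²
      e¹ : ev x f¹ ≈ q * x * F
      e¹ = ev-shift x f
      e² : ev x f² ≈ q * x * (q * x * F)
      e² = trans (ev-shift x f¹) (*-congˡ e¹)
      e³ : ev x f³ ≈ q * x * (q * x * (q * x * F))
      e³ = trans (ev-shift x f²) (*-congˡ e²)

    f-iterate : ∀ x k → ev (p ^ k * x) f ≈ poch (- x) q k * poch (x² x) (q * p) k * ev x f
    f-iterate x zero = trans (ev-congˣ f (*-identityˡ x)) (solve 1 (λ F → F := :1 :* :1 :* F) refl _)
    f-iterate x (suc k) = begin
      ev (p * p ^ k * x) f ≈⟨ trans (ev-congˣ f (*-assoc _ _ _)) (f-step (p ^ k * x)) ⟩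
      (1# - q * (p ^ k * x)) * (1# + q * x² (p ^ k * x)) * ev (p ^ k * x) f ≈⟨ *-cong (*-cong left right) (f-iterate x k) ⟩
      (1# + q * - x * (q * q) ^ k) * (1# + q * x² x * (q * (q * p)) ^ k) * (poch (- x) q k * poch (x² x) (q * p) k * ev x f)
        ≈⟨ solve 5 (λ a b c d F → a :* b :* (c :* d :* F) := c :* a :* (d :* b) :* F) refl _ _ _ _ _ ⟩
      poch (- x) q (suc k) * poch (x² x) (q * p) (suc k) * ev x f ∎
      where
      left : 1# - q * (p ^ k * x) ≈ 1# + q * - x * (q * q) ^ k
      left = solve 3 (λ q P x → :1 :- q :* (P :* x) := :1 :+ q :* (:- x) :* P) refl q (p ^ k) x
      right : 1# + q * x² (p ^ k * x) ≈ 1# + q * x² x * (q * (q * p)) ^ k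
      right = +-congˡ (trans (solve 3 (λ q P x → q :* (q :* (q :* (P :* x)) :* (q :* (P :* x))) := q :* (q :* (q :* x) :* (q :* x)) :* (P :* P)) refl q (p ^ k) x)
        (*-congˡ (trans (sym (^-distrib-* p p k)) (^-congˡ k (solve 1 (λ q → let p = q :* q in p :* p := q :* (q :* p)) refl q)))))

    f-product : ∀ x → Π x * ev x f ≈ 1#
    f-product x = ≈[]⇒≈ (λ k → ≈[]-trans (*-cong[] (*-cong[] (poch-limit _ _ k) (poch-limit _ _ k)) (≈⇒≈[] k refl))
      (≈[]-trans (≈⇒≈[] k (sym (f-iterate x k))) (ev-≈[]1 q x f k refl)))

    t₀-unit : ∃ λ t⁻¹ → t 0 * t⁻¹ ≈ 1#
    t₀-unit = geom (- (q * R)) , (begin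
      t 0 * geom (- (q * R)) ≈⟨ *-congʳ (ev-unfold q _) ⟩
      (1# * 1# + q * q * R) * geom (- (q * R)) ≈⟨ *-congʳ (solve 2 (λ q R → :1 :* :1 :+ q :* q :* R := :1 :- q :* (:- (q :* R))) refl q R) ⟩
      (1# - q * - (q * R)) * geom (- (q * R)) ≈⟨ geom-inverse _ ⟩
      1# ∎)
      where R = ev q (λ k → f (suc k ℕ.+ 0) * f (suc k))

    e-proportional : ∀ x y → x * y ≈ 1# → sym-ev x y e * t 0 ≈ ev x f * ev y f * e 0
    e-proportional x y xy = begin
      sym-ev x y e * t 0 ≈⟨ trans (*-comm _ _) (sym (sym-ev-*ˡ x y (t 0) e)) ⟩
      sym-ev x y (λ m → t 0 * e m) ≈⟨ sym-ev-cong {x} {y} (λ m → trans (*-comm _ _) (trans (solution-proportional e-solution t-solution m) (*-comm _ _))) ⟩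
      sym-ev x y (λ m → e 0 * t m) ≈⟨ trans (sym-ev-*ˡ x y (e 0) t) (*-comm _ _) ⟩
      sym-ev x y t * e 0 ≈⟨ *-congʳ (sym-ev-cong {x} {y} (λ m → ev-congˣ (λ k → f (k ℕ.+ m) * f k) (sym (trans (*-assoc q x y) (trans (*-congˡ xy) (*-identityʳ q)))))) ⟩
      sym-ev x y (diagonal (q * x * y) (λ a c → f a * f c)) * e 0 ≈⟨ *-congʳ (norm x y f) ⟨
      ev x f * ev y f * e 0 ∎

  -- 1 / (Π x · Π y) also expands into a solution of the recurrence, hence into a multiple of e that is independent of x and y.
  e-transfer : ∀ x y x′ y′ → x * y ≈ 1# → x′ * y′ ≈ 1# → sym-ev x y e * (Π x * Π y) ≈ sym-ev x′ y′ e * (Π x′ * Π y′)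
  e-transfer x y x′ y′ xy x′y′ = unit-cancel (proj₂ t₀-unit) (trans (value x y xy) (sym (value x′ y′ x′y′)))
    where
    value : ∀ x y → x * y ≈ 1# → t 0 * (sym-ev x y e * (Π x * Π y)) ≈ e 0
    value x y xy = begin
      t 0 * (sym-ev x y e * (Π x * Π y)) ≈⟨ solve 4 (λ t s a b → t :* (s :* (a :* b)) := s :* t :* (a :* b)) refl _ _ _ _ ⟩
      sym-ev x y e * t 0 * (Π x * Π y) ≈⟨ *-congʳ (e-proportional x y xy) ⟩
      ev x f * ev y f * e 0 * (Π x * Π y) ≈⟨ solve 5 (λ a b c d e → a :* b :* c :* (d :* e) := c :* (d :* a :* (e :* b))) refl _ _ _ _ _ ⟩
      e 0 * (Π x * ev x f * (Π y * ev y f)) ≈⟨ *-congˡ (trans (*-cong (f-product x) (f-product y)) (*-identityˡ _)) ⟩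
      e 0 * 1# ≈⟨ *-identityʳ _ ⟩
      e 0 ∎

-- E(ζ) as a product of theta functions.

module EighthRoot (𝒞 : CompleteRing) (z z̄ : CompleteRing.C 𝒞)
  (z*z̄ : CompleteRing._≈_ 𝒞 (CompleteRing._*_ 𝒞 z z̄) (CompleteRing.1# 𝒞))
  (z̄² : CompleteRing._≈_ 𝒞 (CompleteRing._*_ 𝒞 z̄ z̄) (CompleteRing.-_ 𝒞 (CompleteRing._*_ 𝒞 z z))) where
  open Series 𝒞
  open Grouping 𝒞
  open Products 𝒞
  open Recurrence 𝒞
  open Combination 𝒞
  open Evaluation 𝒞

  i : C
  i = z * z

  i² : i * i ≈ - 1#
  i² = begin
    z * z * (z * z) ≈⟨ solve 1 (λ i → i :* i := :- (i :* (:- i))) refl i ⟩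
    - (z * z * - (z * z)) ≈⟨ -‿cong (*-congˡ z̄²) ⟨
    - (z * z * (z̄ * z̄)) ≈⟨ -‿cong (solve 2 (λ a b → a :* a :* (b :* b) := a :* b :* (a :* b)) refl z z̄) ⟩
    - (z * z̄ * (z * z̄)) ≈⟨ -‿cong (trans (*-cong z*z̄ z*z̄) (*-identityˡ 1#)) ⟩
    - 1# ∎

  i*-i : i * - i ≈ 1#
  i*-i = trans (solve 1 (λ i → i :* (:- i) := :- (i :* i)) refl i) (trans (-‿cong i²) (-‿involutive 1#))

  module J = Jacobi 𝒞
  module Pp² = Partitions 𝒞 (q * p)

  private
    p² : q * (q * p) ≈ p * p
    p² = solve 1 (λ q → q :* (q :* (q :* q)) := q :* q :* (q :* q)) refl q

    -- (1 + c a)(1 - c a) where c² = -1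
    conjugate : ∀ c d x b y w e → c * c ≈ - 1# → d ≈ - c → (∀ n → q * y * (q * e) ^ n ≈ (q * x * (q * b) ^ n) * (q * x * (q * b) ^ n)) → w ≈ y →
      poch∞ (c * x) b * poch∞ (d * x) b ≈ poch∞ w e
    conjugate c d x b y w e c² d≈ h w≈ = trans (*-congˡ (poch∞-cong (*-congʳ d≈) refl)) (trans (poch∞-mul (c * x) b (- c * x) b y e term) (poch∞-cong (sym w≈) refl))
      where
      term : ∀ n → factor (c * x) b n * factor (- c * x) b n ≈ factor y e n
      term n = begin
        (1# + q * (c * x) * B) * (1# + q * (- c * x) * B)
          ≈⟨ solve 4 (λ q c x B → (:1 :+ q :* (c :* x) :* B) :* (:1 :+ q :* (:- c :* x) :* B) := :1 :- c :* c :* (q :* x :* B :* (q :* x :* B))) refl _ _ _ _ ⟩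
        1# - c * c * (q * x * B * (q * x * B)) ≈⟨ +-congˡ (-‿cong (*-cong c² (sym (h n)))) ⟩
        1# - - 1# * (q * y * (q * e) ^ n) ≈⟨ solve 1 (λ a → :1 :- (:- :1) :* a := :1 :+ a) refl _ ⟩
        1# + q * y * (q * e) ^ n ∎
        where B = (q * b) ^ n

    squares : ∀ {a b} (c d : C) n → c * c ≈ d → a * a ≈ b → b * d ^ n ≈ (a * c ^ n) * (a * c ^ n)
    squares {a} {b} c d n c² a² = sym (trans (solve 2 (λ a C → a :* C :* (a :* C) := a :* a :* (C :* C)) refl a (c ^ n))
      (*-cong a² (trans (sym (^-distrib-* c c n)) (^-congˡ n c²))))

    -- In this order: (-p; p²)_∞, (p²; p²)_∞, (-p²; p²)_∞, (-qζ, -q/ζ; p)_∞, (-p²; p⁴)_∞ and (-p⁴;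
    -- p⁴)_∞.
    B G K M D₂ D₄ : C
    B = poch∞ q (q * p)
    G = Pp².euler
    K = poch∞ (q * p) (q * p)
    M = poch∞ z q * poch∞ z̄ q
    D₂ = poch∞ (q * p) υ
    D₄ = poch∞ υ υ

    x²-i : ∀ c → c * c ≈ - 1# → x² c ≈ - (q * p)
    x²-i c c² = begin
      q * (q * c) * (q * c) ≈⟨ solve 2 (λ q c → q :* (q :* c) :* (q :* c) := q :* (q :* q) :* (c :* c)) refl q c ⟩
      q * p * (c * c) ≈⟨ *-congˡ c² ⟩
      q * p * - 1# ≈⟨ solve 1 (λ a → a :* (:- :1) := :- a) refl _ ⟩
      - (q * p) ∎

    [-i]² : - i * - i ≈ - 1#
    [-i]² = trans (solve 1 (λ i → (:- i) :* (:- i) := i :* i) refl i) i²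

    Π-i : Π i * Π (- i) ≈ B * (G * G)
    Π-i = begin
      poch∞ (- i) q * poch∞ (x² i) (q * p) * (poch∞ (- - i) q * poch∞ (x² (- i)) (q * p))
        ≈⟨ *-cong (*-cong (poch∞-cong (sym (*-identityʳ _)) refl) (poch∞-cong (x²-i i i²) refl))
                  (*-cong (poch∞-cong (sym (*-identityʳ _)) refl) (poch∞-cong (x²-i (- i) [-i]²) refl)) ⟩
      poch∞ (- i * 1#) q * G * (poch∞ (- - i * 1#) q * G) ≈⟨ solve 3 (λ a b G → a :* G :* (b :* G) := a :* b :* (G :* G)) refl _ _ _ ⟩
      poch∞ (- i * 1#) q * poch∞ (- - i * 1#) q * (G * G)
        ≈⟨ *-congʳ (conjugate (- i) (- - i) 1# q q q (q * p) [-i]² refl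
             (λ n → squares (q * q) (q * (q * p)) n (solve 1 (λ q → q :* q :* (q :* q) := q :* (q :* (q :* q))) refl q) (solve 1 (λ q → q :* :1 :* (q :* :1) := q :* q) refl q)) refl) ⟩
      B * (G * G) ∎

    -z z̃ : C
    -z = poch∞ (- z) q
    z̃ = poch∞ (- z̄) q

    Π-z : Π z * Π z̄ ≈ -z * z̃ * D₄
    Π-z = begin
      -z * poch∞ (x² z) (q * p) * (z̃ * poch∞ (x² z̄) (q * p))
        ≈⟨ *-cong (*-congˡ (poch∞-cong (solve 2 (λ q z → q :* (q :* z) :* (q :* z) := z :* z :* (q :* (q :* q))) refl q z) refl))
                  (*-congˡ (poch∞-cong (solve 2 (λ q z → q :* (q :* z) :* (q :* z) := z :* z :* (q :* (q :* q))) refl q z̄) refl)) ⟩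
      -z * poch∞ (i * (q * p)) (q * p) * (z̃ * poch∞ (z̄ * z̄ * (q * p)) (q * p))
        ≈⟨ solve 4 (λ a b c d → a :* b :* (c :* d) := a :* c :* (b :* d)) refl _ _ _ _ ⟩
      -z * z̃ * (poch∞ (i * (q * p)) (q * p) * poch∞ (z̄ * z̄ * (q * p)) (q * p))
        ≈⟨ *-congˡ (conjugate i (z̄ * z̄) (q * p) (q * p) υ υ υ i² z̄²
             (λ n → squares (q * (q * p)) (q * υ) n quad quad) refl) ⟩
      -z * z̃ * D₄ ∎
      where
      quad : q * (q * p) * (q * (q * p)) ≈ q * υ
      quad = solve 1 (λ q → let p = q :* q in q :* (q :* p) :* (q :* (q :* p)) := q :* (q :* (p :* p :* p))) refl q

    difference : ∀ c n → factor (- c) q n * factor c q n ≈ factor (- (c * c) * q) (q * p) n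
    difference c n = begin
      (1# + q * - c * (q * q) ^ n) * (1# + q * c * (q * q) ^ n)
        ≈⟨ solve 3 (λ q c B → (:1 :+ q :* (:- c) :* B) :* (:1 :+ q :* c :* B) := :1 :+ q :* (:- (c :* c) :* q) :* (B :* B)) refl _ _ _ ⟩
      1# + q * (- (c * c) * q) * ((q * q) ^ n * (q * q) ^ n) ≈⟨ +-congˡ (*-congˡ (trans (sym (^-distrib-* p p n)) (^-congˡ n (sym p²)))) ⟩
      1# + q * (- (c * c) * q) * (q * (q * p)) ^ n ∎

    -zM : -z * z̃ * M ≈ D₂
    -zM = begin
      -z * z̃ * (poch∞ z q * poch∞ z̄ q) ≈⟨ solve 4 (λ a b c d → a :* b :* (c :* d) := (a :* c) :* (b :* d)) refl _ _ _ _ ⟩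
      -z * poch∞ z q * (z̃ * poch∞ z̄ q) ≈⟨ *-cong (poch∞-mul _ _ _ _ _ _ (difference z)) (poch∞-mul _ _ _ _ _ _ (difference z̄)) ⟩
      poch∞ (- i * q) (q * p) * poch∞ (- (z̄ * z̄) * q) (q * p)
        ≈⟨ conjugate (- i) (- (z̄ * z̄)) q (q * p) (q * p) (q * p) υ [-i]² (-‿cong z̄²)
             (λ n → squares (q * (q * p)) (q * υ) n (solve 1 (λ q → let p = q :* q in q :* (q :* p) :* (q :* (q :* p)) := q :* (q :* (p :* p :* p))) refl q)
                (solve 1 (λ q → q :* q :* (q :* q) := q :* (q :* (q :* q))) refl q)) refl ⟩
      D₂ ∎

    D₂D₄ : D₂ * D₄ ≈ K
    D₂D₄ = sym (trans (poch∞-split (q * p) (q * p)) (*-cong (poch∞-cong refl base) (poch∞-cong (trans (*-comm _ _) base) base)))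
      where
      base : q * (q * p) * (q * p) ≈ υ
      base = solve 1 (λ q → let p = q :* q in q :* (q :* p) :* (q :* p) := q :* (p :* p :* p)) refl q

    euler-double : Pp.euler * poch∞ q q ≈ G
    euler-double = trans (poch∞-mul (- q) q q q _ _ (difference q)) (poch∞-cong (solve 1 (λ q → :- (q :* q) :* q := :- (q :* (q :* q))) refl q) refl)

    qq≈BK : poch∞ q q ≈ B * K
    qq≈BK = trans (poch∞-split q q) (*-cong (poch∞-cong refl (*-assoc q q q)) (poch∞-cong refl (*-assoc q q q)))

  -- θ₃(p) = Σ p^{k²} and ϑ = Σ ζᵏ q^{k²}, summed over k ∈ ℤ.
  θ₃p ϑ : C
  θ₃p = sym-ev q q (J.tri (q * p))
  ϑ = sym-ev z z̄ (J.tri q)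

  private
    GBB : G * (B * B) ≈ θ₃p
    GBB = begin
      G * (B * B) ≈⟨ *-congˡ (J.jacobi (q * p) q q (*-assoc q q q)) ⟩
      G * (Pp².parts * θ₃p) ≈⟨ trans (sym (*-assoc _ _ _)) (trans (*-congʳ Pp².euler*parts) (*-identityˡ _)) ⟩
      θ₃p ∎

    GP : G * Pp.parts ≈ B * K
    GP = begin
      G * Pp.parts ≈⟨ *-congʳ euler-double ⟨
      Pp.euler * poch∞ q q * Pp.parts ≈⟨ solve 3 (λ a b c → a :* b :* c := a :* c :* b) refl _ _ _ ⟩
      Pp.euler * Pp.parts * poch∞ q q ≈⟨ trans (*-congʳ Pp.euler*parts) (*-identityˡ _) ⟩
      poch∞ q q ≈⟨ qq≈BK ⟩
      B * K ∎

    e-i : sym-ev i (- i) e ≈ Pu.parts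
    e-i = begin
      sym-ev i (- i) e ≈⟨ e-value i (- i) i*-i ⟩
      (q * i + q * - i) * R + (1# + u * Pu.symbols (x³ i) (x³ (- i))) ≈⟨ +-cong (trans (*-congʳ (solve 2 (λ q i → q :* i :+ q :* (:- i) := :0) refl q i)) (zeroˡ _)) (+-congˡ (*-congˡ same)) ⟩
      0# + (1# + u * Pu.symbols υ υ) ≈⟨ +-identityˡ _ ⟩
      1# + u * Pu.symbols υ υ ≈⟨ J.rank-sum υ ⟩
      Pu.parts ∎
      where
      R = Pp.symbols i (- i) + p * Pu.symbols (x¹ i) (x¹ (- i))
      x³-i : ∀ c → c * c ≈ - 1# → x³ c ≈ υ
      x³-i c c² = begin
        - (p * p * p) * (q * c * c) ≈⟨ solve 2 (λ q c → let p = q :* q in :- (p :* p :* p) :* (q :* c :* c) := :- (q :* (p :* p :* p)) :* (c :* c)) refl q c ⟩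
        - υ * (c * c) ≈⟨ *-congˡ c² ⟩
        - υ * - 1# ≈⟨ solve 1 (λ a → :- a :* :- :1 := a) refl υ ⟩
        υ ∎
      same : Pu.symbols (x³ i) (x³ (- i)) ≈ Pu.symbols υ υ
      same = trans (ev-congˣ _ (*-cong (*-congˡ (x³-i i i²)) (x³-i (- i) [-i]²)))
        (ev-cong (λ D → *-congˡ (*-cong (Pu.row-cong D (x³-i i i²)) (Pu.row-cong D (x³-i (- i) [-i]²)))))

  -- `e-transfer` compares ζ with i. The product Π(ζ) Π(1/ζ) contains (qζ, q/ζ; p)_∞, which `M`
  -- completes to the rational product `D₂`, while `M` itself is the triple product for `ϑ`. The
  -- factor `K`, equal to `D₂ * D₄`, appears on both sides and is cancelled at the end.
  e-z : sym-ev z z̄ e ≈ Pu.parts * θ₃p * ϑ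
  e-z = poch-cancel (q * p) (q * p) (begin
    K * E ≈⟨ *-congʳ D₂D₄ ⟨
    D₂ * D₄ * E ≈⟨ *-congʳ (*-congʳ -zM) ⟨
    -z * z̃ * M * D₄ * E ≈⟨ solve 4 (λ a M D E → a :* M :* D :* E := E :* (a :* D) :* M) refl _ _ _ _ ⟩
    E * (-z * z̃ * D₄) * M ≈⟨ *-congʳ (trans (*-congˡ (sym Π-z)) (trans (e-transfer z z̄ i (- i) z*z̄ i*-i) (*-cong e-i Π-i))) ⟩
    Pu.parts * (B * (G * G)) * M ≈⟨ *-congˡ (J.jacobi q z z̄ (trans (*-assoc q z z̄) (trans (*-congˡ z*z̄) (*-identityʳ q)))) ⟩
    Pu.parts * (B * (G * G)) * (Pp.parts * ϑ) ≈⟨ solve 5 (λ Q B G P t → Q :* (B :* (G :* G)) :* (P :* t) := Q :* (B :* G) :* (G :* P) :* t) refl _ _ _ _ _ ⟩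
    Pu.parts * (B * G) * (G * Pp.parts) * ϑ ≈⟨ *-congʳ (*-congˡ GP) ⟩
    Pu.parts * (B * G) * (B * K) * ϑ ≈⟨ solve 5 (λ Q B G K t → Q :* (B :* G) :* (B :* K) :* t := K :* (Q :* (G :* (B :* B)) :* t)) refl _ _ _ _ _ ⟩
    K * (Pu.parts * (G * (B * B)) * ϑ) ≈⟨ *-congˡ (*-congʳ (*-congˡ GBB)) ⟩
    K * (Pu.parts * θ₃p * ϑ) ∎)
    where E = sym-ev z z̄ e

-- Σ_{n ∈ ℤ} uⁿ (-u ; u²)_n, the case b = 0 of Ramanujan's ₁ψ₁, in terms of h = q⁴ with h² = u.
module Bilateral (𝒞 : CompleteRing) where
  open Series 𝒞
  open Products 𝒞
  open Recurrence 𝒞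
  open Combination 𝒞

  β₂ b₂ : C
  β₂ = u * υ
  b₂ = q * β₂

  module J₂ = Jacobi 𝒞 β₂

  sq : ℕ → C
  sq zero = 1#
  sq (suc n) = u * b₂ ^ n * sq n

  -- L = (-u; u²)_∞, N = Σ_{n≥0} uⁿ (-u; u²)_n, Ψ = Σ_{n≥0} u^{n²+n} and V = Σ_l uˡ / (u²; u²)_l =
  -- 1/(u; u²)_∞.
  L N Ψ V : C
  L = poch∞ υ β₂
  N = ev υ (poch υ β₂)
  Ψ = ev υ sq
  V = ev υ J₂.recip

  private
    η h : C
    η = q * p
    h = q * η

    v : ℕ → C
    v = J₂.recip

    h² : h * h ≈ u
    h² = solve 1 (λ q → let p = q :* q in q :* (q :* p) :* (q :* (q :* p)) := q :* (q :* (p :* p :* p))) refl q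

    h⁴ : u * u ≈ b₂
    h⁴ = solve 2 (λ q υ → q :* υ :* (q :* υ) := q :* (q :* υ :* υ)) refl q υ

    hη : h * η ≈ υ
    hη = solve 1 (λ q → let p = q :* q in q :* (q :* p) :* (q :* p) := q :* (p :* p :* p)) refl q

    ev-h : ∀ φ → ev η (λ n → h ^ n * φ n) ≈ ev υ φ
    ev-h φ = trans (sym (ev-scale h η φ)) (ev-congˣ φ hη)

    -- h^{2n²+n} and h^{2l²-l}: the values of h^{2d²+d} at d = n and at d = -l.
    A B : ℕ → C
    A zero = 1#
    A (suc n) = h * u * b₂ ^ n * A n
    B zero = 1#
    B (suc l) = h * b₂ ^ l * B l

    A-sq : ∀ n → A n ≈ h ^ n * sq n
    A-sq zero = sym (*-identityˡ _)
    A-sq (suc n) = trans (*-congˡ (A-sq n)) (solve 5 (λ h u b H s → h :* u :* b :* (H :* s) := h :* H :* (u :* b :* s)) refl _ _ _ _ _)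

    B-tri : ∀ l → B l ≈ h ^ l * J₂.tri l
    B-tri zero = sym (*-identityˡ _)
    B-tri (suc l) = trans (*-congˡ (B-tri l)) (solve 4 (λ h b H t → h :* b :* (H :* t) := h :* H :* (b :* t)) refl _ _ _ _)

    BA : ∀ l → b₂ ^ l * B l ≈ A l * u ^ l
    BA zero = refl
    BA (suc l) = begin
      b₂ * b₂ ^ l * (h * b₂ ^ l * B l) ≈⟨ solve 4 (λ b P h B → b :* P :* (h :* P :* B) := b :* (h :* P :* (P :* B))) refl _ _ _ _ ⟩
      b₂ * (h * b₂ ^ l * (b₂ ^ l * B l)) ≈⟨ *-cong (sym h⁴) (*-congˡ (BA l)) ⟩
      u * u * (h * b₂ ^ l * (A l * u ^ l)) ≈⟨ solve 5 (λ u h P A U → u :* u :* (h :* P :* (A :* U)) := h :* u :* P :* A :* (u :* U)) refl _ _ _ _ _ ⟩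
      A (suc l) * u ^ suc l ∎

    -- Λ n l = h^{2d² + d} with d = n - l.
    Λ : ℕ → ℕ → C
    Λ n zero = A n
    Λ zero (suc l) = B (suc l)
    Λ (suc n) (suc l) = Λ n l

    Λ₀ : ∀ l → Λ 0 l ≈ B l
    Λ₀ zero = refl
    Λ₀ (suc l) = refl

    Λ-twist : ∀ n l → Λ (suc n) l * b₂ ^ l ≈ h * u * b₂ ^ n * Λ n l
    Λ-twist n zero = *-identityʳ _
    Λ-twist zero (suc l) = begin
      Λ 0 l * (b₂ * b₂ ^ l) ≈⟨ *-cong (Λ₀ l) (*-congʳ (sym h⁴)) ⟩
      B l * (u * u * b₂ ^ l) ≈⟨ *-congˡ (*-congʳ (*-congʳ (sym h²))) ⟩
      B l * (h * h * u * b₂ ^ l) ≈⟨ solve 4 (λ B h u P → B :* (h :* h :* u :* P) := h :* u :* :1 :* (h :* P :* B)) refl _ _ _ _ ⟩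
      h * u * 1# * (h * b₂ ^ l * B l) ∎
    Λ-twist (suc n) (suc l) = begin
      Λ (suc n) l * (b₂ * b₂ ^ l) ≈⟨ solve 3 (λ a b P → a :* (b :* P) := b :* (a :* P)) refl _ _ _ ⟩
      b₂ * (Λ (suc n) l * b₂ ^ l) ≈⟨ *-congˡ (Λ-twist n l) ⟩
      b₂ * (h * u * b₂ ^ n * Λ n l) ≈⟨ solve 5 (λ b h u P a → b :* (h :* u :* P :* a) := h :* u :* (b :* P) :* a) refl _ _ _ _ _ ⟩
      h * u * (b₂ * b₂ ^ n) * Λ n l ∎

    Mm : ℕ → ℕ → C
    Mm n l = A (n ℕ.+ l) * u ^ l

    Mm-suc : ∀ n l → Mm n (suc l) ≈ u * Mm (suc n) l
    Mm-suc n l = begin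
      A (n ℕ.+ suc l) * (u * u ^ l) ≈⟨ *-congʳ (reflexive (≡.cong A (ℕₚ.+-suc n l))) ⟩
      A (suc (n ℕ.+ l)) * (u * u ^ l) ≈⟨ solve 3 (λ a u U → a :* (u :* U) := u :* (a :* U)) refl _ _ _ ⟩
      u * (A (suc (n ℕ.+ l)) * u ^ l) ∎

    against-shift : ∀ (φ : ℕ → C) → ev η (λ l → φ l * shift v l) ≈ h * ev η (λ l → φ (suc l) * v l)
    against-shift φ = trans (ev-unfold η _) (trans (+-congʳ (zeroʳ _)) (+-identityˡ _))

    split-v : ∀ (φ : ℕ → C) → ev η (λ l → φ l * v l) ≈ h * ev η (λ l → φ (suc l) * v l) + ev η (λ l → φ l * (b₂ ^ l * v l))
    split-v φ = begin
      ev η (λ l → φ l * v l) ≈⟨ ev-cong (λ l → trans (*-congˡ (J₂.recip-law l)) (distribˡ _ _ _)) ⟩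
      _ ≈⟨ ev-+ η _ _ ⟩
      ev η (λ l → φ l * shift v l) + ev η (λ l → φ l * (b₂ ^ l * v l)) ≈⟨ +-congʳ (against-shift φ) ⟩
      h * ev η (λ l → φ (suc l) * v l) + ev η (λ l → φ l * (b₂ ^ l * v l)) ∎

    I Jn : ℕ → C
    I n = ev η (λ l → Λ n l * v l)
    Jn n = ev η (λ l → Mm n l * v l)

    -- Row n is h^{2n²+n} times Euler's series for (-u^{1-2n}; u²)_∞, the power of h clearing all
    -- negative exponents. Splitting `v` by its recursion extracts the factor 1 + u^{2n+1} gained by
    -- the next row.
    I-step : ∀ n → I (suc n) ≈ h * (1# + u * b₂ ^ n) * I n
    I-step n = begin
      I (suc n) ≈⟨ split-v (Λ (suc n)) ⟩
      h * I n + ev η (λ l → Λ (suc n) l * (b₂ ^ l * v l))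
        ≈⟨ +-congˡ (trans (ev-cong (λ l → trans (sym (*-assoc _ _ _)) (trans (*-congʳ (Λ-twist n l)) (*-assoc _ _ _)))) (ev-*ˡ η _ _)) ⟩
      h * I n + h * u * b₂ ^ n * I n ≈⟨ solve 4 (λ h u P I → h :* I :+ h :* u :* P :* I := h :* (:1 :+ u :* P) :* I) refl _ _ _ _ ⟩
      h * (1# + u * b₂ ^ n) * I n ∎

    I₀ : I 0 ≈ L
    I₀ = begin
      I 0 ≈⟨ ev-cong (λ l → trans (*-congʳ (trans (Λ₀ l) (B-tri l))) (*-assoc _ _ _)) ⟩
      ev η (λ l → h ^ l * (J₂.tri l * v l)) ≈⟨ ev-h _ ⟩
      ev υ J₂.g ≈⟨ J₂.ev-g υ ⟩
      L ∎

    I-value : ∀ n → I n ≈ h ^ n * (poch υ β₂ n * L)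
    I-value zero = trans I₀ (solve 1 (λ L → L := :1 :* (:1 :* L)) refl L)
    I-value (suc n) = trans (I-step n) (trans (*-congˡ (I-value n))
      (solve 5 (λ h f H P L → h :* f :* (H :* (P :* L)) := h :* H :* (P :* f :* L)) refl _ _ _ _ _))

    positive-half : ev η I ≈ L * N
    positive-half = begin
      ev η I ≈⟨ trans (ev-cong I-value) (ev-h _) ⟩
      ev υ (λ n → poch υ β₂ n * L) ≈⟨ trans (ev-cong (λ n → *-comm _ _)) (ev-*ˡ υ L _) ⟩
      L * N ∎

    J-step : ∀ n → h * u * b₂ ^ n * Jn n ≈ (1# + u * b₂ ^ suc n) * Jn (suc n)
    J-step n = begin
      h * u * b₂ ^ n * Jn n ≈⟨ *-congˡ (trans (split-v (Mm n)) (+-congʳ (*-congˡ (trans (ev-cong (λ l → trans (*-congʳ (Mm-suc n l)) (*-assoc _ _ _))) (ev-*ˡ η u _))))) ⟩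
      h * u * b₂ ^ n * (h * (u * Jn (suc n)) + X) ≈⟨ solve 5 (λ h u P J X → h :* u :* P :* (h :* (u :* J) :+ X) := u :* ((h :* h :* u) :* P) :* J :+ h :* u :* P :* X) refl _ _ _ _ _ ⟩
      u * (h * h * u * b₂ ^ n) * Jn (suc n) + h * u * b₂ ^ n * X ≈⟨ +-cong (*-congʳ (*-congˡ (*-congʳ (trans (*-congʳ h²) h⁴)))) second ⟩
      u * b₂ ^ suc n * Jn (suc n) + Jn (suc n) ≈⟨ solve 2 (λ a J → a :* J :+ J := (:1 :+ a) :* J) refl _ _ ⟩
      (1# + u * b₂ ^ suc n) * Jn (suc n) ∎
      where
      X = ev η (λ l → Mm n l * (b₂ ^ l * v l))
      second : h * u * b₂ ^ n * X ≈ Jn (suc n)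
      second = trans (sym (ev-*ˡ η _ _)) (ev-cong (λ l → begin
        h * u * b₂ ^ n * (A (n ℕ.+ l) * u ^ l * (b₂ ^ l * v l))
          ≈⟨ solve 7 (λ h u P A U Q v → h :* u :* P :* (A :* U :* (Q :* v)) := h :* u :* (P :* Q) :* A :* U :* v) refl _ _ _ _ _ _ _ ⟩
        h * u * (b₂ ^ n * b₂ ^ l) * A (n ℕ.+ l) * u ^ l * v l ≈⟨ *-congʳ (*-congʳ (*-congʳ (*-congˡ (^-homo-* b₂ n l)))) ⟨
        h * u * b₂ ^ (n ℕ.+ l) * A (n ℕ.+ l) * u ^ l * v l ∎))

    J₀ : Jn 0 * (1# + u) ≈ L
    J₀ = sym (begin
      L ≈⟨ I₀ ⟨
      I 0 ≈⟨ trans (ev-cong (λ l → *-congʳ (Λ₀ l))) (split-v B) ⟩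
      h * ev η (λ l → h * b₂ ^ l * B l * v l) + ev η (λ l → B l * (b₂ ^ l * v l))
        ≈⟨ +-cong (*-congˡ (trans (ev-cong (λ l → trans (solve 4 (λ h P B v → h :* P :* B :* v := h :* (P :* B :* v)) refl _ _ _ _) (*-congˡ (*-congʳ (BA l))))) (ev-*ˡ η h _)))
                  (ev-cong (λ l → trans (solve 3 (λ B P v → B :* (P :* v) := P :* B :* v) refl _ _ _) (*-congʳ (BA l)))) ⟩
      h * (h * Jn 0) + Jn 0 ≈⟨ trans (solve 2 (λ h J → h :* (h :* J) :+ J := J :* (:1 :+ h :* h)) refl _ _) (*-congˡ (+-congˡ h²)) ⟩
      Jn 0 * (1# + u) ∎)

    J-value : ∀ n → Jn n * poch υ β₂ (suc n) ≈ A n * L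
    J-value zero = trans (*-congˡ (solve 1 (λ u → :1 :* (:1 :+ u :* :1) := :1 :+ u) refl u)) (trans J₀ (sym (*-identityˡ L)))
    J-value (suc n) = begin
      Jn (suc n) * (poch υ β₂ (suc n) * (1# + u * b₂ ^ suc n)) ≈⟨ solve 3 (λ J P f → J :* (P :* f) := f :* J :* P) refl _ _ _ ⟩
      (1# + u * b₂ ^ suc n) * Jn (suc n) * poch υ β₂ (suc n) ≈⟨ *-congʳ (J-step n) ⟨
      h * u * b₂ ^ n * Jn n * poch υ β₂ (suc n) ≈⟨ trans (*-assoc _ _ _) (*-congˡ (J-value n)) ⟩
      h * u * b₂ ^ n * (A n * L) ≈⟨ *-assoc _ _ _ ⟨
      A (suc n) * L ∎

    Z : ℕ → C
    Z l = ev η (λ n → Λ n l) + ev η (λ n → Mm n l)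

    Z-step : ∀ l → Z (suc l) ≈ h * Z l
    Z-step l = begin
      Z (suc l) ≈⟨ +-cong (ev-unfold η _) (trans (ev-cong (λ n → Mm-suc n l)) (ev-*ˡ η u _)) ⟩
      (B (suc l) + h * X) + u * Y ≈⟨ +-cong (+-congʳ first) (*-congʳ (sym h²)) ⟩
      (h * Mm 0 l + h * X) + h * h * Y ≈⟨ solve 4 (λ h m X Y → (h :* m :+ h :* X) :+ h :* h :* Y := h :* (X :+ (m :+ h :* Y))) refl _ _ _ _ ⟩
      h * (X + (Mm 0 l + h * Y)) ≈⟨ *-congˡ (+-congˡ (ev-unfold η _)) ⟨
      h * Z l ∎
      where
      X = ev η (λ n → Λ n l)
      Y = ev η (λ n → Mm (suc n) l)
      first : B (suc l) ≈ h * Mm 0 l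
      first = trans (*-assoc _ _ _) (*-congˡ (BA l))

    -- In a fixed column d = n - l runs through all integers, so l enters only as hˡ. The rest is
    -- Σ_{d∈ℤ} h^{2d²+2d} = Σ_{d∈ℤ} u^{d²+d}, twice Ψ because d and -1-d give equal terms.
    Z-value : ∀ l → Z l ≈ h ^ l * (Ψ + Ψ)
    Z-value zero = begin
      ev η A + ev η (λ n → A (n ℕ.+ 0) * 1#) ≈⟨ +-congˡ (ev-cong (λ n → trans (*-identityʳ _) (reflexive (≡.cong A (ℕₚ.+-identityʳ n))))) ⟩
      ev η A + ev η A ≈⟨ +-cong half half ⟩
      Ψ + Ψ ≈⟨ *-identityˡ _ ⟨
      1# * (Ψ + Ψ) ∎
      where
      half : ev η A ≈ Ψ
      half = trans (ev-cong A-sq) (ev-h sq)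
    Z-value (suc l) = trans (Z-step l) (trans (*-congˡ (Z-value l)) (sym (*-assoc _ _ _)))

  -- `rec n` is 1/(-u; u²)_{n+1}, so the second sum consists of the terms of negative index. Summing
  -- hⁿ h^{2d²+d} over rows gives the left side by Euler's expansion, and over columns the right
  -- side by `Z-value`.
  bilateral : ∀ (rec : ℕ → C) → (∀ n → rec n * poch υ β₂ (suc n) ≈ 1#) → L * (N + ev υ (λ n → sq n * rec n)) ≈ (Ψ + Ψ) * V
  bilateral rec inv = begin
    L * (N + ev υ (λ n → sq n * rec n)) ≈⟨ trans (distribˡ _ _ _) (+-cong (sym positive-half) (sym negative-half)) ⟩
    ev η I + ev η Jn ≈⟨ ev-+ η _ _ ⟨
    ev η (λ n → I n + Jn n) ≈⟨ ev-cong (λ n → sym (ev-+ η _ _)) ⟩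
    ev η (λ n → ev η (λ l → Λ n l * v l + Mm n l * v l)) ≈⟨ ev-swap η η _ ⟩
    ev η (λ l → ev η (λ n → Λ n l * v l + Mm n l * v l))
      ≈⟨ ev-cong (λ l → trans (ev-cong (λ n → solve 3 (λ a b v → a :* v :+ b :* v := v :* (a :+ b)) refl _ _ _)) (trans (ev-*ˡ η _ _) (*-congˡ (trans (ev-+ η _ _) (Z-value l))))) ⟩
    ev η (λ l → v l * (h ^ l * (Ψ + Ψ))) ≈⟨ ev-cong (λ l → solve 3 (λ v H P → v :* (H :* P) := H :* (P :* v)) refl _ _ _) ⟩
    ev η (λ l → h ^ l * ((Ψ + Ψ) * v l)) ≈⟨ trans (ev-h _) (ev-*ˡ υ _ _) ⟩
    (Ψ + Ψ) * V ∎
    where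
    negative-half : ev η Jn ≈ L * ev υ (λ n → sq n * rec n)
    negative-half = begin
      ev η Jn ≈⟨ ev-cong (λ n → begin
        Jn n ≈⟨ trans (sym (*-identityʳ _)) (*-congˡ (sym (inv n))) ⟩
        Jn n * (rec n * poch υ β₂ (suc n)) ≈⟨ solve 3 (λ J r P → J :* (r :* P) := J :* P :* r) refl _ _ _ ⟩
        Jn n * poch υ β₂ (suc n) * rec n ≈⟨ *-congʳ (J-value n) ⟩
        A n * L * rec n ≈⟨ *-congʳ (*-congʳ (A-sq n)) ⟩
        h ^ n * sq n * L * rec n ≈⟨ solve 4 (λ H s L r → H :* s :* L :* r := H :* (L :* (s :* r))) refl _ _ _ _ ⟩
        h ^ n * (L * (sq n * rec n)) ∎) ⟩
      ev η (λ n → h ^ n * (L * (sq n * rec n))) ≈⟨ trans (ev-h _) (ev-*ˡ υ L _) ⟩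
      L * ev υ (λ n → sq n * rec n) ∎

-- The identity for R(ζ).

module RankSeries (𝒞 : CompleteRing) (z z̄ : CompleteRing.C 𝒞)
  (z*z̄ : CompleteRing._≈_ 𝒞 (CompleteRing._*_ 𝒞 z z̄) (CompleteRing.1# 𝒞))
  (z̄² : CompleteRing._≈_ 𝒞 (CompleteRing._*_ 𝒞 z̄ z̄) (CompleteRing.-_ 𝒞 (CompleteRing._*_ 𝒞 z z))) where
  open Series 𝒞
  open Grouping 𝒞
  open Products 𝒞
  open Recurrence 𝒞
  open Combination 𝒞
  open Evaluation 𝒞
  open EighthRoot 𝒞 z z̄ z*z̄ z̄²
  open Bilateral 𝒞

  β₄ b₄ : C
  β₄ = q * β₂ * β₂
  b₄ = q * β₄

  module J₄ = Jacobi 𝒞 β₄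
  module P₄ = Partitions 𝒞 β₄

  private
    products : ∀ (a b c : C) n → a ^ n * (b ^ n * c) ≈ (a * b) ^ n * c
    products a b c n = trans (sym (*-assoc _ _ _)) (*-congʳ (sym (^-distrib-* a b n)))

    ^-*ˡ : ∀ a b n → a ^ n * b ^ n ≈ (a * b) ^ n
    ^-*ˡ a b n = sym (^-distrib-* a b n)

    rescale : ∀ c x y φ → c * x ≈ y → ev x (λ n → c ^ n * φ n) ≈ ev y φ
    rescale c x y φ h = trans (sym (ev-scale c x φ)) (ev-congˣ φ h)

  T₁ : C
  T₁ = u * ev β₂ sq

  private
    tri′ : ℕ → C
    tri′ = J.tri (q * p)

    b′ : C
    b′ = q * (q * p)

    tri′-odd : ∀ n → tri′ (suc (n ℕ.+ n)) ≈ (p * p) ^ n * sq n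
    tri′-odd zero = refl
    tri′-odd (suc n) = begin
      tri′ (suc (suc n ℕ.+ suc n)) ≡⟨ ≡.cong (λ k → tri′ (suc (suc k))) (ℕₚ.+-suc n n) ⟩
      b′ * (b′ * b′ ^ (n ℕ.+ n)) * (b′ * b′ ^ (n ℕ.+ n) * tri′ (suc (n ℕ.+ n))) ≈⟨ *-cong (*-congˡ (*-congˡ power)) (*-cong (*-congˡ power) (tri′-odd n)) ⟩
      b′ * (b′ * X) * (b′ * X * ((p * p) ^ n * sq n)) ≈⟨ solve 4 (λ b X P s → b :* (b :* X) :* (b :* X :* (P :* s)) := P :* (b :* b :* b :* (X :* X) :* s)) refl _ _ _ _ ⟩
      (p * p) ^ n * (b′ * b′ * b′ * (X * X) * sq n) ≈⟨ *-congˡ (*-congʳ (*-cong (solve 1 (λ q → let p = q :* q ; b = q :* (q :* p) in b :* b :* b := p :* p :* (q :* (q :* (p :* p :* p)))) refl q)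
            (trans (^-*ˡ _ _ n) (^-congˡ n (solve 1 (λ q → let p = q :* q ; b = q :* (q :* p) ; υ = q :* (p :* p :* p) in b :* b :* (b :* b) := q :* (q :* υ :* υ)) refl q))))) ⟩
      (p * p) ^ n * (p * p * u * b₂ ^ n * sq n) ≈⟨ solve 5 (λ P pp u b s → P :* (pp :* u :* b :* s) := pp :* P :* (u :* b :* s)) refl _ _ _ _ _ ⟩
      (p * p) ^ suc n * sq (suc n) ∎
      where
      X = (b′ * b′) ^ n
      power : b′ ^ (n ℕ.+ n) ≈ X
      power = trans (^-homo-* b′ n n) (^-*ˡ b′ b′ n)

    tri′-even : ∀ n → tri′ (suc (suc (n ℕ.+ n))) ≈ b′ * ((p * p * p * p * p * p) ^ n * sq n)
    tri′-even n = begin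
      b′ * b′ ^ (n ℕ.+ n) * tri′ (suc (n ℕ.+ n)) ≈⟨ *-cong (*-congˡ (trans (^-homo-* b′ n n) (^-*ˡ b′ b′ n))) (tri′-odd n) ⟩
      b′ * (b′ * b′) ^ n * ((p * p) ^ n * sq n) ≈⟨ trans (*-assoc _ _ _) (*-congˡ (products _ _ _ n)) ⟩
      b′ * ((b′ * b′ * (p * p)) ^ n * sq n) ≈⟨ *-congˡ (*-congʳ (^-congˡ n (solve 1 (λ q → let p = q :* q ; b = q :* (q :* p) in b :* b :* (p :* p) := p :* p :* p :* p :* p :* p) refl q))) ⟩
      b′ * ((p * p * p * p * p * p) ^ n * sq n) ∎

  -- Even and odd k: p^{(2j)²} = u^{j²} and p^{(2j+1)²} = p u^{j²+j}.
  θ₃-split : θ₃p ≈ 1# + (T₁ + T₁) + p * (Ψ + Ψ)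
  θ₃-split = begin
    1# + (p * E + p * E) ≈⟨ +-congˡ (+-cong half half) ⟩
    1# + ((p * Ψ + T₁) + (p * Ψ + T₁)) ≈⟨ solve 3 (λ p a t → :1 :+ ((p :* a :+ t) :+ (p :* a :+ t)) := :1 :+ (t :+ t) :+ p :* (a :+ a)) refl _ _ _ ⟩
    1# + (T₁ + T₁) + p * (Ψ + Ψ) ∎
    where
    E = ev q (tail tri′)
    half : p * E ≈ p * Ψ + T₁
    half = begin
      p * E ≈⟨ *-congˡ (ev-even-odd q (tail tri′)) ⟩
      p * (ev (q * q * q) (λ n → tri′ (suc (n ℕ.+ n))) + q * q * ev (q * q * q) (λ n → tri′ (suc (suc (n ℕ.+ n)))))
        ≈⟨ *-congˡ (+-cong (trans (ev-cong tri′-odd) (rescale _ _ υ sq (solve 1 (λ q → let p = q :* q in p :* p :* (q :* q :* q) := q :* (p :* p :* p)) refl q)))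
             (*-congˡ (trans (ev-cong tri′-even) (trans (ev-*ˡ _ b′ _) (*-congˡ (rescale _ _ β₂ sq
                (solve 1 (λ q → let p = q :* q ; υ = q :* (p :* p :* p) in p :* p :* p :* p :* p :* p :* (q :* q :* q) := q :* υ :* υ) refl q))))))) ⟩
      p * (Ψ + q * q * (b′ * ev β₂ sq)) ≈⟨ solve 3 (λ q a e → let p = q :* q in p :* (a :+ q :* q :* (q :* (q :* p) :* e)) := p :* a :+ q :* (q :* (p :* p :* p)) :* e) refl q _ _ ⟩
      p * Ψ + T₁ ∎

  private
    quad : ℕ → ℕ
    quad zero = 0
    quad (suc n) = 4 ℕ.+ quad n

    ev-quad : ∀ x φ → let x₄ = x * (q * x) * (q * x) * (q * x) ; X = q * x in
      ev x φ ≈ ev x₄ (λ n → φ (quad n)) + X * ev x₄ (λ n → φ (1 ℕ.+ quad n))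
        + X * X * ev x₄ (λ n → φ (2 ℕ.+ quad n)) + X * X * X * ev x₄ (λ n → φ (3 ℕ.+ quad n))
    ev-quad x φ = coinduction {ℕ → C} (ev x)
      (λ φ → ev x₄ (λ n → φ (quad n)) + X * ev x₄ (λ n → φ (1 ℕ.+ quad n))
        + X * X * ev x₄ (λ n → φ (2 ℕ.+ quad n)) + X * X * X * ev x₄ (λ n → φ (3 ℕ.+ quad n)))
      (λ φ → φ 0 + X * φ 1 + X * X * φ 2 + X * X * X * φ 3) (λ _ → x₄) (λ φ n → φ (4 ℕ.+ n))
      (λ φ → begin
        ev x φ ≈⟨ trans (ev-unfold x φ) (+-congˡ (*-congˡ (trans (ev-unfold x _) (+-congˡ (*-congˡ (trans (ev-unfold x _) (+-congˡ (*-congˡ (ev-unfold x _))))))))) ⟩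
        φ 0 + X * (φ 1 + X * (φ 2 + X * (φ 3 + X * ev x (λ n → φ (4 ℕ.+ n)))))
          ≈⟨ solve 7 (λ a b c d q x e → let X = q :* x in a :+ X :* (b :+ X :* (c :+ X :* (d :+ X :* e)))
               := a :+ X :* b :+ X :* X :* c :+ X :* X :* X :* d :+ q :* (x :* X :* X :* X :* e)) refl _ _ _ _ q x _ ⟩
        _ ∎)
      (λ φ → begin
        _ ≈⟨ +-cong (+-cong (+-cong (ev-unfold x₄ _) (*-congˡ (ev-unfold x₄ _))) (*-congˡ (ev-unfold x₄ _))) (*-congˡ (ev-unfold x₄ _)) ⟩
        _ ≈⟨ solve 11 (λ a b c d q X x₄ e f g h → (a :+ q :* x₄ :* e) :+ X :* (b :+ q :* x₄ :* f) :+ X :* X :* (c :+ q :* x₄ :* g) :+ X :* X :* X :* (d :+ q :* x₄ :* h)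
               := a :+ X :* b :+ X :* X :* c :+ X :* X :* X :* d :+ q :* (x₄ :* (e :+ X :* f :+ X :* X :* g :+ X :* X :* X :* h))) refl _ _ _ _ _ _ _ _ _ _ _ ⟩
        _ ∎)
      φ
      where
      X = q * x
      x₄ = x * (q * x) * (q * x) * (q * x)

    tri : ℕ → C
    tri = J.tri q

    p^quad : ∀ n → p ^ quad n ≈ u ^ n
    p^quad zero = refl
    p^quad (suc n) = begin
      p * (p * (p * (p * p ^ quad n))) ≈⟨ solve 2 (λ q P → let p = q :* q in p :* (p :* (p :* (p :* P))) := q :* (q :* (p :* p :* p)) :* P) refl q _ ⟩
      u * p ^ quad n ≈⟨ *-congˡ (p^quad n) ⟩
      u * u ^ n ∎

    u⁴ : ∀ n → u ^ n * u ^ n * (u ^ n * u ^ n) ≈ b₄ ^ n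
    u⁴ n = trans (*-cong (^-*ˡ u u n) (^-*ˡ u u n)) (trans (^-*ˡ (u * u) (u * u) n)
      (^-congˡ n (solve 2 (λ q υ → let u = q :* υ ; β = u :* υ in u :* u :* (u :* u) := q :* (q :* β :* β)) refl q υ)))

    tri-quad : ∀ n → tri (quad n) ≈ (u * p * p) ^ n * J₄.tri n
    tri-quad zero = sym (*-identityˡ _)
    tri-quad (suc n) = begin
      p * (p * (p * P)) * (p * (p * P) * (p * P * (P * tri (quad n))))
        ≈⟨ solve 3 (λ q P t → let p = q :* q in p :* (p :* (p :* P)) :* (p :* (p :* P) :* (p :* P :* (P :* t))) := q :* (q :* (p :* p :* p)) :* p :* p :* (P :* P :* (P :* P) :* t)) refl q P _ ⟩
      u * p * p * (P * P * (P * P) * tri (quad n)) ≈⟨ *-congˡ (*-cong (trans (*-cong (*-cong (p^quad n) (p^quad n)) (*-cong (p^quad n) (p^quad n))) (u⁴ n)) (tri-quad n)) ⟩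
      u * p * p * (b₄ ^ n * ((u * p * p) ^ n * J₄.tri n)) ≈⟨ solve 4 (λ c B D t → c :* (B :* (D :* t)) := c :* D :* (B :* t)) refl _ _ _ _ ⟩
      (u * p * p) ^ suc n * J₄.tri (suc n) ∎
      where P = p ^ quad n

    tri-quad₁ : ∀ n → tri (1 ℕ.+ quad n) ≈ (u * u * p * p) ^ n * J₄.tri n
    tri-quad₁ n = begin
      p ^ quad n * tri (quad n) ≈⟨ *-cong (p^quad n) (tri-quad n) ⟩
      u ^ n * ((u * p * p) ^ n * J₄.tri n) ≈⟨ products _ _ _ n ⟩
      (u * (u * p * p)) ^ n * J₄.tri n ≈⟨ *-congʳ (^-congˡ n (solve 2 (λ u p → u :* (u :* p :* p) := u :* u :* p :* p) refl u p)) ⟩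
      (u * u * p * p) ^ n * J₄.tri n ∎

    tri-quad₃ : ∀ n → tri (3 ℕ.+ quad n) ≈ p * p * p * ((p * p) ^ n * J₄.tri (suc n))
    tri-quad₃ n = begin
      p * (p * P) * (p * P * (P * tri (quad n))) ≈⟨ solve 3 (λ p P t → p :* (p :* P) :* (p :* P :* (P :* t)) := p :* p :* p :* (P :* P :* P :* t)) refl p P _ ⟩
      p * p * p * (P * P * P * tri (quad n)) ≈⟨ *-congˡ (*-cong (*-cong (*-cong (p^quad n) (p^quad n)) (p^quad n)) (tri-quad n)) ⟩
      p * p * p * (U * U * U * ((u * p * p) ^ n * J₄.tri n))
        ≈⟨ *-congˡ (*-congˡ (*-congʳ (trans (^-congˡ n (*-assoc _ _ _)) (^-distrib-* u (p * p) n)))) ⟩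
      p * p * p * (U * U * U * (U * (p * p) ^ n * J₄.tri n)) ≈⟨ *-congˡ (solve 3 (λ U P t → U :* U :* U :* (U :* P :* t) := P :* (U :* U :* (U :* U) :* t)) refl _ _ _) ⟩
      p * p * p * ((p * p) ^ n * (U * U * (U * U) * J₄.tri n)) ≈⟨ *-congˡ (*-congˡ (*-congʳ (u⁴ n))) ⟩
      p * p * p * ((p * p) ^ n * J₄.tri (suc n)) ∎
      where
      P = p ^ quad n
      U = u ^ n

  -- Σ (-1)ʲ u^{2j²} and Σ (-1)ʲ u^{2j²-j}, summed over j ∈ ℤ.
  θ₄ ψ₋ : C
  θ₄ = sym-ev (- β₂) (- β₂) J₄.tri
  ψ₋ = sym-ev (- υ) (- (u * u * υ)) J₄.tri

  private
    X Y : C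
    X = q * z
    Y = q * z̄

    fourth : ∀ c → c * c * (c * c) ≈ - 1# → c * (q * c) * (q * c) * (q * c) ≈ - (q * p)
    fourth c h = trans (solve 2 (λ q c → c :* (q :* c) :* (q :* c) :* (q :* c) := q :* (q :* q) :* (c :* c :* (c :* c))) refl q c)
      (trans (*-congˡ h) (solve 1 (λ a → a :* :- :1 := :- a) refl (q * p)))

    z̄⁴ : z̄ * z̄ * (z̄ * z̄) ≈ - 1#
    z̄⁴ = trans (*-cong z̄² z̄²) (trans (solve 1 (λ i → (:- i) :* (:- i) := i :* i) refl i) i²)

    X²+Y² : X * X + Y * Y ≈ 0#
    X²+Y² = trans (solve 3 (λ q z w → q :* z :* (q :* z) :+ q :* w :* (q :* w) := q :* q :* (z :* z :+ w :* w)) refl q z z̄)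
      (trans (*-congˡ (trans (+-congˡ z̄²) (-‿inverseʳ _))) (zeroʳ _))

    XY : X * Y ≈ p
    XY = trans (solve 3 (λ q z w → q :* z :* (q :* w) := q :* q :* (z :* w)) refl q z z̄) (trans (*-congˡ z*z̄) (*-identityʳ _))

    W : ℕ → C
    W k = ev (- (q * p)) (λ n → tri (k ℕ.+ quad n))

    ev-z : ∀ c → c * c * (c * c) ≈ - 1# → ev c tri ≈ W 0 + q * c * W 1 + q * c * (q * c) * W 2 + q * c * (q * c) * (q * c) * W 3
    ev-z c h = trans (ev-quad c tri) (+-cong (+-cong (+-cong (ev-congˣ _ (fourth c h)) (*-congˡ (ev-congˣ _ (fourth c h)))) (*-congˡ (ev-congˣ _ (fourth c h)))) (*-congˡ (ev-congˣ _ (fourth c h))))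

    W₀ : W 0 ≈ ev (- β₂) J₄.tri
    W₀ = trans (ev-cong tri-quad) (rescale _ _ _ _ (solve 1 (λ q → let p = q :* q ; υ = q :* (p :* p :* p) ; u = q :* υ in u :* p :* p :* (:- (q :* p)) := :- (u :* υ)) refl q))

    W₁ : W 1 ≈ ev (- (u * u * υ)) J₄.tri
    W₁ = trans (ev-cong tri-quad₁) (rescale _ _ _ _ (solve 1 (λ q → let p = q :* q ; υ = q :* (p :* p :* p) ; u = q :* υ in u :* u :* p :* p :* (:- (q :* p)) := :- (u :* u :* υ)) refl q))

    W₃ : p * W 3 ≈ u * ev (- υ) (tail J₄.tri)
    W₃ = trans (*-congˡ (trans (ev-cong tri-quad₃) (trans (ev-*ˡ _ _ _) (*-congˡ (rescale _ _ (- υ) _ (solve 1 (λ q → let p = q :* q in p :* p :* (:- (q :* p)) := :- (q :* (p :* p :* p))) refl q))))))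
      (solve 2 (λ q e → let p = q :* q in p :* (p :* p :* p :* e) := q :* (q :* (p :* p :* p)) :* e) refl q _)

  -- Splitting k modulo 4: class 0 carries ζ^{4j} = (-1)ʲ, class 2 cancels because ζ² + ζ⁻² = 0, and
  -- the odd classes combine to a multiple of ζ + ζ⁻¹ because X³ + Y³ = (X + Y)(X² + Y² - X Y) with
  -- X² + Y² = 0.
  ϑ-split : ϑ ≈ θ₄ + (q * z + q * z̄) * ψ₋
  ϑ-split = begin
    1# + (X * ev z (tail tri) + Y * ev z̄ (tail tri)) ≈⟨ solve 2 (λ a b → :1 :+ (a :+ b) := (:1 :+ a) :+ (:1 :+ b) :- :1) refl _ _ ⟩
    (1# + X * ev z (tail tri)) + (1# + Y * ev z̄ (tail tri)) - 1# ≈⟨ +-congʳ (+-cong (ev-unfold z tri) (ev-unfold z̄ tri)) ⟨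
    ev z tri + ev z̄ tri - 1# ≈⟨ +-congʳ (+-cong (ev-z z i²) (ev-z z̄ z̄⁴)) ⟩
    (W 0 + X * W 1 + X * X * W 2 + X * X * X * W 3) + (W 0 + Y * W 1 + Y * Y * W 2 + Y * Y * Y * W 3) - 1#
      ≈⟨ solve 6 (λ X Y a b c d → (a :+ X :* b :+ X :* X :* c :+ X :* X :* X :* d) :+ (a :+ Y :* b :+ Y :* Y :* c :+ Y :* Y :* Y :* d) :- :1
           := (a :+ a :- :1) :+ (X :+ Y) :* (b :- X :* Y :* d) :+ (X :* X :+ Y :* Y) :* (c :+ (X :+ Y) :* d)) refl _ _ _ _ _ _ ⟩
    (W 0 + W 0 - 1#) + (X + Y) * (W 1 - X * Y * W 3) + (X * X + Y * Y) * (W 2 + (X + Y) * W 3)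
      ≈⟨ trans (+-cong (+-congˡ (*-congˡ (+-congˡ (-‿cong (*-congʳ XY))))) (trans (*-congʳ X²+Y²) (zeroˡ _))) (+-identityʳ _) ⟩
    (W 0 + W 0 - 1#) + (X + Y) * (W 1 - p * W 3) ≈⟨ +-cong θ-part (*-congˡ ψ-part) ⟩
    θ₄ + (X + Y) * ψ₋ ∎
    where
    θ-part : W 0 + W 0 - 1# ≈ θ₄
    θ-part = trans (+-congʳ (trans (+-cong W₀ W₀) (+-cong (ev-unfold _ _) (ev-unfold _ _))))
      (solve 1 (λ a → (:1 :+ a) :+ (:1 :+ a) :- :1 := :1 :+ (a :+ a)) refl _)
    ψ-part : W 1 - p * W 3 ≈ ψ₋
    ψ-part = trans (+-cong (trans W₁ (ev-unfold _ _)) (-‿cong W₃))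
      (solve 4 (λ b q υ e → (:1 :+ b) :- q :* υ :* e := :1 :+ (q :* (:- υ) :* e :+ b)) refl _ q υ _)

  H : C
  H = ev β₂ J₄.recip

  private
    -- (u; u²)_∞ and (u²; u⁴)_∞. Together with (u⁴; u⁴)_∞ they factor (u; u)_∞, and every quotient
    -- of products below is reduced to these factors.
    O₁ O₂ : C
    O₁ = poch∞ (- υ) β₂
    O₂ = poch∞ (- β₂) β₄

    O₁L : O₁ * L ≈ O₂
    O₁L = poch∞-mul (- υ) β₂ υ β₂ (- β₂) β₄ (λ n → begin
      (1# + q * - υ * b₂ ^ n) * (1# + q * υ * b₂ ^ n)
        ≈⟨ solve 3 (λ q υ B → (:1 :+ q :* (:- υ) :* B) :* (:1 :+ q :* υ :* B) := :1 :+ q :* (:- (q :* υ :* υ)) :* (B :* B)) refl _ _ _ ⟩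
      1# + q * - β₂ * (b₂ ^ n * b₂ ^ n) ≈⟨ +-congˡ (*-congˡ (trans (^-*ˡ b₂ b₂ n) (^-congˡ n (solve 2 (λ q β → q :* β :* (q :* β) := q :* (q :* β :* β)) refl q β₂)))) ⟩
      1# + q * - β₂ * b₄ ^ n ∎)

    euler-u : Pu.euler ≈ O₁ * (O₂ * P₄.euler)
    euler-u = begin
      poch∞ (- υ) υ ≈⟨ poch∞-split (- υ) υ ⟩
      O₁ * poch∞ (- υ * (q * υ)) β₂ ≈⟨ *-congˡ (poch∞-cong (solve 2 (λ q υ → :- υ :* (q :* υ) := :- (q :* υ :* υ)) refl q υ) refl) ⟩
      O₁ * poch∞ (- β₂) β₂ ≈⟨ *-congˡ (poch∞-split (- β₂) β₂) ⟩
      O₁ * (O₂ * poch∞ (- β₂ * (q * β₂)) β₄) ≈⟨ *-congˡ (*-congˡ (poch∞-cong (solve 2 (λ q β → :- β :* (q :* β) := :- (q :* β :* β)) refl q β₂) refl)) ⟩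
      O₁ * (O₂ * P₄.euler) ∎

    strip : ∀ {x y} → P₄.euler * (P₄.parts * x) ≈ y → x ≈ y
    strip {x} e = trans (sym (trans (sym (*-assoc _ _ _)) (trans (*-congʳ P₄.euler*parts) (*-identityˡ x)))) e

    θ₄-product : θ₄ ≈ P₄.euler * (O₂ * O₂)
    θ₄-product = strip (*-congˡ (sym (J₄.jacobi (- β₂) (- β₂) (solve 2 (λ q β → q :* (:- β) :* (:- β) := q :* β :* β) refl q β₂))))

    ψ₋-product : ψ₋ ≈ P₄.euler * O₁
    ψ₋-product = strip (*-congˡ (trans (sym (J₄.jacobi (- υ) (- (u * u * υ)) (solve 2 (λ q υ → let u = q :* υ ; β = u :* υ in q :* (:- υ) :* (:- (u :* u :* υ)) := q :* β :* β) refl q υ)))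
      (sym (trans (poch∞-split (- υ) β₂) (*-congˡ (poch∞-cong (solve 2 (λ q υ → let u = q :* υ in :- υ :* (q :* (u :* υ)) := :- (u :* u :* υ)) refl q υ) refl))))))

    O₂H : O₂ * H ≈ 1#
    O₂H = J₄.ev-recip β₂

    unparts : ∀ {x y} → Pu.euler * x ≈ y → Pu.parts * y ≈ x
    unparts {x} {y} e = begin
      Pu.parts * y ≈⟨ *-congˡ e ⟨
      Pu.parts * (Pu.euler * x) ≈⟨ solve 3 (λ P E x → P :* (E :* x) := E :* P :* x) refl _ _ _ ⟩
      Pu.euler * Pu.parts * x ≈⟨ trans (*-congʳ Pu.euler*parts) (*-identityˡ x) ⟩
      x ∎

  θ₄-value : Pu.parts * θ₄ ≈ L
  θ₄-value = unparts (begin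
    Pu.euler * L ≈⟨ *-congʳ euler-u ⟩
    O₁ * (O₂ * P₄.euler) * L ≈⟨ solve 4 (λ a b e l → a :* (b :* e) :* l := e :* (b :* (a :* l))) refl _ _ _ _ ⟩
    P₄.euler * (O₂ * (O₁ * L)) ≈⟨ *-congˡ (*-congˡ O₁L) ⟩
    P₄.euler * (O₂ * O₂) ≈⟨ θ₄-product ⟨
    θ₄ ∎)

  ψ₋-value : Pu.parts * ψ₋ ≈ H
  ψ₋-value = unparts (begin
    Pu.euler * H ≈⟨ *-congʳ euler-u ⟩
    O₁ * (O₂ * P₄.euler) * H ≈⟨ solve 4 (λ a b e l → a :* (b :* e) :* l := e :* a :* (b :* l)) refl _ _ _ _ ⟩
    P₄.euler * O₁ * (O₂ * H) ≈⟨ trans (*-congˡ O₂H) (*-identityʳ _) ⟩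
    P₄.euler * O₁ ≈⟨ ψ₋-product ⟨
    ψ₋ ∎)

  private
    L*H : L * H ≈ V
    L*H = unit-cancel {a = O₁} (poch-inverse _ _) (begin
      O₁ * (L * H) ≈⟨ *-assoc _ _ _ ⟨
      O₁ * L * H ≈⟨ trans (*-congʳ O₁L) O₂H ⟩
      1# ≈⟨ J₂.ev-recip υ ⟨
      O₁ * V ∎)

    -- As X + Y = 0, (1 - X U)(1 - Y U) = 1 + X Y U². Two conjugate rows in base u thus merge into
    -- one real product in base u².
    geom-pair : ∀ x y w k → q * x + q * y ≈ 0# → q * x * (q * y) ≈ q * w → geom (x * u ^ k) * geom (y * u ^ k) * (1# + q * w * b₂ ^ k) ≈ 1#
    geom-pair x y w k sum≈ prod≈ = begin
      g₁ * g₂ * (1# + q * w * b₂ ^ k) ≈⟨ *-congˡ (+-cong refl (*-cong (sym prod≈) (sym (trans (^-*ˡ u u k) (^-congˡ k (solve 2 (λ q υ → q :* υ :* (q :* υ) := q :* (q :* υ :* υ)) refl q υ)))))) ⟩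
      g₁ * g₂ * (1# + q * x * (q * y) * (U * U)) ≈⟨ solve 6 (λ g h q x y U → g :* h :* (:1 :+ q :* x :* (q :* y) :* (U :* U))
          := ((:1 :- q :* (x :* U)) :* g) :* ((:1 :- q :* (y :* U)) :* h) :+ (q :* x :+ q :* y) :* (U :* g :* h)) refl _ _ _ _ _ _ ⟩
      ((1# - q * (x * U)) * g₁) * ((1# - q * (y * U)) * g₂) + (q * x + q * y) * (U * g₁ * g₂)
        ≈⟨ +-cong (trans (*-cong (geom-inverse _) (geom-inverse _)) (*-identityˡ _)) (trans (*-congʳ sum≈) (zeroˡ _)) ⟩
      1# + 0# ≈⟨ +-identityʳ _ ⟩
      1# ∎
      where
      U = u ^ k
      g₁ = geom (x * U)
      g₂ = geom (y * U)

    row-pair : ∀ x y w → q * x + q * y ≈ 0# → q * x * (q * y) ≈ q * w → ∀ D → Pu.row x D * Pu.row y D * poch w β₂ (suc D) ≈ 1#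
    row-pair x y w s≈ p≈ zero = trans (*-cong (*-cong (geom-cong (sym (*-identityʳ x))) (geom-cong (sym (*-identityʳ y)))) (*-identityˡ _)) (geom-pair x y w 0 s≈ p≈)
    row-pair x y w s≈ p≈ (suc D) = begin
      Pu.row x D * g₁ * (Pu.row y D * g₂) * (poch w β₂ (suc D) * F)
        ≈⟨ solve 6 (λ r g s h P F → r :* g :* (s :* h) :* (P :* F) := r :* s :* P :* (g :* h :* F)) refl _ _ _ _ _ _ ⟩
      Pu.row x D * Pu.row y D * poch w β₂ (suc D) * (g₁ * g₂ * F) ≈⟨ *-cong (row-pair x y w s≈ p≈ D) (geom-pair x y w (suc D) s≈ p≈) ⟩
      1# * 1# ≈⟨ *-identityˡ _ ⟩ 1# ∎
      where
      g₁ = geom (x * u ^ suc D)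
      g₂ = geom (y * u ^ suc D)
      F = 1# + q * w * b₂ ^ suc D

    sq-power : ∀ D → u ^ (D ℕ.* D) ≈ sq D
    sq-power zero = refl
    sq-power (suc D) = begin
      u * u ^ (D ℕ.+ D ℕ.* suc D) ≡⟨ ≡.cong (λ k → u * u ^ (D ℕ.+ k)) (ℕₚ.*-suc D D) ⟩
      u * u ^ (D ℕ.+ (D ℕ.+ D ℕ.* D)) ≈⟨ *-congˡ (trans (^-homo-* u D _) (*-congˡ (^-homo-* u D _))) ⟩
      u * (u ^ D * (u ^ D * u ^ (D ℕ.* D))) ≈⟨ *-congˡ (*-congˡ (*-congˡ (sq-power D))) ⟩
      u * (u ^ D * (u ^ D * sq D)) ≈⟨ *-congˡ (products u u _ D) ⟩
      u * ((u * u) ^ D * sq D) ≈⟨ trans (sym (*-assoc _ _ _)) (*-congʳ (*-congˡ (^-congˡ D (solve 2 (λ q υ → q :* υ :* (q :* υ) := q :* (q :* υ :* υ)) refl q υ)))) ⟩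
      u * b₂ ^ D * sq D ∎

    opposite : ∀ c → q * (c * (q * z * z)) + q * (c * (q * z̄ * z̄)) ≈ 0#
    opposite c = trans (solve 4 (λ q c z w → q :* (c :* (q :* z :* z)) :+ q :* (c :* (q :* w :* w)) := q :* c :* q :* (z :* z :+ w :* w)) refl q c z z̄)
      (trans (*-congˡ (trans (+-congˡ z̄²) (-‿inverseʳ _))) (zeroʳ _))

    zz̄zz̄ : z * z̄ * (z * z̄) ≈ 1#
    zz̄zz̄ = trans (*-cong z*z̄ z*z̄) (*-identityˡ _)

    base : ∀ c → q * (c * (q * z * z)) * (c * (q * z̄ * z̄)) ≈ q * c * q * (c * q)
    base c = trans (solve 4 (λ q c z w → q :* (c :* (q :* z :* z)) :* (c :* (q :* w :* w)) := q :* c :* q :* (c :* q) :* (z :* w :* (z :* w))) refl q c z z̄)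
      (trans (*-congˡ zz̄zz̄) (*-identityʳ _))

  -- The third order mock theta functions Σ u^{n²+n} / (-u; u²)_{n+1} and Σ u^{n²} / (-u²; u²)_n.
  ν φ₃ : C
  ν = Pu.symbols (x¹ z) (x¹ z̄)
  φ₃ = 1# + u * Pu.symbols (x³ z) (x³ z̄)

  -- The terms of ν are those of negative index in the bilateral sum. Since V = L H, the factor `L`
  -- cancels.
  ν-value : N + ν ≈ (Ψ + Ψ) * H
  ν-value = unit-cancel {a = L} (poch-inverse _ _) (begin
    L * (N + ν) ≈⟨ *-congˡ (+-congˡ shape) ⟩
    L * (N + ev υ (λ D → sq D * (Pu.row (x¹ z) D * Pu.row (x¹ z̄) D))) ≈⟨ bilateral _ (row-pair _ _ υ (opposite (- p))
        (trans (solve 3 (λ q x y → q :* x :* (q :* y) := q :* (q :* x :* y)) refl q _ _) (*-congˡ weight))) ⟩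
    (Ψ + Ψ) * V ≈⟨ *-congˡ L*H ⟨
    (Ψ + Ψ) * (L * H) ≈⟨ solve 3 (λ a b c → a :* (b :* c) := b :* (a :* c)) refl _ _ _ ⟩
    L * ((Ψ + Ψ) * H) ∎)
    where
    weight : q * x¹ z * x¹ z̄ ≈ υ
    weight = trans (base (- p)) (solve 1 (λ q → let p = q :* q in q :* (:- p) :* q :* (:- p :* q) := q :* (p :* p :* p)) refl q)
    shape : ν ≈ ev υ (λ D → sq D * (Pu.row (x¹ z) D * Pu.row (x¹ z̄) D))
    shape = trans (ev-congˣ _ weight) (ev-cong (λ D → *-congʳ (sq-power D)))

  -- 1/(u² ; u²)_n = al n + be n and 1/(-u² ; u²)_n = al n - be n: al and be collect an even and an odd number of parts.
  al be : ℕ → C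
  γ : ℕ → C
  γ n = geom (q * (β₂ * b₂ ^ n) * (β₂ * b₂ ^ n))
  al zero = 1#
  al (suc n) = γ n * (al n + be n * b₂ ^ suc n)
  be zero = 0#
  be (suc n) = γ n * (al n * b₂ ^ suc n + be n)

  Bε : C
  Bε = ev β₂ (λ D → sq D * be (suc D))

  private
    γ-inverse : ∀ n → (1# - b₂ ^ suc n) * (1# + b₂ ^ suc n) * γ n ≈ 1#
    γ-inverse n = trans (*-congʳ (solve 3 (λ q β B → (:1 :- q :* β :* B) :* (:1 :+ q :* β :* B) := :1 :- q :* (q :* (β :* B) :* (β :* B))) refl q β₂ (b₂ ^ n))) (geom-inverse _)

    recip-al : ∀ n → J₂.recip n ≈ al n + be n
    recip-al zero = sym (+-identityʳ _)
    recip-al (suc n) = sym (begin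
      γ n * (al n + be n * t) + γ n * (al n * t + be n) ≈⟨ solve 4 (λ g a b t → g :* (a :+ b :* t) :+ g :* (a :* t :+ b) := (:1 :+ t) :* g :* (a :+ b)) refl _ _ _ _ ⟩
      (1# + t) * γ n * (al n + be n) ≈⟨ *-congˡ (recip-al n) ⟨
      (1# + t) * γ n * J₂.recip n ≈⟨ *-congˡ (J₂.recip-inverse n) ⟨
      (1# + t) * γ n * ((1# - t) * J₂.recip (suc n)) ≈⟨ solve 3 (λ t g r → (:1 :+ t) :* g :* ((:1 :- t) :* r) := (:1 :- t) :* (:1 :+ t) :* g :* r) refl _ _ _ ⟩
      (1# - t) * (1# + t) * γ n * J₂.recip (suc n) ≈⟨ trans (*-congʳ (γ-inverse n)) (*-identityˡ _) ⟩
      J₂.recip (suc n) ∎)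
      where t = b₂ ^ suc n

    al-be-inverse : ∀ n → (al n - be n) * poch β₂ β₂ n ≈ 1#
    al-be-inverse zero = solve 0 ((:1 :- :0) :* :1 := :1) refl
    al-be-inverse (suc n) = begin
      (γ n * (al n + be n * t) - γ n * (al n * t + be n)) * (P * (1# + t))
        ≈⟨ solve 5 (λ g a b t P → (g :* (a :+ b :* t) :- g :* (a :* t :+ b)) :* (P :* (:1 :+ t)) := (:1 :- t) :* (:1 :+ t) :* g :* ((a :- b) :* P)) refl _ _ _ _ _ ⟩
      (1# - t) * (1# + t) * γ n * ((al n - be n) * P) ≈⟨ *-cong (γ-inverse n) (al-be-inverse n) ⟩
      1# * 1# ≈⟨ *-identityˡ _ ⟩ 1# ∎
      where
      t = b₂ ^ suc n
      P = poch β₂ β₂ n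

    inverse-unique : ∀ {a b c} → a * c ≈ 1# → b * c ≈ 1# → a ≈ b
    inverse-unique {a} {b} {c} ac bc = begin
      a ≈⟨ *-identityʳ a ⟨ a * 1# ≈⟨ *-congˡ bc ⟨ a * (b * c) ≈⟨ solve 3 (λ a b c → a :* (b :* c) := b :* (a :* c)) refl a b c ⟩
      b * (a * c) ≈⟨ *-congˡ ac ⟩ b * 1# ≈⟨ *-identityʳ b ⟩ b ∎

  -- Euler gives L = Σ u^{n²} / (u²; u²)_n, which differs from φ only in the sign under the
  -- denominators. Passing from `al - be` to `al + be` costs twice `be`, which is nonnegative.
  φ₃-value : φ₃ + u * (Bε + Bε) ≈ L
  φ₃-value = sym (begin
    L ≈⟨ J₂.ev-g υ ⟨
    ev υ J₂.g ≈⟨ ev-unfold υ _ ⟩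
    1# * 1# + u * ev υ (λ D → b₂ ^ D * J₂.tri D * J₂.recip (suc D))
      ≈⟨ +-cong (*-identityˡ _) (*-congˡ (trans (ev-cong (λ D → trans (*-congʳ (tri-sq D)) (*-assoc _ _ _))) (rescale u υ β₂ _ refl))) ⟩
    1# + u * ev β₂ (λ D → sq D * J₂.recip (suc D))
      ≈⟨ +-congˡ (*-congˡ (trans (ev-cong (λ D → trans (*-congˡ (trans (recip-al (suc D)) (solve 2 (λ a b → a :+ b := (a :- b) :+ (b :+ b)) refl _ _)))
            (solve 3 (λ s d b → s :* (d :+ (b :+ b)) := s :* d :+ (s :* b :+ s :* b)) refl _ _ _))) (trans (ev-+ β₂ _ _) (+-congˡ (ev-+ β₂ _ _))))) ⟩
    1# + u * (ev β₂ (λ D → sq D * (al (suc D) - be (suc D))) + (Bε + Bε)) ≈⟨ +-congˡ (*-congˡ (+-congʳ (sym shape))) ⟩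
    1# + u * (S + (Bε + Bε)) ≈⟨ solve 3 (λ u s b → :1 :+ u :* (s :+ b) := (:1 :+ u :* s) :+ u :* b) refl _ _ _ ⟩
    φ₃ + u * (Bε + Bε) ∎)
    where
    S = Pu.symbols (x³ z) (x³ z̄)
    tri-sq : ∀ D → b₂ ^ D * J₂.tri D ≈ u ^ D * sq D
    tri-sq zero = refl
    tri-sq (suc D) = begin
      b₂ * b₂ ^ D * (b₂ ^ D * J₂.tri D) ≈⟨ *-cong (*-congʳ (solve 2 (λ q υ → q :* (q :* υ :* υ) := q :* υ :* (q :* υ)) refl q υ)) (tri-sq D) ⟩
      u * u * b₂ ^ D * (u ^ D * sq D) ≈⟨ solve 4 (λ u B U s → u :* u :* B :* (U :* s) := u :* U :* (u :* B :* s)) refl _ _ _ _ ⟩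
      u ^ suc D * sq (suc D) ∎
    weight : q * x³ z * x³ z̄ ≈ β₂
    weight = trans (base (- (p * p * p))) (solve 1 (λ q → let p = q :* q ; c = :- (p :* p :* p) ; υ = q :* (p :* p :* p) in q :* c :* q :* (c :* q) := q :* υ :* υ) refl q)
    rows : ∀ D → Pu.row (x³ z) D * Pu.row (x³ z̄) D ≈ al (suc D) - be (suc D)
    rows D = inverse-unique (row-pair _ _ β₂ (opposite (- (p * p * p))) (trans (solve 3 (λ q x y → q :* x :* (q :* y) := q :* (q :* x :* y)) refl q _ _) (*-congˡ weight)) D)
      (al-be-inverse (suc D))
    shape : S ≈ ev β₂ (λ D → sq D * (al (suc D) - be (suc D)))
    shape = trans (ev-congˣ _ weight) (ev-cong (λ D → *-cong (sq-power D) (rows D)))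

  rank-even rank-odd : C
  rank-even = (1# + (T₁ + T₁)) * H + p * N
  rank-odd = (T₁ + p * Ψ) * L + u * Bε

  -- E(ζ) = (1 + 2T₁ + 2pΨ)(L + k H). Subtracting φ = L - 2uBε removes the lone L, and subtracting k
  -- p ν = k p (2ΨH - N) removes 2pΨ k H. All remaining terms carry a plus sign.
  rank-series : (q * z + q * z̄) * Pp.symbols z z̄ ≈ (rank-odd + rank-odd) + (q * z + q * z̄) * rank-even
  rank-series = begin
    k * R ≈⟨ solve 6 (λ k R p ν f b → k :* R := (k :* (R :+ p :* ν) :+ f) :- (f :+ b) :+ b :- k :* (p :* ν)) refl k R p ν φ₃ (u * (Bε + Bε)) ⟩
    (k * (R + p * ν) + φ₃) - (φ₃ + u * (Bε + Bε)) + u * (Bε + Bε) - k * (p * ν)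
      ≈⟨ +-congʳ (+-congʳ (+-cong total (-‿cong φ₃-value))) ⟩
    (1# + (T₁ + T₁) + p * (Ψ + Ψ)) * (L + k * H) - L + u * (Bε + Bε) - k * (p * ν)
      ≈⟨ solve 9 (λ T p Ψ L k H u B ν → (:1 :+ (T :+ T) :+ p :* (Ψ :+ Ψ)) :* (L :+ k :* H) :- L :+ u :* (B :+ B) :- k :* (p :* ν)
           := (((T :+ p :* Ψ) :* L :+ u :* B) :+ ((T :+ p :* Ψ) :* L :+ u :* B)) :+ k :* ((:1 :+ (T :+ T)) :* H :+ p :* ((Ψ :+ Ψ) :* H :- ν))) refl _ _ _ _ _ _ _ _ _ ⟩
    (rank-odd + rank-odd) + k * ((1# + (T₁ + T₁)) * H + p * ((Ψ + Ψ) * H - ν))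
      ≈⟨ +-congˡ (*-congˡ (+-congˡ (*-congˡ (trans (+-congʳ (sym ν-value)) (solve 2 (λ a b → a :+ b :- b := a) refl N ν))))) ⟩
    (rank-odd + rank-odd) + k * rank-even ∎
    where
    k = q * z + q * z̄
    R = Pp.symbols z z̄
    total : k * (R + p * ν) + φ₃ ≈ (1# + (T₁ + T₁) + p * (Ψ + Ψ)) * (L + k * H)
    total = begin
      k * (R + p * ν) + φ₃ ≈⟨ e-value z z̄ z*z̄ ⟨
      sym-ev z z̄ e ≈⟨ e-z ⟩
      Pu.parts * θ₃p * ϑ ≈⟨ *-congˡ ϑ-split ⟩
      Pu.parts * θ₃p * (θ₄ + k * ψ₋) ≈⟨ solve 5 (λ P t a k b → P :* t :* (a :+ k :* b) := t :* (P :* a :+ k :* (P :* b))) refl _ _ _ _ _ ⟩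
      θ₃p * (Pu.parts * θ₄ + k * (Pu.parts * ψ₋)) ≈⟨ *-cong θ₃-split (+-cong θ₄-value (*-congˡ ψ₋-value)) ⟩
      (1# + (T₁ + T₁) + p * (Ψ + Ψ)) * (L + k * H) ∎

-- Formal power series as a complete ring.

module PowerSeries (R : CommutativeRing 0ℓ 0ℓ) where
  private module R = CommutativeRing R
  open R using (Carrier)
  open IntegerSolver R using (solve; :0; :1; _:+_; _:*_; _:-_; :-_; _:=_)

  Seq : Set
  Seq = ℕ → Carrier

  infix 4 _≋_
  record _≋_ (f g : Seq) : Set where
    constructor pointwise
    field at : ∀ n → f n R.≈ g n
  open _≋_ public

  drop : Seq → Seq
  drop f n = f (suc n)

  infixl 6 _⊕_
  infixl 7 _⊛_
  _⊕_ _⊛_ : Seq → Seq → Seq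
  (f ⊕ g) n = f n R.+ g n
  (f ⊛ g) zero = f 0 R.* g 0
  (f ⊛ g) (suc n) = f 0 R.* g (suc n) R.+ (drop f ⊛ g) n

  ⊝_ : Seq → Seq
  (⊝ f) n = R.- f n

  constant : Carrier → Seq
  constant c zero = c
  constant c (suc n) = R.0#

  𝟘 𝟙 x : Seq
  𝟘 n = R.0#
  𝟙 = constant R.1#
  x zero = R.0#
  x (suc n) = 𝟙 n

  private
    ⊛-cong : ∀ {f f′ g g′ : Seq} → (∀ n → f n R.≈ f′ n) → (∀ n → g n R.≈ g′ n) → ∀ n → (f ⊛ g) n R.≈ (f′ ⊛ g′) n
    ⊛-cong e e′ zero = R.*-cong (e 0) (e′ 0)
    ⊛-cong e e′ (suc n) = R.+-cong (R.*-cong (e 0) (e′ (suc n))) (⊛-cong (λ n → e (suc n)) e′ n)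

    ⊛-zeroˡ : ∀ {f : Seq} g → (∀ n → f n R.≈ R.0#) → ∀ n → (f ⊛ g) n R.≈ R.0#
    ⊛-zeroˡ g e zero = R.trans (R.*-congʳ (e 0)) (R.zeroˡ _)
    ⊛-zeroˡ g e (suc n) = R.trans (R.+-cong (R.trans (R.*-congʳ (e 0)) (R.zeroˡ _)) (⊛-zeroˡ g (λ n → e (suc n)) n)) (R.+-identityʳ _)

    ⊛-distribʳ : ∀ f g h n → ((f ⊕ g) ⊛ h) n R.≈ (f ⊛ h) n R.+ (g ⊛ h) n
    ⊛-distribʳ f g h zero = R.distribʳ _ _ _
    ⊛-distribʳ f g h (suc n) = R.trans (R.+-congˡ (⊛-distribʳ (drop f) (drop g) h n))
      (solve 5 (λ a b c d e → (a :+ b) :* c :+ (d :+ e) := a :* c :+ d :+ (b :* c :+ e)) R.refl _ _ _ _ _)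

    ⊛-scale : ∀ c f g n → ((λ k → c R.* f k) ⊛ g) n R.≈ c R.* (f ⊛ g) n
    ⊛-scale c f g zero = R.*-assoc _ _ _
    ⊛-scale c f g (suc n) = R.trans (R.+-congˡ (⊛-scale c (drop f) g n))
      (solve 4 (λ c a b d → c :* a :* b :+ c :* d := c :* (a :* b :+ d)) R.refl _ _ _ _)

    ⊛-assoc : ∀ f g h n → ((f ⊛ g) ⊛ h) n R.≈ (f ⊛ (g ⊛ h)) n
    ⊛-assoc f g h zero = R.*-assoc _ _ _
    ⊛-assoc f g h (suc n) = R.trans
      (R.+-congˡ (R.trans (⊛-distribʳ (λ k → f 0 R.* g (suc k)) (drop f ⊛ g) h n) (R.+-cong (⊛-scale (f 0) (drop g) h n) (⊛-assoc (drop f) g h n))))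
      (solve 5 (λ a b c d e → a :* b :* c :+ (a :* d :+ e) := a :* (b :* c :+ d) :+ e) R.refl _ _ _ _ _)

    ⊛-sucʳ : ∀ f g n → (f ⊛ g) (suc n) R.≈ f (suc n) R.* g 0 R.+ (f ⊛ drop g) n
    ⊛-sucʳ f g zero = R.+-comm _ _
    ⊛-sucʳ f g (suc n) = R.trans (R.+-congˡ (⊛-sucʳ (drop f) g n))
      (solve 3 (λ a b c → a :+ (b :+ c) := b :+ (a :+ c)) R.refl _ _ _)

    ⊛-comm : ∀ f g n → (f ⊛ g) n R.≈ (g ⊛ f) n
    ⊛-comm f g zero = R.*-comm _ _
    ⊛-comm f g (suc n) = R.trans (R.+-cong (R.*-comm _ _) (⊛-comm (drop f) g n)) (R.sym (⊛-sucʳ g f n))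

  constant-⊛ : ∀ c f n → (constant c ⊛ f) n R.≈ c R.* f n
  constant-⊛ c f zero = R.refl
  constant-⊛ c f (suc n) = R.trans (R.+-congˡ (⊛-zeroˡ f (λ n → R.refl) n)) (R.+-identityʳ _)

  private
    ⊛-identityˡ : ∀ f n → (𝟙 ⊛ f) n R.≈ f n
    ⊛-identityˡ f n = R.trans (constant-⊛ R.1# f n) (R.*-identityˡ _)

  x-⊛-zero : ∀ f → (x ⊛ f) 0 R.≈ R.0#
  x-⊛-zero f = R.zeroˡ _

  x-⊛-suc : ∀ f n → (x ⊛ f) (suc n) R.≈ f n
  x-⊛-suc f n = R.trans (R.+-cong (R.zeroˡ _) (⊛-identityˡ f n)) (R.+-identityˡ _)

  commutativeRing : CommutativeRing 0ℓ 0ℓ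
  commutativeRing = record
    { Carrier = Seq ; _≈_ = _≋_ ; _+_ = _⊕_ ; _*_ = _⊛_ ; -_ = ⊝_ ; 0# = 𝟘 ; 1# = 𝟙
    ; isCommutativeRing = record
      { isRing = record
        { +-isAbelianGroup = record
          { isGroup = record
            { isMonoid = record
              { isSemigroup = record
                { isMagma = record
                  { isEquivalence = record
                    { refl = pointwise (λ n → R.refl)
                    ; sym = λ e → pointwise (λ n → R.sym (at e n))
                    ; trans = λ e e′ → pointwise (λ n → R.trans (at e n) (at e′ n)) }
                  ; ∙-cong = λ e e′ → pointwise (λ n → R.+-cong (at e n) (at e′ n)) }
                ; assoc = λ f g h → pointwise (λ n → R.+-assoc _ _ _) }
              ; identity = (λ f → pointwise (λ n → R.+-identityˡ _)) , (λ f → pointwise (λ n → R.+-identityʳ _)) }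
            ; inverse = (λ f → pointwise (λ n → R.-‿inverseˡ _)) , (λ f → pointwise (λ n → R.-‿inverseʳ _))
            ; ⁻¹-cong = λ e → pointwise (λ n → R.-‿cong (at e n)) }
          ; comm = λ f g → pointwise (λ n → R.+-comm _ _) }
        ; *-cong = λ e e′ → pointwise (⊛-cong (at e) (at e′))
        ; *-assoc = λ f g h → pointwise (⊛-assoc f g h)
        ; *-identity = (λ f → pointwise (⊛-identityˡ f)) , (λ f → pointwise (λ n → R.trans (⊛-comm f 𝟙 n) (⊛-identityˡ f n)))
        ; distrib = (λ f g h → pointwise (λ n → R.trans (⊛-comm f (g ⊕ h) n) (R.trans (⊛-distribʳ g h f n) (R.+-cong (⊛-comm g f n) (⊛-comm h f n)))))
                  , (λ f g h → pointwise (⊛-distribʳ g h f)) }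
      ; *-comm = λ f g → pointwise (⊛-comm f g) } }

  -- The coefficient of xⁿ in Σ xᵐ φₘ is the finite antidiagonal sum of φₘ at n - m, so no limit has
  -- to be taken.
  sumˢ : (ℕ → Seq) → Seq
  sumˢ φ zero = φ 0 0
  sumˢ φ (suc n) = φ 0 (suc n) R.+ sumˢ (λ k → φ (suc k)) n

  private
    module C = CommutativeRing commutativeRing
    _^_ = Exp._^_ C.semiring

    x^n-small : ∀ n i (f : Seq) → i ℕ.< n → ((x ^ n) ⊛ f) i R.≈ R.0#
    x^n-small (suc n) i f i<n = R.trans (at (C.*-assoc x (x ^ n) f) i) (go i i<n)
      where
      go : ∀ i → i ℕ.< suc n → (x ⊛ ((x ^ n) ⊛ f)) i R.≈ R.0#
      go zero _ = x-⊛-zero ((x ^ n) ⊛ f)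
      go (suc i) (ℕ.s≤s i<n) = R.trans (x-⊛-suc _ i) (x^n-small n i f i<n)

  completeRing : CompleteRing
  completeRing = record
    { ring = commutativeRing
    ; q = x
    ; sum = sumˢ
    ; sum-unfold = λ φ → pointwise (λ
        { zero → R.sym (R.trans (R.+-congˡ (x-⊛-zero (sumˢ (λ k → φ (suc k))))) (R.+-identityʳ _))
        ; (suc n) → R.+-congˡ (R.sym (x-⊛-suc (sumˢ (λ k → φ (suc k))) n)) })
    ; separated = λ f g h → pointwise (λ n → R.trans (at (proj₂ (h (suc n))) n)
        (R.trans (R.+-congˡ (x^n-small (suc n) n (proj₁ (h (suc n))) ℕₚ.≤-refl)) (R.+-identityʳ _)))
    }

-- Quadratic extensions of a commutative ring.

module Quadratic (K : CommutativeRing 0ℓ 0ℓ) (c : CommutativeRing.Carrier K) where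
  private module K = CommutativeRing K
  open K using (Carrier)
  open IntegerSolver K using (solve; :0; :1; _:+_; _:*_; _:-_; :-_; _:=_)

  -- K[√c], with (a , b) standing for a + b √c.
  commutativeRing : CommutativeRing 0ℓ 0ℓ
  commutativeRing = record
    { Carrier = Carrier × Carrier
    ; _≈_ = λ { (a , b) (a′ , b′) → (a K.≈ a′) × (b K.≈ b′) }
    ; _+_ = λ { (a , b) (a′ , b′) → a K.+ a′ , b K.+ b′ }
    ; _*_ = λ { (a , b) (a′ , b′) → a K.* a′ K.+ c K.* (b K.* b′) , a K.* b′ K.+ b K.* a′ }
    ; -_ = λ { (a , b) → K.- a , K.- b }
    ; 0# = K.0# , K.0#
    ; 1# = K.1# , K.0#
    ; isCommutativeRing = record
      { isRing = record
        { +-isAbelianGroup = record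
          { isGroup = record
            { isMonoid = record
              { isSemigroup = record
                { isMagma = record
                  { isEquivalence = record
                    { refl = K.refl , K.refl
                    ; sym = λ { (e , f) → K.sym e , K.sym f }
                    ; trans = λ { (e , f) (e′ , f′) → K.trans e e′ , K.trans f f′ } }
                  ; ∙-cong = λ { (e , f) (e′ , f′) → K.+-cong e e′ , K.+-cong f f′ } }
                ; assoc = λ _ _ _ → K.+-assoc _ _ _ , K.+-assoc _ _ _ }
              ; identity = (λ _ → K.+-identityˡ _ , K.+-identityˡ _) , (λ _ → K.+-identityʳ _ , K.+-identityʳ _) }
            ; inverse = (λ _ → K.-‿inverseˡ _ , K.-‿inverseˡ _) , (λ _ → K.-‿inverseʳ _ , K.-‿inverseʳ _)
            ; ⁻¹-cong = λ { (e , f) → K.-‿cong e , K.-‿cong f } }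
          ; comm = λ _ _ → K.+-comm _ _ , K.+-comm _ _ }
        ; *-cong = λ { (e , f) (e′ , f′) → K.+-cong (K.*-cong e e′) (K.*-congˡ (K.*-cong f f′)) , K.+-cong (K.*-cong e f′) (K.*-cong f e′) }
        ; *-assoc = λ { (a , b) (a′ , b′) (a″ , b″) →
            solve 7 (λ c a b a′ b′ a″ b″ → (a :* a′ :+ c :* (b :* b′)) :* a″ :+ c :* ((a :* b′ :+ b :* a′) :* b″)
              := a :* (a′ :* a″ :+ c :* (b′ :* b″)) :+ c :* (b :* (a′ :* b″ :+ b′ :* a″))) K.refl c a b a′ b′ a″ b″ ,
            solve 7 (λ c a b a′ b′ a″ b″ → (a :* a′ :+ c :* (b :* b′)) :* b″ :+ (a :* b′ :+ b :* a′) :* a″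
              := a :* (a′ :* b″ :+ b′ :* a″) :+ b :* (a′ :* a″ :+ c :* (b′ :* b″))) K.refl c a b a′ b′ a″ b″ }
        ; *-identity = (λ { (a , b) → solve 3 (λ c a b → :1 :* a :+ c :* (:0 :* b) := a) K.refl c a b , solve 2 (λ a b → :1 :* b :+ :0 :* a := b) K.refl a b })
                     , (λ { (a , b) → solve 3 (λ c a b → a :* :1 :+ c :* (b :* :0) := a) K.refl c a b , solve 2 (λ a b → a :* :0 :+ b :* :1 := b) K.refl a b })
        ; distrib = (λ { (a , b) (a′ , b′) (a″ , b″) →
            solve 7 (λ c a b a′ b′ a″ b″ → a :* (a′ :+ a″) :+ c :* (b :* (b′ :+ b″)) := (a :* a′ :+ c :* (b :* b′)) :+ (a :* a″ :+ c :* (b :* b″))) K.refl c a b a′ b′ a″ b″ ,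
            solve 6 (λ a b a′ b′ a″ b″ → a :* (b′ :+ b″) :+ b :* (a′ :+ a″) := (a :* b′ :+ b :* a′) :+ (a :* b″ :+ b :* a″)) K.refl a b a′ b′ a″ b″ })
          , (λ { (a , b) (a′ , b′) (a″ , b″) →
            solve 7 (λ c a b a′ b′ a″ b″ → (a′ :+ a″) :* a :+ c :* ((b′ :+ b″) :* b) := (a′ :* a :+ c :* (b′ :* b)) :+ (a″ :* a :+ c :* (b″ :* b))) K.refl c a b a′ b′ a″ b″ ,
            solve 6 (λ a b a′ b′ a″ b″ → (a′ :+ a″) :* b :+ (b′ :+ b″) :* a := (a′ :* b :+ b′ :* a) :+ (a″ :* b :+ b″ :* a)) K.refl a b a′ b′ a″ b″ }) }
      ; *-comm = λ { (a , b) (a′ , b′) →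
          solve 5 (λ c a b a′ b′ → a :* a′ :+ c :* (b :* b′) := a′ :* a :+ c :* (b′ :* b)) K.refl c a b a′ b′ ,
          solve 4 (λ a b a′ b′ → a :* b′ :+ b :* a′ := a′ :* b :+ b′ :* a) K.refl a b a′ b′ } } }

-- Lower bounds for series with nonnegative integer coefficients.

record Positive (𝒞 : CompleteRing) : Set₁ where
  open CompleteRing 𝒞
  field
    Natural   : C → Set
    nat-0     : Natural 0#
    nat-1     : Natural 1#
    nat-q     : Natural q
    nat-+     : ∀ {x y} → Natural x → Natural y → Natural (x + y)
    nat-*     : ∀ {x y} → Natural x → Natural y → Natural (x * y)
    nat-sum   : ∀ {φ} → (∀ n → Natural (φ n)) → Natural (sum φ)

module Positivity (𝒞 : CompleteRing) (pos : Positive 𝒞) (z z̄ : CompleteRing.C 𝒞)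
  (z*z̄ : CompleteRing._≈_ 𝒞 (CompleteRing._*_ 𝒞 z z̄) (CompleteRing.1# 𝒞))
  (z̄² : CompleteRing._≈_ 𝒞 (CompleteRing._*_ 𝒞 z̄ z̄) (CompleteRing.-_ 𝒞 (CompleteRing._*_ 𝒞 z z))) where
  open Series 𝒞
  open Positive pos
  open Recurrence 𝒞 using (p)
  open Combination 𝒞 using (u; υ)
  open Bilateral 𝒞
  open RankSeries 𝒞 z z̄ z*z̄ z̄²

  nat-^ : ∀ {x} n → Natural x → Natural (x ^ n)
  nat-^ zero nx = nat-1
  nat-^ (suc n) nx = nat-* nx (nat-^ n nx)

  nat-ev : ∀ {x φ} → Natural x → (∀ n → Natural (φ n)) → Natural (ev x φ)
  nat-ev nx nφ = nat-sum (λ n → nat-* (nat-^ n nx) (nφ n))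

  infix 4 _≽_
  record _≽_ (x y : C) : Set where
    constructor excess
    field
      rest         : C
      rest-natural : Natural rest
      decompose    : x ≈ y + rest

  ≽-trans : ∀ {x y w} → x ≽ y → y ≽ w → x ≽ w
  ≽-trans (excess a na e) (excess b nb f) = excess (b + a) (nat-+ nb na) (trans e (trans (+-congʳ f) (+-assoc _ _ _)))

  ≽-≈ : ∀ {x y} → x ≈ y → x ≽ y
  ≽-≈ e = excess 0# nat-0 (trans e (sym (+-identityʳ _)))

  ≽-refl : ∀ {x} → x ≽ x
  ≽-refl = ≽-≈ refl

  ≽-left : ∀ {x y} → Natural y → x + y ≽ x
  ≽-left {x} {y} ny = excess y ny refl

  ≽-right : ∀ {x y} → Natural x → x + y ≽ y
  ≽-right {x} {y} nx = excess x nx (+-comm _ _)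

  ≽-* : ∀ {x y x′ y′} → Natural y → Natural y′ → x ≽ y → x′ ≽ y′ → x * x′ ≽ y * y′
  ≽-* {x} {y} {x′} {y′} ny ny′ (excess a na e) (excess b nb f) = excess (y * b + a * y′ + a * b)
    (nat-+ (nat-+ (nat-* ny nb) (nat-* na ny′)) (nat-* na nb))
    (trans (*-cong e f) (solve 4 (λ y a w b → (y :+ a) :* (w :+ b) := y :* w :+ (y :* b :+ a :* w :+ a :* b)) refl y a y′ b))

  ≽-ev : ∀ {x φ} k → Natural x → (∀ n → Natural (φ n)) → ev x φ ≽ (q * x) ^ k * φ k
  ≽-ev {x} {φ} k nx nφ = ≽-trans (≽-≈ (ev-partial x φ (suc k)))
    (≽-trans (≽-left (nat-* (nat-^ (suc k) nX) (nat-ev nx (λ n → nφ (suc k ℕ.+ n))))) (≽-right (partials k)))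
    where
    nX = nat-* nat-q nx
    partials : ∀ k → Natural (partial x φ k)
    partials zero = nat-0
    partials (suc k) = nat-+ (partials k) (nat-* (nat-^ k nX) (nφ k))

  private
    np = nat-* nat-q nat-q
    nυ = nat-* nat-q (nat-* (nat-* np np) np)
    nu = nat-* nat-q nυ
    nβ₂ = nat-* nu nυ
    nb₂ = nat-* nat-q nβ₂
    nβ₄ = nat-* (nat-* nat-q nβ₂) nβ₂

    n-geom : ∀ {x} → Natural x → Natural (geom x)
    n-geom nx = nat-ev nx (λ _ → nat-1)

    geom≽1 : ∀ {x} → Natural x → geom x ≽ 1#
    geom≽1 nx = ≽-trans (≽-ev 0 nx (λ _ → nat-1)) (≽-≈ (*-identityˡ _))

    n-sq : ∀ n → Natural (sq n)
    n-sq zero = nat-1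
    n-sq (suc n) = nat-* (nat-* nu (nat-^ n nb₂)) (n-sq n)

    n-poch : ∀ n → Natural (poch υ β₂ n)
    n-poch zero = nat-1
    n-poch (suc n) = nat-* (n-poch n) (nat-+ nat-1 (nat-* nu (nat-^ n nb₂)))

    n-recip : ∀ n → Natural (J₄.recip n)
    n-recip zero = nat-1
    n-recip (suc n) = nat-* (n-recip n) (n-geom (nat-* nβ₄ (nat-^ n (nat-* nat-q nβ₄))))

    n-γ : ∀ n → Natural (γ n)
    n-γ n = n-geom (nat-* (nat-* nat-q (nat-* nβ₂ (nat-^ n nb₂))) (nat-* nβ₂ (nat-^ n nb₂)))

    n-al : ∀ n → Natural (al n)
    n-be : ∀ n → Natural (be n)
    n-al zero = nat-1
    n-al (suc n) = nat-* (n-γ n) (nat-+ (n-al n) (nat-* (n-be n) (nat-^ (suc n) nb₂)))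
    n-be zero = nat-0
    n-be (suc n) = nat-* (n-γ n) (nat-+ (nat-* (n-al n) (nat-^ (suc n) nb₂)) (n-be n))

    n-H : Natural H
    n-H = nat-ev nβ₂ n-recip
    n-N : Natural N
    n-N = nat-ev nυ n-poch
    n-T : Natural T₁
    n-T = nat-* nu (nat-ev nβ₂ n-sq)
    n-Ψ : Natural Ψ
    n-Ψ = nat-ev nυ n-sq
    n-L : Natural L
    n-L = nat-+ nat-1 (nat-* nat-q (nat-* nυ (nat-ev nβ₂ n-poch)))
    n-Bε : Natural Bε
    n-Bε = nat-ev nβ₂ (λ D → nat-* (n-sq D) (n-be (suc D)))

  natural-even : Natural rank-even
  natural-even = nat-+ (nat-* (nat-+ nat-1 (nat-+ n-T n-T)) n-H) (nat-* np n-N)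

  natural-odd : Natural rank-odd
  natural-odd = nat-+ (nat-* (nat-+ n-T (nat-* np n-Ψ)) n-L) (nat-* nu n-Bε)

  private
    poch≽1 : ∀ n → poch υ β₂ n ≽ 1#
    poch≽1 zero = ≽-refl
    poch≽1 (suc n) = ≽-trans (≽-* nat-1 nat-1 (poch≽1 n) (≽-left (nat-* nu (nat-^ n nb₂)))) (≽-≈ (*-identityˡ _))

    poch≽u : ∀ n → poch υ β₂ (suc n) ≽ u
    poch≽u zero = ≽-trans (≽-≈ (solve 1 (λ u → :1 :* (:1 :+ u :* :1) := :1 :+ u) refl u)) (≽-right nat-1)
    poch≽u (suc n) = ≽-trans (≽-* nu nat-1 (poch≽u n) (≽-left (nat-* nu (nat-^ (suc n) nb₂)))) (≽-≈ (*-identityʳ _))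

    recip≽1 : ∀ n → J₄.recip n ≽ 1#
    recip≽1 zero = ≽-refl
    recip≽1 (suc n) = ≽-trans (≽-* nat-1 nat-1 (recip≽1 n) (geom≽1 (nat-* nβ₄ (nat-^ n (nat-* nat-q nβ₄))))) (≽-≈ (*-identityˡ _))

    b₂^ : ∀ j → b₂ ^ j ≈ u ^ (j ℕ.+ j)
    b₂^ j = trans (^-congˡ j (solve 2 (λ q υ → q :* (q :* υ :* υ) := q :* υ :* (q :* υ)) refl q υ))
      (trans (^-distrib-* u u j) (sym (^-homo-* u j j)))

    T≽u : T₁ ≽ u
    T≽u = ≽-trans (≽-* nu nat-1 ≽-refl (≽-trans (≽-ev 0 nβ₂ n-sq) (≽-≈ (*-identityˡ _)))) (≽-≈ (*-identityʳ _))

    H≽ : ∀ j → H ≽ u ^ (j ℕ.+ j)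
    H≽ j = ≽-trans (≽-ev j nβ₂ n-recip) (≽-trans (≽-* (nat-^ j nb₂) nat-1 ≽-refl (recip≽1 j)) (≽-≈ (trans (*-identityʳ _) (b₂^ j))))

    n-u^ : ∀ k → Natural (u ^ k)
    n-u^ k = nat-^ k nu

  -- H = Σ_a u²ᵃ / (u⁴; u⁴)_a contains every even power of u. An odd power takes one extra factor u
  -- from `T₁`.
  even≽u^k : ∀ k → rank-even ≽ u ^ k
  even≽u^k k = ≽-trans (≽-left (nat-* np n-N)) (go (parity k))
    where
    go : (∃ λ i → k ≡ i ℕ.+ i) ⊎ (∃ λ i → k ≡ suc (i ℕ.+ i)) → (1# + (T₁ + T₁)) * H ≽ u ^ k
    go (inj₁ (i , ≡.refl)) = ≽-trans (≽-* nat-1 (n-u^ (i ℕ.+ i)) (≽-left (nat-+ n-T n-T)) (H≽ i)) (≽-≈ (*-identityˡ _))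
    go (inj₂ (i , ≡.refl)) = ≽-* nu (n-u^ (i ℕ.+ i)) (≽-trans (≽-right nat-1) (≽-trans (≽-left n-T) T≽u)) (H≽ i)

  even≽pu^k : ∀ k → rank-even ≽ p * u ^ k
  even≽pu^k k = ≽-trans (≽-right (nat-* (nat-+ nat-1 (nat-+ n-T n-T)) n-H)) (≽-* np (n-u^ k) ≽-refl
    (≽-trans (≽-ev k nυ n-poch) (≽-trans (≽-* (n-u^ k) nat-1 ≽-refl (poch≽1 k)) (≽-≈ (*-identityʳ _)))))

  private
    L≽1 : L ≽ 1#
    L≽1 = ≽-left (nat-* nat-q (nat-* nυ (nat-ev nβ₂ n-poch)))

    -- L counts partitions into distinct odd parts; the n-th summand of `poch∞` collects those with
    -- largest part 2n + 1, and `poch υ β₂ n` accounts for the smaller parts.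
    L≽term : ∀ {y} n → Natural y → poch υ β₂ n ≽ y → L ≽ u ^ suc (n ℕ.+ n) * y
    L≽term {y} n ny h = ≽-trans (≽-right nat-1) (≽-trans (≽-≈ (sym (*-assoc q υ _)))
      (≽-trans (≽-* nu (nat-* (nat-^ n nb₂) ny) ≽-refl (≽-trans (≽-ev n nβ₂ n-poch) (≽-* (nat-^ n nb₂) ny ≽-refl h)))
        (≽-≈ (trans (sym (*-assoc _ _ _)) (*-congʳ (*-congˡ (b₂^ n)))))))

    L≽odd : ∀ n → L ≽ u ^ suc (n ℕ.+ n)
    L≽odd n = ≽-trans (L≽term n nat-1 (poch≽1 n)) (≽-≈ (*-identityʳ _))

    L≽even : ∀ n → L ≽ u ^ (4 ℕ.+ (n ℕ.+ n))
    L≽even n = ≽-trans (L≽term (suc n) nu (poch≽u n))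
      (≽-≈ (trans (*-comm _ _) (reflexive (≡.cong (λ k → u ^ suc (suc (suc k))) (ℕₚ.+-suc n n)))))

    -- An odd k is a single part of L, and an even k ≥ 4 is 1 + (k - 1). Only k = 2 is not a sum of
    -- distinct odd numbers; there the term u² of Ψ = 1 + u² + u⁶ + ... is used.
    ΨL≽ : ∀ k → Ψ * L ≽ u ^ k
    ΨL≽ k = go (parity k)
      where
      Ψ≽1 : Ψ ≽ 1#
      Ψ≽1 = ≽-trans (≽-ev 0 nυ n-sq) (≽-≈ (*-identityˡ _))
      Ψ≽u² : Ψ ≽ u ^ 2
      Ψ≽u² = ≽-trans (≽-ev 1 nυ n-sq) (≽-≈ (solve 1 (λ u → u :* :1 :* (u :* :1 :* :1) := u :^ 2) refl u))
      withL : ∀ {k} → L ≽ u ^ k → Ψ * L ≽ u ^ k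
      withL {k} h = ≽-trans (≽-* nat-1 (n-u^ k) Ψ≽1 h) (≽-≈ (*-identityˡ _))
      go : ∀ {k} → (∃ λ i → k ≡ i ℕ.+ i) ⊎ (∃ λ i → k ≡ suc (i ℕ.+ i)) → Ψ * L ≽ u ^ k
      go (inj₂ (i , ≡.refl)) = withL {suc (i ℕ.+ i)} (L≽odd i)
      go (inj₁ (zero , ≡.refl)) = withL {0} L≽1
      go (inj₁ (suc zero , ≡.refl)) = ≽-trans (≽-* (n-u^ 2) nat-1 Ψ≽u² L≽1) (≽-≈ (*-identityʳ _))
      go (inj₁ (suc (suc i) , ≡.refl)) = ≽-trans (withL {4 ℕ.+ (i ℕ.+ i)} (L≽even i)) (≽-≈ (reflexive (≡.cong (u ^_) index)))
        where
        index : 4 ℕ.+ (i ℕ.+ i) ≡ suc (suc i) ℕ.+ suc (suc i)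
        index = ≡.cong (λ k → suc (suc k)) (≡.sym (≡.trans (ℕₚ.+-suc i (suc i)) (≡.cong suc (ℕₚ.+-suc i i))))

  odd≽pu^k : ∀ k → rank-odd ≽ p * u ^ k
  odd≽pu^k k = ≽-trans (≽-left (nat-* nu n-Bε)) (≽-trans (≽-≈ (distribʳ L T₁ (p * Ψ)))
    (≽-trans (≽-right (nat-* n-T n-L)) (≽-trans (≽-≈ (*-assoc _ _ _)) (≽-* np (n-u^ k) ≽-refl (ΨL≽ k)))))

  -- `T₁ * L` contains u · uᵏ whenever L contains uᵏ. In the exceptional case k = 2 the term u³
  -- comes from `u * Bε`: a single part u² is an odd number of parts.
  odd≽u^k : ∀ k → rank-odd ≽ u ^ suc k
  odd≽u^k k = go (parity k)
    where
    withT : ∀ {j} → L ≽ u ^ j → rank-odd ≽ u ^ suc j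
    withT {j} h = ≽-trans (≽-left (nat-* nu n-Bε)) (≽-* nu (n-u^ j) (≽-trans (≽-left (nat-* np n-Ψ)) T≽u) h)
    Bε≽ : Bε ≽ u ^ 2
    Bε≽ = ≽-trans (≽-ev 0 nβ₂ (λ D → nat-* (n-sq D) (n-be (suc D)))) (≽-trans (≽-≈ (solve 1 (λ b → :1 :* (:1 :* b) := b) refl (be 1)))
      (≽-trans (≽-* nat-1 (nat-* nat-1 (nat-^ 1 nb₂)) (geom≽1 (nat-* (nat-* nat-q (nat-* nβ₂ nat-1)) (nat-* nβ₂ nat-1))) (≽-left nat-0))
        (≽-≈ (trans (*-identityˡ _) (trans (*-identityˡ _) (b₂^ 1))))))
    go : ∀ {k} → (∃ λ i → k ≡ i ℕ.+ i) ⊎ (∃ λ i → k ≡ suc (i ℕ.+ i)) → rank-odd ≽ u ^ suc k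
    go (inj₂ (i , ≡.refl)) = withT {suc (i ℕ.+ i)} (L≽odd i)
    go (inj₁ (zero , ≡.refl)) = withT {0} L≽1
    go (inj₁ (suc zero , ≡.refl)) = ≽-trans (≽-right (nat-* (nat-+ n-T (nat-* np n-Ψ)) n-L)) (≽-* nu (n-u^ 2) ≽-refl Bε≽)
    go (inj₁ (suc (suc i) , ≡.refl)) = ≽-trans (withT {4 ℕ.+ (i ℕ.+ i)} (L≽even i)) (≽-≈ (reflexive (≡.cong (λ k → u ^ suc k) index)))
      where
      index : 4 ℕ.+ (i ℕ.+ i) ≡ suc (suc i) ℕ.+ suc (suc i)
      index = ≡.cong (λ k → suc (suc k)) (≡.sym (≡.trans (ℕₚ.+-suc i (suc i)) (≡.cong suc (ℕₚ.+-suc i i))))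

open import Defs
open import Data.Empty using (⊥; ⊥-elim)
import Data.Nat.Divisibility as ℕᵈ
open import Data.Nat.DivMod using (_%_; _/_; m≡m%n+[m/n]*n; m%n<n)
open import Data.Nat.ListAction using (sum)
open import Data.Nat.Solver using (module +-*-Solver)
import Data.Integer.Divisibility.Signed as Signed
open import Data.List using (List; []; _∷_; _++_; map; length; filter; cartesianProduct)
open import Data.List.Properties using (length-map; filter-accept; filter-reject)
open import Data.List.Relation.Unary.All as All using (All; []; _∷_)
open import Data.List.Relation.Unary.AllPairs using (AllPairs; []; _∷_)
open import Data.List.Relation.Unary.Any using (here)
open import Data.List.Relation.Unary.Linked using (Linked; []; [-]; _∷_)
open import Data.List.Relation.Unary.Linked.Properties using (Linked⇒AllPairs)
open import Data.List.Relation.Unary.Unique.Propositional using (Unique)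
import Data.List.Relation.Unary.Unique.Propositional.Properties as Uniqueₚ
open import Data.List.Membership.Propositional using (_∈_)
open import Data.List.Membership.Propositional.Properties using (∈-++⁺ˡ; ∈-++⁺ʳ; ∈-++⁻; ∈-map⁺; ∈-map⁻; ∈-filter⁺; ∈-filter⁻; ∈-cartesianProduct⁺; ∈-cartesianProduct⁻)
open import Function.Bundles using (mk⇔; Equivalence)

-- Weighted enumerations and their generating functions.

module Enumeration (R : CommutativeRing 0ℓ 0ℓ) where
  open CommutativeRing R
  open PowerSeries R using (Seq; _⊛_; drop; sumˢ)
  open import Relation.Binary.Reasoning.Setoid setoid

  weigh : {A : Set} → (A → Carrier) → List A → Carrier
  weigh w [] = 0#
  weigh w (a ∷ as) = w a + weigh w as

  -- Keeps the list next to its total weight: the list yields the witnesses for `HasCount`, and the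
  -- weight is a coefficient of the series.
  record Enum {A : Set} (P : A → Set) (w : A → Carrier) (c : Carrier) : Set where
    field
      list     : List A
      unique   : Unique list
      sound    : ∀ {a} → a ∈ list → P a
      complete : ∀ {a} → P a → a ∈ list
      total    : weigh w list ≈ c
  open Enum public

  module _ {A : Set} where
    private variable
      P Q : A → Set
      w : A → Carrier
      c d : Carrier

    enum-⇔ : (∀ {a} → P a → Q a) → (∀ {a} → Q a → P a) → c ≈ d → Enum P w c → Enum Q w d
    enum-⇔ f g e E = record { list = list E ; unique = unique E ; sound = λ m → f (sound E m) ; complete = λ q → complete E (g q) ; total = trans (total E) e }

    enum-∅ : (∀ {a} → ¬ P a) → Enum P w 0#
    enum-∅ h = record { list = [] ; unique = [] ; sound = λ () ; complete = λ pa → ⊥-elim (h pa) ; total = refl }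

    enum-one : ∀ a → P a → (∀ {b} → P b → b ≡ a) → Enum P w (w a)
    enum-one a pa h = record { list = a ∷ [] ; unique = [] ∷ [] ; sound = λ { (here ≡.refl) → pa } ; complete = λ pb → here (h pb) ; total = +-identityʳ _ }

    weigh-++ : ∀ (w : A → Carrier) xs ys → weigh w (xs ++ ys) ≈ weigh w xs + weigh w ys
    weigh-++ w [] ys = sym (+-identityˡ _)
    weigh-++ w (a ∷ xs) ys = trans (+-congˡ (weigh-++ w xs ys)) (sym (+-assoc _ _ _))

    enum-⊎ : Enum P w c → Enum Q w d → (∀ {a} → P a → Q a → ⊥) → Enum (λ a → P a ⊎ Q a) w (c + d)
    enum-⊎ {w = w} E F disjoint = record
      { list = list E ++ list F
      ; unique = Uniqueₚ.++⁺ (unique E) (unique F) (λ { (m , n) → disjoint (sound E m) (sound F n) })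
      ; sound = λ m → split (∈-++⁻ (list E) m)
      ; complete = λ { (inj₁ pa) → ∈-++⁺ˡ (complete E pa) ; (inj₂ qa) → ∈-++⁺ʳ (list E) (complete F qa) }
      ; total = trans (weigh-++ w (list E) (list F)) (+-cong (total E) (total F)) }
      where
      split : ∀ {a} → a ∈ list E ⊎ a ∈ list F → _
      split (inj₁ m) = inj₁ (sound E m)
      split (inj₂ m) = inj₂ (sound F m)

  enum-map : ∀ {A B : Set} {P : A → Set} {Q : B → Set} {w : A → Carrier} {v : B → Carrier} {c} (f : A → B) k →
    (∀ {a a′} → f a ≡ f a′ → a ≡ a′) → (∀ {a} → P a → Q (f a)) → (∀ {b} → Q b → ∃ λ a → P a × b ≡ f a) →
    (∀ a → v (f a) ≈ k * w a) → Enum P w c → Enum Q v (k * c)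
  enum-map {P = P} {Q} {w} {v} f k inj to from vf E = record
    { list = map f (list E)
    ; unique = Uniqueₚ.map⁺ inj (unique E)
    ; sound = λ m → sound′ (∈-map⁻ f m)
    ; complete = λ qb → complete′ (from qb)
    ; total = trans (weigh-map (list E)) (*-congˡ (total E)) }
    where
    sound′ : ∀ {b} → (∃ λ a → a ∈ list E × b ≡ f a) → Q b
    sound′ (a , m , ≡.refl) = to (sound E m)
    complete′ : ∀ {b} → (∃ λ a → P a × b ≡ f a) → b ∈ map f (list E)
    complete′ (a , pa , ≡.refl) = ∈-map⁺ f (complete E pa)
    weigh-map : ∀ xs → weigh v (map f xs) ≈ k * weigh w xs
    weigh-map [] = sym (zeroʳ k)
    weigh-map (a ∷ xs) = trans (+-cong (vf a) (weigh-map xs)) (sym (distribˡ _ _ _))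

  enum-× : ∀ {A B : Set} {P : A → Set} {Q : B → Set} {w : A → Carrier} {v : B → Carrier} {c d} → Enum P w c → Enum Q v d →
    Enum {A × B} (λ { (a , b) → P a × Q b }) (λ { (a , b) → w a * v b }) (c * d)
  enum-× {A} {B} {w = w} {v} E F = record
    { list = cartesianProduct (list E) (list F)
    ; unique = Uniqueₚ.cartesianProduct⁺ (unique E) (unique F)
    ; sound = λ m → let (m₁ , m₂) = ∈-cartesianProduct⁻ (list E) (list F) m in sound E m₁ , sound F m₂
    ; complete = λ { (pa , qb) → ∈-cartesianProduct⁺ (complete E pa) (complete F qb) }
    ; total = trans (weigh-× (list E)) (*-cong (total E) (total F)) }
    where
    wv : A × B → Carrier
    wv (a , b) = w a * v b
    weigh-row : ∀ a ys → weigh wv (map (a ,_) ys) ≈ w a * weigh v ys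
    weigh-row a [] = sym (zeroʳ _)
    weigh-row a (b ∷ ys) = trans (+-congˡ (weigh-row a ys)) (sym (distribˡ _ _ _))
    weigh-× : ∀ xs → weigh wv (cartesianProduct xs (list F)) ≈ weigh w xs * weigh v (list F)
    weigh-× [] = sym (zeroˡ _)
    weigh-× (a ∷ xs) = trans (weigh-++ wv (map (a ,_) (list F)) _) (trans (+-cong (weigh-row a (list F)) (weigh-× xs)) (sym (distribʳ _ _ _)))

  -- An object determines its size, so different splittings of `n` enumerate disjoint sets and the
  -- convolution counts nothing twice.
  enum-⊛ : ∀ {A B : Set} {w : A → Carrier} {v : B → Carrier} {f g : Seq} (P : ℕ → A → Set) (Q : ℕ → B → Set) →
    (∀ {i j a} → P i a → P j a → i ≡ j) → (∀ n → Enum (P n) w (f n)) → (∀ n → Enum (Q n) v (g n)) →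
    ∀ n → Enum {A × B} (λ { (a , b) → ∃ λ i → ∃ λ j → i ℕ.+ j ≡ n × P i a × Q j b }) (λ { (a , b) → w a * v b }) ((f ⊛ g) n)
  enum-⊛ P Q det E F zero = enum-⇔ (λ { (pa , qb) → 0 , 0 , ≡.refl , pa , qb }) (λ { (zero , zero , _ , pa , qb) → pa , qb }) refl (enum-× (E 0) (F 0))
  enum-⊛ P Q det E F (suc n) = enum-⇔
    (λ { (inj₁ (pa , qb)) → 0 , suc n , ≡.refl , pa , qb ; (inj₂ (i , j , e , pa , qb)) → suc i , j , ≡.cong suc e , pa , qb })
    (λ { (zero , j , ≡.refl , pa , qb) → inj₁ (pa , qb) ; (suc i , j , ≡.refl , pa , qb) → inj₂ (i , j , ≡.refl , pa , qb) }) refl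
    (enum-⊎ (enum-× (E 0) (F (suc n))) (enum-⊛ (λ i → P (suc i)) Q (λ p p′ → ℕₚ.suc-injective (det p p′)) (λ i → E (suc i)) F n)
      (λ { (pa , qb) (i , j , _ , pa′ , qb′) → ℕₚ.0≢1+n (det pa pa′) }))

  enum-sum : ∀ {A : Set} {w : A → Carrier} {φ : ℕ → Seq} (P : ℕ → ℕ → A → Set) →
    (∀ {i j m n a} → P i m a → P j n a → i ≡ j) → (∀ D m → Enum (P D m) w (φ D m)) →
    ∀ n → Enum (λ a → ∃ λ D → ∃ λ m → D ℕ.+ m ≡ n × P D m a) w (sumˢ φ n)
  enum-sum P det E zero = enum-⇔ (λ pa → 0 , 0 , ≡.refl , pa) (λ { (zero , zero , _ , pa) → pa }) refl (E 0 0)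
  enum-sum P det E (suc n) = enum-⇔
    (λ { (inj₁ pa) → 0 , suc n , ≡.refl , pa ; (inj₂ (D , m , e , pa)) → suc D , m , ≡.cong suc e , pa })
    (λ { (zero , m , ≡.refl , pa) → inj₁ pa ; (suc D , m , ≡.refl , pa) → inj₂ (D , m , ≡.refl , pa) }) refl
    (enum-⊎ (E 0 (suc n)) (enum-sum (λ D → P (suc D)) (λ p p′ → ℕₚ.suc-injective (det p p′)) (λ D → E (suc D)) n)
      (λ { pa (D , m , _ , pa′) → ℕₚ.0≢1+n (det pa pa′) }))

-- Rows of odd parts and the enumeration of odd Durfee symbols.

Row : ℕ → ℕ → List ℕ → Set
Row k n l = All Odd l × All (λ a → a < 2 ℕ.* k) l × Linked _≥_ l × sum l ≡ n

row-sum : ∀ {k i j l} → Row k i l → Row k j l → i ≡ j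
row-sum (_ , _ , _ , e) (_ , _ , _ , e′) = ≡.trans (≡.sym e) e′

private
  2*suc : ∀ k → 2 ℕ.* suc k ≡ suc (suc (2 ℕ.* k))
  2*suc k = ≡.cong suc (ℕₚ.+-suc k (k ℕ.+ 0))

row-weaken : ∀ {k n l} → Row k n l → Row (suc k) n l
row-weaken {k} (o , b , s , e) = o , All.map (λ h → ℕₚ.≤-trans h (ℕₚ.*-monoʳ-≤ 2 (ℕₚ.n≤1+n k))) b , s , e

row-cons : ∀ {k n l} → Row (suc k) n l → Row (suc k) (suc (2 ℕ.* k) ℕ.+ n) (suc (2 ℕ.* k) ∷ l)
row-cons {k} {n} {l} (o , b , s , e) = (k , ≡.refl) ∷ o , ≡.subst (suc (2 ℕ.* k) <_) (≡.sym (2*suc k)) (ℕₚ.n<1+n _) ∷ b ,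
  link l b s , ≡.cong (suc (2 ℕ.* k) ℕ.+_) e
  where
  link : ∀ l → All (λ a → a < 2 ℕ.* suc k) l → Linked _≥_ l → Linked _≥_ (suc (2 ℕ.* k) ∷ l)
  link [] _ _ = [-]
  link (a ∷ l) (h ∷ _) s = ℕₚ.≤-pred (≡.subst (suc a ≤_) (2*suc k) h) ∷ s

row-uncons : ∀ {k n l} → Row (suc k) n l → Row k n l ⊎ (∃ λ l′ → ∃ λ n′ → Row (suc k) n′ l′ × n ≡ suc (2 ℕ.* k) ℕ.+ n′ × l ≡ suc (2 ℕ.* k) ∷ l′)
row-uncons {k} {n} {[]} (o , b , s , e) = inj₁ (o , [] , s , e)
row-uncons {k} {n} {a ∷ l} ((j , ≡.refl) ∷ o , h ∷ b , s , e) with j ℕ.<? k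
... | yes j<k = inj₁ ((j , ≡.refl) ∷ o , a<2k ∷ All.map (λ x≤a → ℕₚ.≤-<-trans x≤a a<2k) (below (Linked⇒AllPairs (λ p q → ℕₚ.≤-trans q p) s)) , s , e)
  where
  a<2k : suc (2 ℕ.* j) < 2 ℕ.* k
  a<2k = ≡.subst (_≤ 2 ℕ.* k) (2*suc j) (ℕₚ.*-monoʳ-≤ 2 j<k)
  below : AllPairs _≥_ (suc (2 ℕ.* j) ∷ l) → All (_≤ suc (2 ℕ.* j)) l
  below (hd ∷ _) = hd
... | no j≮k with ℕₚ.≤-antisym (ℕₚ.*-cancelˡ-≤ 2 (ℕₚ.≤-pred (ℕₚ.≤-pred (≡.subst (suc (suc (2 ℕ.* j)) ≤_) (2*suc k) h)))) (ℕₚ.≮⇒≥ j≮k)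
... | ≡.refl = inj₂ (l , sum l , (o , b , unlink s , ≡.refl) , ≡.sym e , ≡.refl)
  where
  unlink : ∀ {a l} → Linked _≥_ (a ∷ l) → Linked _≥_ l
  unlink [-] = []
  unlink (_ ∷ s) = s

row-disjoint : ∀ {k n l l′} → Row k n l → l ≡ suc (2 ℕ.* k) ∷ l′ → ⊥
row-disjoint (_ , h ∷ _ , _) ≡.refl = ℕₚ.<-asym h (ℕₚ.n<1+n _)

module SymbolCount (R : CommutativeRing 0ℓ 0ℓ) (ξ ξ′ : CommutativeRing.Carrier R)
  (ξξ′ : CommutativeRing._≈_ R (CommutativeRing._*_ R ξ ξ′) (CommutativeRing.1# R)) where
  private module R = CommutativeRing R
  private module PS = PowerSeries R
  open PS using (Seq; constant; at; _⊛_; x-⊛-zero; x-⊛-suc; constant-⊛)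
  open Enumeration R
  open Series PS.completeRing hiding (sum)
  open Recurrence PS.completeRing using (p)
  private module Pp = Partitions PS.completeRing q
  private
    _^ᴿ_ = Exp._^_ R.semiring

  z z̄ : C
  z = constant ξ
  z̄ = constant ξ′

  z*z̄ : z * z̄ ≈ 1#
  z*z̄ = PS.pointwise (λ { zero → ξξ′ ; (suc n) → R.trans (constant-⊛ ξ z̄ (suc n)) (R.zeroʳ ξ) })

  q^-shift : ∀ m f n → (q ^ m * f) (m ℕ.+ n) R.≈ f n
  q^-shift zero f n = at (*-identityˡ f) n
  q^-shift (suc m) f n = R.trans (at (*-assoc q (q ^ m) f) (suc (m ℕ.+ n))) (R.trans (x-⊛-suc (q ^ m * f) (m ℕ.+ n)) (q^-shift m f n))

  q^-small : ∀ m f n → n < m → (q ^ m * f) n R.≈ R.0#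
  q^-small (suc m) f zero _ = R.trans (at (*-assoc q (q ^ m) f) 0) (x-⊛-zero (q ^ m * f))
  q^-small (suc m) f (suc n) (s≤s n<m) = R.trans (at (*-assoc q (q ^ m) f) (suc n)) (R.trans (x-⊛-suc (q ^ m * f) n) (q^-small m f n n<m))

  row-weight : R.Carrier → List ℕ → R.Carrier
  row-weight c l = c ^ᴿ length l

  p^≈ : ∀ k → p ^ k ≈ q ^ (2 ℕ.* k)
  p^≈ zero = refl
  p^≈ (suc k) = begin
    q * q * p ^ k ≈⟨ *-assoc _ _ _ ⟩
    q * (q * p ^ k) ≈⟨ *-congˡ (*-congˡ (p^≈ k)) ⟩
    q ^ suc (suc (2 ℕ.* k)) ≡⟨ ≡.cong (q ^_) (≡.cong suc (≡.sym (ℕₚ.+-suc k (k ℕ.+ 0)))) ⟩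
    q ^ (2 ℕ.* suc k) ∎

  -- A row with entries up to 2k + 1 either avoids that value or begins with it. Removing this head
  -- costs the weight `c` and lowers the sum by 2k + 1. The recursive call is at `n ∸ m`, whence the
  -- fuel.
  enum-row-step : ∀ c k (F G : Seq) → G ≈ F + q ^ suc (2 ℕ.* k) * (constant c * G) →
    (∀ n → Enum (Row k n) (row-weight c) (F n)) → ∀ n → Enum (Row (suc k) n) (row-weight c) (G n)
  enum-row-step c k F G G≈ E n = go (suc n) n ℕₚ.≤-refl
    where
    m = suc (2 ℕ.* k)
    go : ∀ fuel n → n < fuel → Enum (Row (suc k) n) (row-weight c) (G n)
    go (suc fuel) n (s≤s n≤fuel) with m ℕ.≤? n
    ... | no m≰n = enum-⇔ row-weaken back (R.sym (R.trans (at G≈ n) (R.trans (R.+-congˡ (q^-small m _ n (ℕₚ.≰⇒> m≰n))) (R.+-identityʳ _)))) (E n)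
      where
      back : ∀ {l} → Row (suc k) n l → Row k n l
      back r with row-uncons r
      ... | inj₁ r′ = r′
      ... | inj₂ (_ , n′ , _ , e , _) = ⊥-elim (m≰n (≡.subst (m ≤_) (≡.sym e) (ℕₚ.m≤m+n m n′)))
    ... | yes m≤n = ≡.subst (λ n → Enum (Row (suc k) n) (row-weight c) (G n)) index
      (enum-⇔ (λ { (inj₁ r) → row-weaken r ; (inj₂ (l , ≡.refl , r)) → row-cons r }) back
        (R.sym (R.trans (at G≈ (m ℕ.+ n′)) (R.+-congˡ (R.trans (q^-shift m _ n′) (constant-⊛ c G n′)))))
        (enum-⊎ (E (m ℕ.+ n′)) longer (λ { r (l , e , _) → row-disjoint {k} r e })))
      where
      n′ = n ℕ.∸ m
      index : m ℕ.+ n′ ≡ n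
      index = ℕₚ.m+[n∸m]≡n m≤n
      longer : Enum (λ l → ∃ λ l′ → l ≡ m ∷ l′ × Row (suc k) n′ l′) (row-weight c) (c R.* G n′)
      longer = enum-map (m ∷_) c (λ { ≡.refl → ≡.refl }) (λ r → _ , ≡.refl , r) (λ { (l , ≡.refl , r) → l , r , ≡.refl }) (λ l → R.refl)
        (go fuel n′ (ℕₚ.<-≤-trans (≡.subst (n′ <_) index (ℕₚ.m<n+m n′ (s≤s z≤n))) n≤fuel))
      back : ∀ {l} → Row (suc k) (m ℕ.+ n′) l → Row k (m ℕ.+ n′) l ⊎ (∃ λ l′ → l ≡ m ∷ l′ × Row (suc k) n′ l′)
      back r with row-uncons r
      ... | inj₁ r′ = inj₁ r′
      ... | inj₂ (l′ , n″ , r′ , e , e′) = inj₂ (l′ , e′ , ≡.subst (λ n → Row (suc k) n l′) (ℕₚ.+-cancelˡ-≡ m n″ n′ (≡.sym e)) r′)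

  geom-step : ∀ x → geom x ≈ 1# + q * x * geom x
  geom-step x = ev-unfold x _

  enum-row : ∀ c D n → Enum (Row (suc D) n) (row-weight c) (Pp.row (constant c) D n)
  enum-row c zero = enum-row-step c 0 1# (geom (constant c))
    (trans (geom-step (constant c)) (+-congˡ (trans (*-assoc _ _ _) (*-congʳ (sym (*-identityʳ q)))))) empty
    where
    empty : ∀ n → Enum (Row 0 n) (row-weight c) (1# n)
    empty zero = enum-one [] ([] , [] , [] , ≡.refl) only
      where
      only : ∀ {l} → Row 0 0 l → l ≡ []
      only {[]} _ = ≡.refl
      only {_ ∷ _} (_ , () ∷ _ , _)
    empty (suc n) = enum-∅ none
      where
      none : ∀ {l} → ¬ Row 0 (suc n) l
      none {[]} (_ , _ , _ , ())
      none {_ ∷ _} (_ , () ∷ _ , _)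
  enum-row c (suc D) = enum-row-step c (suc D) (Pp.row zc D) (Pp.row zc (suc D)) (begin
    Pp.row zc D * g ≈⟨ *-congˡ (geom-step _) ⟩
    Pp.row zc D * (1# + q * (zc * p ^ suc D) * g)
      ≈⟨ solve 5 (λ r q z P g → r :* (:1 :+ q :* (z :* P) :* g) := r :+ q :* P :* (z :* (r :* g))) refl _ q zc (p ^ suc D) g ⟩
    Pp.row zc D + q * p ^ suc D * (zc * (Pp.row zc D * g)) ≈⟨ +-congˡ (*-congʳ (*-congˡ (p^≈ (suc D)))) ⟩
    Pp.row zc D + q ^ suc (2 ℕ.* suc D) * (zc * (Pp.row zc D * g)) ∎) (enum-row c D)
    where
    zc = constant c
    g = geom (zc * p ^ suc D)

  symbol-weight : Symbol → R.Carrier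
  symbol-weight (D , as , bs) = row-weight ξ as R.* row-weight ξ′ bs

  private
    -- The summation over D supplies a further q^D, which makes 2D² + 2D. The remaining 1 in the
    -- size of a symbol is the offset between the coefficient index n and `suc n`.
    exponent : ℕ → ℕ
    exponent D = D ℕ.+ 2 ℕ.* (D ℕ.* D)

    φ : ℕ → Seq
    φ D = (q * z * z̄) ^ D * (p ^ (D ℕ.* D) * (Pp.row z D * Pp.row z̄ D))

    φ≈ : ∀ D → φ D ≈ q ^ exponent D * (Pp.row z D * Pp.row z̄ D)
    φ≈ D = begin
      (q * z * z̄) ^ D * (p ^ (D ℕ.* D) * X) ≈⟨ *-cong (^-congˡ D (trans (*-assoc q z z̄) (trans (*-congˡ z*z̄) (*-identityʳ q)))) (*-congʳ (p^≈ (D ℕ.* D))) ⟩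
      q ^ D * (q ^ (2 ℕ.* (D ℕ.* D)) * X) ≈⟨ *-assoc _ _ _ ⟨
      q ^ D * q ^ (2 ℕ.* (D ℕ.* D)) * X ≈⟨ *-congʳ (^-homo-* q D _) ⟨
      q ^ exponent D * X ∎
      where X = Pp.row z D * Pp.row z̄ D

    AtD : ℕ → ℕ → Symbol → Set
    AtD D m σ = proj₁ σ ≡ D × IsOddDurfeeSymbol (suc (D ℕ.+ m)) σ

    size : ∀ D s m → suc (D ℕ.+ (exponent D ℕ.+ m)) ≡ s ℕ.+ 2 ℕ.* (D ℕ.* D) ℕ.+ 2 ℕ.* D ℕ.+ 1 → m ≡ s
    size D s m e = ℕₚ.+-cancelˡ-≡ (suc (D ℕ.+ exponent D)) m s (≡.trans (≡.cong suc (ℕₚ.+-assoc D (exponent D) m)) (≡.trans e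
      (solveℕ 2 (λ D s → s :+ℕ conℕ 2 :*ℕ (D :*ℕ D) :+ℕ conℕ 2 :*ℕ D :+ℕ conℕ 1 :=ℕ conℕ 1 :+ℕ (D :+ℕ (D :+ℕ conℕ 2 :*ℕ (D :*ℕ D))) :+ℕ s) ≡.refl D s)))
      where open +-*-Solver renaming (solve to solveℕ; con to conℕ; _:+_ to _:+ℕ_; _:*_ to _:*ℕ_; _:=_ to _:=ℕ_)

    size⁻¹ : ∀ D s → suc (D ℕ.+ (exponent D ℕ.+ s)) ≡ s ℕ.+ 2 ℕ.* (D ℕ.* D) ℕ.+ 2 ℕ.* D ℕ.+ 1
    size⁻¹ D s = solveℕ 2 (λ D s → conℕ 1 :+ℕ (D :+ℕ (D :+ℕ conℕ 2 :*ℕ (D :*ℕ D) :+ℕ s)) :=ℕ s :+ℕ conℕ 2 :*ℕ (D :*ℕ D) :+ℕ conℕ 2 :*ℕ D :+ℕ conℕ 1) ≡.refl D s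
      where open +-*-Solver renaming (solve to solveℕ; con to conℕ; _:+_ to _:+ℕ_; _:*_ to _:*ℕ_; _:=_ to _:=ℕ_)

    bound : ∀ D a → a ≤ 2 ℕ.* D ℕ.+ 1 → a < 2 ℕ.* suc D
    bound D a h = ≡.subst (a <_) (solveℕ 1 (λ D → conℕ 1 :+ℕ (conℕ 2 :*ℕ D :+ℕ conℕ 1) :=ℕ conℕ 2 :*ℕ (conℕ 1 :+ℕ D)) ≡.refl D) (s≤s h)
      where open +-*-Solver renaming (solve to solveℕ; con to conℕ; _:+_ to _:+ℕ_; _:*_ to _:*ℕ_; _:=_ to _:=ℕ_)

    bound⁻¹ : ∀ D a → a < 2 ℕ.* suc D → a ≤ 2 ℕ.* D ℕ.+ 1
    bound⁻¹ D a h = ℕₚ.≤-pred (≡.subst (a <_) (solveℕ 1 (λ D → conℕ 2 :*ℕ (conℕ 1 :+ℕ D) :=ℕ conℕ 1 :+ℕ (conℕ 2 :*ℕ D :+ℕ conℕ 1)) ≡.refl D) h)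
      where open +-*-Solver renaming (solve to solveℕ; con to conℕ; _:+_ to _:+ℕ_; _:*_ to _:*ℕ_; _:=_ to _:=ℕ_)

    Pair : ℕ → ℕ → List ℕ × List ℕ → Set
    Pair D m (as , bs) = ∃ λ i → ∃ λ j → i ℕ.+ j ≡ m × Row (suc D) i as × Row (suc D) j bs

    to : ∀ D m {l} → Pair D m l → AtD D (exponent D ℕ.+ m) (D , l)
    to D m {as , bs} (i , j , ≡.refl , (oa , ba , la , ≡.refl) , (ob , bb , lb , ≡.refl)) = ≡.refl ,
      oa , ob , All.map (bound⁻¹ D _) ba , All.map (bound⁻¹ D _) bb , la , lb , size⁻¹ D (sum as ℕ.+ sum bs)

    from : ∀ D m {σ} → AtD D (exponent D ℕ.+ m) σ → ∃ λ l → Pair D m l × σ ≡ (D , l)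
    from D m {D , as , bs} (≡.refl , oa , ob , ba , bb , la , lb , e) = (as , bs) ,
      (sum as , sum bs , ≡.sym (size D (sum as ℕ.+ sum bs) m e) , (oa , All.map (bound D _) ba , la , ≡.refl) , (ob , All.map (bound D _) bb , lb , ≡.refl)) , ≡.refl

    too-small : ∀ D m → m < exponent D → ∀ {σ} → ¬ AtD D m σ
    too-small D m h {D , as , bs} (≡.refl , _ , _ , _ , _ , _ , _ , e) = ℕₚ.<⇒≱ h (ℕₚ.+-cancelˡ-≤ (suc D) _ _
      (≡.subst (suc (D ℕ.+ exponent D) ≤_) (≡.sym (≡.trans e (≡.trans (≡.sym (size⁻¹ D s)) (≡.cong suc (≡.sym (ℕₚ.+-assoc D (exponent D) s))))))
        (ℕₚ.m≤m+n (suc (D ℕ.+ exponent D)) s)))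
      where s = sum as ℕ.+ sum bs

    enum-D : ∀ D m → Enum (AtD D m) symbol-weight (φ D m)
    enum-D D m with exponent D ℕ.≤? m
    ... | no h = enum-⇔ (λ a → a) (λ a → a) (R.sym (R.trans (at (φ≈ D) m) (q^-small (exponent D) _ m (ℕₚ.≰⇒> h)))) (enum-∅ (too-small D m (ℕₚ.≰⇒> h)))
    ... | yes h = ≡.subst (λ m → Enum (AtD D m) symbol-weight (φ D m)) (ℕₚ.m+[n∸m]≡n h)
      (enum-⇔ (λ a → a) (λ a → a) (R.trans (R.*-identityˡ _) (R.sym (R.trans (at (φ≈ D) (exponent D ℕ.+ m′)) (q^-shift (exponent D) _ m′))))
        (enum-map (D ,_) R.1# (λ { ≡.refl → ≡.refl }) (to D m′) (from D m′) (λ _ → R.sym (R.*-identityˡ _))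
          (enum-⇔ (λ a → a) (λ a → a) R.refl (enum-⊛ (Row (suc D)) (Row (suc D)) (row-sum {suc D}) (enum-row ξ D) (enum-row ξ′ D) m′))))
      where m′ = m ℕ.∸ exponent D

  enum-symbols : ∀ n → Enum (IsOddDurfeeSymbol (suc n)) symbol-weight (Pp.symbols z z̄ n)
  enum-symbols n = enum-⇔ (λ { (D , m , ≡.refl , _ , s) → s }) back R.refl
    (enum-sum AtD (λ { (≡.refl , _) (e , _) → e }) enum-D n)
    where
    back : ∀ {σ} → IsOddDurfeeSymbol (suc n) σ → ∃ λ D → ∃ λ m → D ℕ.+ m ≡ n × AtD D m σ
    back {D , as , bs} s@(_ , _ , _ , _ , _ , _ , e) = D , n ℕ.∸ D , ℕₚ.m+[n∸m]≡n D≤n , ≡.refl ,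
      ≡.subst (λ k → IsOddDurfeeSymbol (suc k) (D , as , bs)) (≡.sym (ℕₚ.m+[n∸m]≡n D≤n)) s
      where
      D≤n : D ≤ n
      D≤n = ≡.subst (D ≤_) (ℕₚ.suc-injective (≡.trans (size⁻¹ D (sum as ℕ.+ sum bs)) (≡.sym e))) (ℕₚ.m≤m+n D _)

-- Power series whose coefficients are natural multiples of 1.

module NaturalSeries (R : CommutativeRing 0ℓ 0ℓ) where
  private module R = CommutativeRing R
  open PowerSeries R
  open Mult R.semiring using (×-homo-+; ×1-homo-*; ×-homo-1) renaming (_×_ to _·_)

  IsNatural : R.Carrier → Set
  IsNatural a = ∃ λ k → a R.≈ k · R.1#

  private
    nat-+ᴿ : ∀ {a b} → IsNatural a → IsNatural b → IsNatural (a R.+ b)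
    nat-+ᴿ (k , e) (l , f) = k ℕ.+ l , R.trans (R.+-cong e f) (R.sym (×-homo-+ R.1# k l))

    nat-*ᴿ : ∀ {a b} → IsNatural a → IsNatural b → IsNatural (a R.* b)
    nat-*ᴿ (k , e) (l , f) = k ℕ.* l , R.trans (R.*-cong e f) (R.sym (×1-homo-* k l))

    nat-⊛ : ∀ (f g : Seq) → (∀ n → IsNatural (f n)) → (∀ n → IsNatural (g n)) → ∀ n → IsNatural ((f ⊛ g) n)
    nat-⊛ f g nf ng zero = nat-*ᴿ (nf 0) (ng 0)
    nat-⊛ f g nf ng (suc n) = nat-+ᴿ (nat-*ᴿ (nf 0) (ng (suc n))) (nat-⊛ (drop f) g (λ n → nf (suc n)) ng n)

    nat-sumˢ : ∀ (φ : ℕ → Seq) → (∀ m n → IsNatural (φ m n)) → ∀ n → IsNatural (sumˢ φ n)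
    nat-sumˢ φ nφ zero = nφ 0 0
    nat-sumˢ φ nφ (suc n) = nat-+ᴿ (nφ 0 (suc n)) (nat-sumˢ (λ k → φ (suc k)) (λ m → nφ (suc m)) n)

    nat-𝟙 : ∀ n → IsNatural (𝟙 n)
    nat-𝟙 zero = 1 , R.sym (×-homo-1 R.1#)
    nat-𝟙 (suc n) = 0 , R.refl

  positive : Positive completeRing
  positive = record
    { Natural = λ f → ∀ n → IsNatural (f n)
    ; nat-0 = λ n → 0 , R.refl
    ; nat-1 = nat-𝟙
    ; nat-q = λ { zero → 0 , R.refl ; (suc n) → nat-𝟙 n }
    ; nat-+ = λ nf ng n → nat-+ᴿ (nf n) (ng n)
    ; nat-* = λ {f} {g} → nat-⊛ f g
    ; nat-sum = λ {φ} → nat-sumˢ φ }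

-- The cyclotomic ring of the eighth roots of unity.

data Residue (i j r : ℕ) (c : ℤ) : Set where
  plus  : r ≡ i → c ≡ + 1 → Residue i j r c
  minus : r ≡ j → c ≡ ℤ.- + 1 → Residue i j r c
  other : ¬ r ≡ i → ¬ r ≡ j → c ≡ + 0 → Residue i j r c

-- ℤ[ζ] for a primitive 8th root of unity ζ; coeff₀ and coeff₁ read off the coefficients of 1 and ζ in the basis 1, ζ, ζ², ζ³.
record EighthRootRing : Set₁ where
  field
    cyclotomicRing : CommutativeRing 0ℓ 0ℓ
  open CommutativeRing cyclotomicRing
  field
    ζ ζ⁻¹       : Carrier
    ζ*ζ⁻¹       : ζ * ζ⁻¹ ≈ 1#
    ζ⁻²         : ζ⁻¹ * ζ⁻¹ ≈ - (ζ * ζ)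
    ζ⁸          : Exp._^_ semiring ζ 8 ≈ 1#
    ζ⁷          : ζ⁻¹ ≈ Exp._^_ semiring ζ 7
    2-cancel    : ∀ {a b} → a + a ≈ b + b → a ≈ b
    coeff₀      : Carrier → ℤ
    coeff₁      : Carrier → ℤ
    coeff₀-cong : ∀ {a b} → a ≈ b → coeff₀ a ≡ coeff₀ b
    coeff₁-cong : ∀ {a b} → a ≈ b → coeff₁ a ≡ coeff₁ b
    coeff₀-+    : ∀ a b → coeff₀ (a + b) ≡ coeff₀ a ℤ.+ coeff₀ b
    coeff₁-+    : ∀ a b → coeff₁ (a + b) ≡ coeff₁ a ℤ.+ coeff₁ b
    coeff₀-0    : coeff₀ 0# ≡ + 0
    coeff₁-0    : coeff₁ 0# ≡ + 0
    coeff₀-ζ    : ∀ r → r < 8 → Residue 0 4 r (coeff₀ (Exp._^_ semiring ζ r))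
    coeff₁-ζ    : ∀ r → r < 8 → Residue 1 5 r (coeff₁ (Exp._^_ semiring ζ r))
    coeff₀-√2   : coeff₀ (ζ + ζ⁻¹) ≡ + 0
    coeff₁-√2   : coeff₁ (ζ + ζ⁻¹) ≡ + 1

module Cyclotomic where
  private
    ℤ-half : ∀ {i j : ℤ} → i ℤ.+ i ≡ j ℤ.+ j → i ≡ j
    ℤ-half {i} {j} e = ℤₚ.*-cancelʳ-≡ i j (+ 2) (≡.trans (double i) (≡.trans e (≡.sym (double j))))
      where
      double : ∀ i → i ℤ.* + 2 ≡ i ℤ.+ i
      double i = ≡.trans (ℤₚ.*-comm i (+ 2)) (≡.trans (ℤₚ.suc-* (+ 1) i) (≡.cong (λ k → i ℤ.+ k) (ℤₚ.*-identityˡ i)))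

  -- Constructed as ℤ[i][√i] with ζ = √i and ζ⁻¹ = -iζ. The nested pairs are coordinates in the
  -- order 1, ζ², ζ, ζ³, so the facts about powers of ζ hold by evaluation. Elsewhere the ring is an
  -- abstract parameter.
  ℤ[ζ] : EighthRootRing
  ℤ[ζ] = record
    { cyclotomicRing = Quadratic.commutativeRing (Quadratic.commutativeRing ℤₚ.+-*-commutativeRing (ℤ.- + 1)) (+ 0 , + 1)
    ; ζ = (+ 0 , + 0) , (+ 1 , + 0)
    ; ζ⁻¹ = (+ 0 , + 0) , (+ 0 , ℤ.- + 1)
    ; ζ*ζ⁻¹ = (≡.refl , ≡.refl) , (≡.refl , ≡.refl)
    ; ζ⁻² = (≡.refl , ≡.refl) , (≡.refl , ≡.refl)
    ; ζ⁸ = (≡.refl , ≡.refl) , (≡.refl , ≡.refl)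
    ; ζ⁷ = (≡.refl , ≡.refl) , (≡.refl , ≡.refl)
    ; 2-cancel = λ { ((e₀ , e₁) , (e₂ , e₃)) → (ℤ-half e₀ , ℤ-half e₁) , (ℤ-half e₂ , ℤ-half e₃) }
    ; coeff₀ = λ { ((a , _) , _) → a }
    ; coeff₁ = λ { (_ , (b , _)) → b }
    ; coeff₀-cong = λ { ((e , _) , _) → e }
    ; coeff₁-cong = λ { (_ , (e , _)) → e }
    ; coeff₀-+ = λ _ _ → ≡.refl
    ; coeff₁-+ = λ _ _ → ≡.refl
    ; coeff₀-0 = ≡.refl
    ; coeff₁-0 = ≡.refl
    ; coeff₀-ζ = λ
      { 0 _ → plus ≡.refl ≡.refl
      ; 1 _ → other (λ ()) (λ ()) ≡.refl
      ; 2 _ → other (λ ()) (λ ()) ≡.refl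
      ; 3 _ → other (λ ()) (λ ()) ≡.refl
      ; 4 _ → minus ≡.refl ≡.refl
      ; 5 _ → other (λ ()) (λ ()) ≡.refl
      ; 6 _ → other (λ ()) (λ ()) ≡.refl
      ; 7 _ → other (λ ()) (λ ()) ≡.refl
      ; (suc (suc (suc (suc (suc (suc (suc (suc r)))))))) (s≤s (s≤s (s≤s (s≤s (s≤s (s≤s (s≤s (s≤s ())))))))) }
    ; coeff₁-ζ = λ
      { 0 _ → other (λ ()) (λ ()) ≡.refl
      ; 1 _ → plus ≡.refl ≡.refl
      ; 2 _ → other (λ ()) (λ ()) ≡.refl
      ; 3 _ → other (λ ()) (λ ()) ≡.refl
      ; 4 _ → other (λ ()) (λ ()) ≡.refl
      ; 5 _ → minus ≡.refl ≡.refl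
      ; 6 _ → other (λ ()) (λ ()) ≡.refl
      ; 7 _ → other (λ ()) (λ ()) ≡.refl
      ; (suc (suc (suc (suc (suc (suc (suc (suc r)))))))) (s≤s (s≤s (s≤s (s≤s (s≤s (s≤s (s≤s (s≤s ())))))))) }
    ; coeff₀-√2 = ≡.refl
    ; coeff₁-√2 = ≡.refl
    }

-- Reading rank counts modulo 8 off the weights.

module Ranks (𝒵 : EighthRootRing) where
  open EighthRootRing 𝒵
  private module R = CommutativeRing cyclotomicRing
  open Exp R.semiring using (_^_; ^-homo-*)
  open SymbolCount cyclotomicRing ζ ζ⁻¹ ζ*ζ⁻¹ public
  open Enumeration cyclotomicRing

  private
    ζ^8+ : ∀ m k → ζ ^ (m ℕ.+ k ℕ.* 8) R.≈ ζ ^ m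
    ζ^8+ m k = R.trans (^-homo-* ζ m (k ℕ.* 8)) (R.trans (R.*-congˡ (turns k)) (R.*-identityʳ _))
      where
      turns : ∀ k → ζ ^ (k ℕ.* 8) R.≈ R.1#
      turns zero = R.refl
      turns (suc k) = R.trans (^-homo-* ζ 8 (k ℕ.* 8)) (R.trans (R.*-cong ζ⁸ (turns k)) (R.*-identityˡ _))

    ζ^% : ∀ m → ζ ^ m R.≈ ζ ^ (m % 8)
    ζ^% m = R.trans (R.reflexive (≡.cong (ζ ^_) (m≡m%n+[m/n]*n m 8))) (ζ^8+ (m % 8) (m / 8))

    ζ⁻¹^ : ∀ t → ζ⁻¹ ^ t R.≈ ζ ^ (7 ℕ.* t)
    ζ⁻¹^ zero = R.refl
    ζ⁻¹^ (suc t) = R.trans (R.*-cong ζ⁷ (ζ⁻¹^ t))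
      (R.trans (R.sym (^-homo-* ζ 7 (7 ℕ.* t))) (R.reflexive (≡.cong (ζ ^_) (≡.sym (ℕₚ.*-suc 7 t)))))

  -- As 7 ≡ -1 modulo 8, this is the residue of the odd rank, computed without leaving ℕ.
  rank₈ : Symbol → ℕ
  rank₈ (D , as , bs) = (length as ℕ.+ 7 ℕ.* length bs) % 8

  rank₈<8 : ∀ σ → rank₈ σ < 8
  rank₈<8 (D , as , bs) = m%n<n (length as ℕ.+ 7 ℕ.* length bs) 8

  weight-rank₈ : ∀ σ → symbol-weight σ R.≈ ζ ^ rank₈ σ
  weight-rank₈ (D , as , bs) = R.trans (R.*-congˡ (ζ⁻¹^ (length bs)))
    (R.trans (R.sym (^-homo-* ζ (length as) (7 ℕ.* length bs))) (ζ^% (length as ℕ.+ 7 ℕ.* length bs)))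

  count : ℕ → List Symbol → ℕ
  count a L = length (filter (λ σ → rank₈ σ ℕ.≟ a) L)

  count-yes : ∀ a σ L → rank₈ σ ≡ a → count a (σ ∷ L) ≡ suc (count a L)
  count-yes a σ L e = ≡.cong length (filter-accept (λ σ → rank₈ σ ℕ.≟ a) {x = σ} {xs = L} e)

  count-no : ∀ a σ L → ¬ rank₈ σ ≡ a → count a (σ ∷ L) ≡ count a L
  count-no a σ L ne = ≡.cong length (filter-reject (λ σ → rank₈ σ ℕ.≟ a) {x = σ} {xs = L} ne)

  module _ (i j : ℕ) (i≢j : ¬ i ≡ j) (coeff : R.Carrier → ℤ) (coeff-0 : coeff R.0# ≡ + 0)
    (coeff-+ : ∀ a b → coeff (a R.+ b) ≡ coeff a ℤ.+ coeff b) (coeff-cong : ∀ {a b} → a R.≈ b → coeff a ≡ coeff b)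
    (residue : ∀ r → r < 8 → Residue i j r (coeff (ζ ^ r))) where

    -- A symbol of rank r contributes ζʳ. Because ζ⁴ = -1, a basis coefficient sees two opposite
    -- residues with opposite signs and no others.
    weigh-count : ∀ L → coeff (weigh symbol-weight L) ≡ + count i L ℤ.- + count j L
    weigh-count [] = coeff-0
    weigh-count (σ ∷ L) = ≡.trans (coeff-+ (symbol-weight σ) (weigh symbol-weight L))
      (≡.trans (≡.cong₂ ℤ._+_ (coeff-cong (weight-rank₈ σ)) (weigh-count L)) (go (residue (rank₈ σ) (rank₈<8 σ))))
      where
      A = count i L
      B = count j L
      go : ∀ {c} → Residue i j (rank₈ σ) c → c ℤ.+ (+ A ℤ.- + B) ≡ + count i (σ ∷ L) ℤ.- + count j (σ ∷ L)
      go (plus e ≡.refl) = ≡.trans (≡.sym (ℤₚ.+-assoc (+ 1) (+ A) (ℤ.- + B)))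
        (≡.cong₂ (λ a b → + a ℤ.- + b) (≡.sym (count-yes i σ L e)) (≡.sym (count-no j σ L (λ e′ → i≢j (≡.trans (≡.sym e) e′)))))
      go (minus e ≡.refl) = ≡.trans (≡.trans (≡.sym (ℤₚ.+-assoc (ℤ.- + 1) (+ A) (ℤ.- + B))) (≡.trans (≡.cong (λ k → k ℤ.+ ℤ.- + B) (ℤₚ.+-comm (ℤ.- + 1) (+ A)))
          (≡.trans (ℤₚ.+-assoc (+ A) (ℤ.- + 1) (ℤ.- + B)) (≡.cong (λ k → + A ℤ.+ k) (≡.sym (ℤₚ.neg-distrib-+ (+ 1) (+ B)))))))
        (≡.cong₂ (λ a b → + a ℤ.- + b) (≡.sym (count-no i σ L (λ e′ → i≢j (≡.trans (≡.sym e′) e)))) (≡.sym (count-yes j σ L e)))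
      go (other ni nj ≡.refl) = ≡.trans (ℤₚ.+-identityˡ _) (≡.cong₂ (λ a b → + a ℤ.- + b) (≡.sym (count-no i σ L ni)) (≡.sym (count-no j σ L nj)))

  private
    module ℤS = IntegerSolver ℤₚ.+-*-commutativeRing

    vanish : ∀ k → k < 8 → 8 ℕᵈ.∣ k → k ≡ 0
    vanish zero _ _ = ≡.refl
    vanish (suc k) k<8 8∣k = ⊥-elim (ℕₚ.<⇒≱ k<8 (ℕᵈ.∣⇒≤ 8∣k))

    small-multiple : ∀ {m n} → m < 8 → n < 8 → (+ 8) Signed.∣ (+ m ℤ.- + n) → m ≡ n
    small-multiple {m} {n} m<8 n<8 d with ℕₚ.≤-total m n
    ... | inj₁ m≤n = ℕₚ.≤-antisym m≤n (ℕₚ.m∸n≡0⇒m≤n (vanish (n ℕ.∸ m) (ℕₚ.≤-<-trans (ℕₚ.m∸n≤m n m) n<8)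
      (≡.subst (8 ℕᵈ.∣_) (≡.trans (≡.cong ℤ.∣_∣ (ℤₚ.m-n≡m⊖n m n)) (ℤₚ.∣⊖∣-≤ m≤n)) (Signed.∣⇒∣ᵤ d))))
    ... | inj₂ n≤m = ≡.sym (ℕₚ.≤-antisym n≤m (ℕₚ.m∸n≡0⇒m≤n (vanish (m ℕ.∸ n) (ℕₚ.≤-<-trans (ℕₚ.m∸n≤m m n) m<8)
      (≡.subst (8 ℕᵈ.∣_) (≡.trans (≡.cong ℤ.∣_∣ (ℤₚ.m-n≡m⊖n m n)) (≡.trans (ℤₚ.∣m⊖n∣≡∣n⊖m∣ m n) (ℤₚ.∣⊖∣-≤ n≤m))) (Signed.∣⇒∣ᵤ d)))))

    lift : ∀ s t → + (s ℕ.+ 7 ℕ.* t) ≡ + ((s ℕ.+ 7 ℕ.* t) % 8) ℤ.+ + ((s ℕ.+ 7 ℕ.* t) / 8) ℤ.* + 8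
    lift s t = ≡.trans (≡.cong +_ (m≡m%n+[m/n]*n (s ℕ.+ 7 ℕ.* t) 8))
      (≡.cong (λ k → + ((s ℕ.+ 7 ℕ.* t) % 8) ℤ.+ k) (ℤₚ.pos-* ((s ℕ.+ 7 ℕ.* t) / 8) 8))

    lift′ : ∀ s t → + s ℤ.+ + 7 ℤ.* + t ≡ + ((s ℕ.+ 7 ℕ.* t) % 8) ℤ.+ + ((s ℕ.+ 7 ℕ.* t) / 8) ℤ.* + 8
    lift′ s t = ≡.trans (≡.cong (λ k → + s ℤ.+ k) (≡.sym (ℤₚ.pos-* 7 t))) (lift s t)

  rank₈-rank : ∀ σ → (+ 8) Signed.∣ (oddRank σ ℤ.- + rank₈ σ)
  rank₈-rank (D , as , bs) = Signed.divides (+ k ℤ.- + t) (begin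
    + s′ ℤ.- + t ℤ.- + r ≡⟨ ℤS.solve 3 (λ s t r → s ℤS.:- t ℤS.:- r ℤS.:= s ℤS.:+ ℤS.con (+ 7) ℤS.:* t ℤS.:- r ℤS.:- t ℤS.:* ℤS.con (+ 8)) ≡.refl (+ s′) (+ t) (+ r) ⟩
    + s′ ℤ.+ + 7 ℤ.* + t ℤ.- + r ℤ.- + t ℤ.* + 8 ≡⟨ ≡.cong (λ a → a ℤ.- + r ℤ.- + t ℤ.* + 8) (lift′ s′ t) ⟩
    + r ℤ.+ + k ℤ.* + 8 ℤ.- + r ℤ.- + t ℤ.* + 8 ≡⟨ ℤS.solve 3 (λ r k t → r ℤS.:+ k ℤS.:* ℤS.con (+ 8) ℤS.:- r ℤS.:- t ℤS.:* ℤS.con (+ 8) ℤS.:= (k ℤS.:- t) ℤS.:* ℤS.con (+ 8)) ≡.refl (+ r) (+ k) (+ t) ⟩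
    (+ k ℤ.- + t) ℤ.* + 8 ∎)
    where
    open ≡.≡-Reasoning
    s′ = length as
    t = length bs
    r = (s′ ℕ.+ 7 ℕ.* t) % 8
    k = (s′ ℕ.+ 7 ℕ.* t) / 8

  rank-mod : ∀ σ a → rank₈ σ ≡ a → oddRank σ ≡ + a [mod 8 ]
  rank-mod σ _ ≡.refl = Signed.∣⇒∣ᵤ (rank₈-rank σ)

  rank-mod⁻¹ : ∀ σ a → a < 8 → oddRank σ ≡ + a [mod 8 ] → rank₈ σ ≡ a
  rank-mod⁻¹ σ a a<8 d = small-multiple (rank₈<8 σ) a<8 (≡.subst ((+ 8) Signed.∣_)
    (ℤS.solve 3 (λ x r a → x ℤS.:- a ℤS.:- (x ℤS.:- r) ℤS.:= r ℤS.:- a) ≡.refl (oddRank σ) (+ rank₈ σ) (+ a))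
    (Signed.∣m∣n⇒∣m-n (Signed.∣ᵤ⇒∣ {+ 8} {oddRank σ ℤ.- + a} d) (rank₈-rank σ)))

  swap : Symbol → Symbol
  swap (D , as , bs) = D , bs , as

  swap-mod : ∀ σ → oddRank (swap σ) ≡ + 5 [mod 8 ] → oddRank σ ≡ + 3 [mod 8 ]
  swap-mod (D , as , bs) d with Signed.∣ᵤ⇒∣ {+ 8} {oddRank (D , bs , as) ℤ.- + 5} d
  -- From t - s - 5 = 8k follows s - t - 3 = -8k - 8, hence the quotient -k - 1.
  ... | Signed.divides k e = Signed.∣⇒∣ᵤ {+ 8} {oddRank (D , as , bs) ℤ.- + 3} (Signed.divides (ℤ.- k ℤ.- + 1) (≡.trans
    (ℤS.solve 2 (λ s t → s ℤS.:- t ℤS.:- ℤS.con (+ 3) ℤS.:= ℤS.:- (t ℤS.:- s ℤS.:- ℤS.con (+ 5)) ℤS.:- ℤS.con (+ 8)) ≡.refl (+ length as) (+ length bs))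
    (≡.trans (≡.cong (λ a → ℤ.- a ℤ.- + 8) e)
      (ℤS.solve 1 (λ k → ℤS.:- (k ℤS.:* ℤS.con (+ 8)) ℤS.:- ℤS.con (+ 8) ℤS.:= (ℤS.:- k ℤS.:- ℤS.:1) ℤS.:* ℤS.con (+ 8)) ≡.refl k))))

  swap-mod⁻¹ : ∀ σ → oddRank σ ≡ + 3 [mod 8 ] → oddRank (swap σ) ≡ + 5 [mod 8 ]
  swap-mod⁻¹ (D , as , bs) d with Signed.∣ᵤ⇒∣ {+ 8} {oddRank (D , as , bs) ℤ.- + 3} d
  ... | Signed.divides k e = Signed.∣⇒∣ᵤ {+ 8} {oddRank (D , bs , as) ℤ.- + 5} (Signed.divides (ℤ.- k ℤ.- + 1) (≡.trans
    (ℤS.solve 2 (λ s t → t ℤS.:- s ℤS.:- ℤS.con (+ 5) ℤS.:= ℤS.:- (s ℤS.:- t ℤS.:- ℤS.con (+ 3)) ℤS.:- ℤS.con (+ 8)) ≡.refl (+ length as) (+ length bs))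
    (≡.trans (≡.cong (λ a → ℤ.- a ℤ.- + 8) e)
      (ℤS.solve 1 (λ k → ℤS.:- (k ℤS.:* ℤS.con (+ 8)) ℤS.:- ℤS.con (+ 8) ℤS.:= (ℤS.:- k ℤS.:- ℤS.:1) ℤS.:* ℤS.con (+ 8)) ≡.refl k))))

  swap-symbol : ∀ {N} σ → IsOddDurfeeSymbol N σ → IsOddDurfeeSymbol N (swap σ)
  swap-symbol (D , as , bs) (oa , ob , ba , bb , la , lb , e) = ob , oa , bb , ba , lb , la ,
    ≡.trans e (≡.cong (λ k → k ℕ.+ 2 ℕ.* (D ℕ.* D) ℕ.+ 2 ℕ.* D ℕ.+ 1) (ℕₚ.+-comm (sum as) (sum bs)))

  symbol-list : ℕ → List Symbol
  symbol-list n = list (enum-symbols n)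

  count-is-N0 : ∀ n a → a < 8 → N0≡ (+ a) 8 (suc n) (count a (symbol-list n))
  count-is-N0 n a a<8 = filter P? (symbol-list n) , ≡.refl , Uniqueₚ.filter⁺ P? (unique E) , λ σ → mk⇔
    (λ m → let (m′ , e) = ∈-filter⁻ P? {xs = symbol-list n} m in sound E m′ , rank-mod σ a e)
    (λ { (s , d) → ∈-filter⁺ P? (complete E s) (rank-mod⁻¹ σ a a<8 d) })
    where
    E = enum-symbols n
    P? = λ σ → rank₈ σ ℕ.≟ a

  -- The coefficient of ζ compares the residues 1 and 5. Exchanging the rows negates the rank, and
  -- -5 ≡ 3 modulo 8.
  count-5-is-N0-3 : ∀ n → N0≡ (+ 3) 8 (suc n) (count 5 (symbol-list n))
  count-5-is-N0-3 n with count-is-N0 n 5 (s≤s (s≤s (s≤s (s≤s (s≤s (s≤s z≤n))))))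
  ... | L , e , u , m = map swap L , ≡.trans (length-map swap L) e , Uniqueₚ.map⁺ (λ { ≡.refl → ≡.refl }) u , λ σ → mk⇔
    (λ h → to σ (∈-map⁻ swap h))
    (λ { (s , d) → ∈-map⁺ swap (Equivalence.from (m (swap σ)) (swap-symbol σ s , swap-mod⁻¹ σ d)) })
    where
    to : ∀ σ → (∃ λ τ → τ ∈ L × σ ≡ swap τ) → IsOddDurfeeSymbol (suc n) σ × (oddRank σ ≡ + 3 [mod 8 ])
    to σ (τ , h , ≡.refl) = let (s , d) = Equivalence.to (m τ) h in swap-symbol τ s , swap-mod (swap τ) d

-- The rank differences as positive coefficients.

module RankDifferences (𝒵 : EighthRootRing) where
  open EighthRootRing 𝒵
  private module R = CommutativeRing cyclotomicRing
  private module PS = PowerSeries cyclotomicRing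
  open Mult R.semiring using (×-assoc-*) renaming (_×_ to _·_)
  open Ranks 𝒵
  open Enumeration cyclotomicRing using (total; weigh)
  open Series PS.completeRing
  open Recurrence PS.completeRing using (p)
  open Combination PS.completeRing using (u; module Pp)
  open NaturalSeries cyclotomicRing
  private module RS = IntegerSolver cyclotomicRing

  private
    z̄² : z̄ * z̄ ≈ - (z * z)
    z̄² = PS.pointwise (λ
      { zero → ζ⁻²
      ; (suc n) → R.trans (tail-zero ζ⁻¹ n) (R.sym (R.trans (R.-‿cong (tail-zero ζ n)) (RS.solve 0 (RS.:- RS.:0 RS.:= RS.:0) R.refl))) })
      where
      tail-zero : ∀ c n → (PS.constant c * PS.constant c) (suc n) R.≈ R.0#
      tail-zero c n = R.trans (PS.constant-⊛ c (PS.constant c) (suc n)) (R.zeroʳ c)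

  open RankSeries PS.completeRing z z̄ z*z̄ z̄² using (rank-even; rank-odd; rank-series)
  open Positivity PS.completeRing positive z z̄ z*z̄ z̄²

  private
    √2 : R.Carrier
    √2 = ζ R.+ ζ⁻¹

    √2² : √2 R.* √2 R.≈ R.1# R.+ R.1#
    √2² = R.trans (RS.solve 2 (λ a b → (a RS.:+ b) RS.:* (a RS.:+ b) RS.:= (a RS.:* a RS.:+ b RS.:* b) RS.:+ (a RS.:* b RS.:+ a RS.:* b)) R.refl ζ ζ⁻¹)
      (R.trans (R.+-cong (R.trans (R.+-congˡ ζ⁻²) (R.-‿inverseʳ _)) (R.+-cong ζ*ζ⁻¹ ζ*ζ⁻¹)) (R.+-identityˡ _))

    √2-times : ∀ f n → ((q * z + q * z̄) * f) (suc n) R.≈ √2 R.* f n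
    √2-times f n = R.trans (PS.at (solve 4 (λ q z w f → (q :* z :+ q :* w) :* f := q :* (z :* f :+ w :* f)) refl q z z̄ f) (suc n))
      (R.trans (PS.x-⊛-suc (z * f + z̄ * f) n) (R.trans (R.+-cong (PS.constant-⊛ ζ f n) (PS.constant-⊛ ζ⁻¹ f n)) (R.sym (R.distribʳ _ _ _))))

    coeff-multiple : ∀ (coeff : R.Carrier → ℤ) → coeff R.0# ≡ + 0 → (∀ a b → coeff (a R.+ b) ≡ coeff a ℤ.+ coeff b) →
      ∀ {a} c → coeff a ≡ + c → ∀ k → coeff (k · a) ≡ + (k ℕ.* c)
    coeff-multiple coeff e₀ e₊ c e zero = e₀
    coeff-multiple coeff e₀ e₊ c e (suc k) = ≡.trans (e₊ _ _) (≡.cong₂ ℤ._+_ e (coeff-multiple coeff e₀ e₊ c e k))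

    coeff₀-1 : coeff₀ R.1# ≡ + 1
    coeff₀-1 with coeff₀-ζ 0 (s≤s z≤n)
    ... | plus _ e = e
    ... | other n _ _ = ⊥-elim (n ≡.refl)

    coeff₁-1 : coeff₁ R.1# ≡ + 0
    coeff₁-1 with coeff₁-ζ 0 (s≤s z≤n)
    ... | other _ _ e = e

    difference : ∀ {a b m} → + a ℤ.- + b ≡ + suc m → b < a
    difference {a} {b} {m} e = ≡.subst (b <_) (≡.sym (ℤₚ.+-injective (≡.trans (ℤS.solve 2 (λ a b → a ℤS.:= (a ℤS.:- b) ℤS.:+ b) ≡.refl (+ a) (+ b)) (≡.cong (λ k → k ℤ.+ + b) e))))
      (ℕₚ.m<n+m b (s≤s z≤n))
      where module ℤS = IntegerSolver ℤₚ.+-*-commutativeRing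

    module Extract (S A B : C) (series : (q * z + q * z̄) * S ≈ (B + B) + (q * z + q * z̄) * A) where
      -- The series identity only gives √2 S = 2B + √2 A at this coefficient. Multiplying by √2 and
      -- cancelling 2 replaces a division by √2.
      coefficient : ∀ n → S n R.≈ A n R.+ √2 R.* B (suc n)
      coefficient n = 2-cancel (R.trans (R.trans (R.sym (twice s)) (R.*-congʳ (R.sym √2²))) (R.trans (R.*-assoc √2 √2 s)
        (R.trans (R.*-congˡ equation) (R.trans (RS.solve 3 (λ s b a → s RS.:* ((b RS.:+ b) RS.:+ s RS.:* a) RS.:= s RS.:* s RS.:* a RS.:+ (s RS.:* b RS.:+ s RS.:* b)) R.refl √2 b a)
          (R.trans (R.+-congʳ (R.trans (R.*-congʳ √2²) (twice a))) (RS.solve 2 (λ a c → (a RS.:+ a) RS.:+ (c RS.:+ c) RS.:= (a RS.:+ c) RS.:+ (a RS.:+ c)) R.refl a (√2 R.* b)))))))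
        where
        s = S n
        a = A n
        b = B (suc n)
        twice : ∀ a → (R.1# R.+ R.1#) R.* a R.≈ a R.+ a
        twice a = RS.solve 1 (λ a → (RS.:1 RS.:+ RS.:1) RS.:* a RS.:= a RS.:+ a) R.refl a
        equation : √2 R.* s R.≈ (b R.+ b) R.+ √2 R.* a
        equation = R.trans (R.sym (√2-times S n)) (R.trans (PS.at series (suc n)) (R.+-congˡ (√2-times A n)))

      value : ∀ n k l → A n R.≈ k · R.1# → B (suc n) R.≈ l · R.1# → S n R.≈ k · R.1# R.+ l · √2
      value n k l ek el = R.trans (coefficient n) (R.+-cong ek (R.trans (R.*-comm _ _) (R.trans (R.*-congʳ el) (R.trans (×-assoc-* l R.1# √2) (Mult.×-congʳ R.semiring l (R.*-identityˡ √2))))))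

      coeff₀-value : ∀ n k l → A n R.≈ k · R.1# → B (suc n) R.≈ l · R.1# → coeff₀ (S n) ≡ + k
      coeff₀-value n k l ek el = ≡.trans (coeff₀-cong (value n k l ek el)) (≡.trans (coeff₀-+ _ _)
        (≡.trans (≡.cong₂ ℤ._+_ (coeff-multiple coeff₀ coeff₀-0 coeff₀-+ 1 coeff₀-1 k) (coeff-multiple coeff₀ coeff₀-0 coeff₀-+ 0 coeff₀-√2 l))
          (≡.cong +_ (≡.trans (≡.cong₂ ℕ._+_ (ℕₚ.*-identityʳ k) (ℕₚ.*-zeroʳ l)) (ℕₚ.+-identityʳ k)))))

      coeff₁-value : ∀ n k l → A n R.≈ k · R.1# → B (suc n) R.≈ l · R.1# → coeff₁ (S n) ≡ + l
      coeff₁-value n k l ek el = ≡.trans (coeff₁-cong (value n k l ek el)) (≡.trans (coeff₁-+ _ _)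
        (≡.trans (≡.cong₂ ℤ._+_ (coeff-multiple coeff₁ coeff₁-0 coeff₁-+ 0 coeff₁-1 k) (coeff-multiple coeff₁ coeff₁-0 coeff₁-+ 1 coeff₁-√2 l))
          (≡.cong +_ (≡.cong₂ ℕ._+_ (ℕₚ.*-zeroʳ k) (ℕₚ.*-identityʳ l)))))

      0-vs-4 : ∀ n L → weigh symbol-weight L R.≈ S n → (∃ λ m → A n R.≈ suc m · R.1#) → IsNatural (B (suc n)) → count 4 L < count 0 L
      0-vs-4 n L e (m , eA) (l , eB) = difference (≡.trans (≡.sym (weigh-count 0 4 (λ ()) coeff₀ coeff₀-0 coeff₀-+ coeff₀-cong coeff₀-ζ L))
        (≡.trans (coeff₀-cong e) (coeff₀-value n (suc m) l eA eB)))

      1-vs-5 : ∀ n L → weigh symbol-weight L R.≈ S n → IsNatural (A n) → (∃ λ m → B (suc n) R.≈ suc m · R.1#) → count 5 L < count 1 L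
      1-vs-5 n L e (k , eA) (m , eB) = difference (≡.trans (≡.sym (weigh-count 1 5 (λ ()) coeff₁ coeff₁-0 coeff₁-+ coeff₁-cong coeff₁-ζ L))
        (≡.trans (coeff₁-cong e) (coeff₁-value n k (suc m) eA eB)))

    module Rank = Extract (Pp.symbols z z̄) rank-even rank-odd rank-series

    positive-at : ∀ {f} k → f ≽ q ^ k → ∃ λ m → f k R.≈ suc m · R.1#
    positive-at {f} k (excess g ng e) = proj₁ (ng k) , R.trans (PS.at e k) (R.+-cong
      (R.trans (R.trans (R.sym (PS.at (*-identityʳ (q ^ k)) k)) (R.reflexive (≡.cong (q ^ k * 1#) (≡.sym (ℕₚ.+-identityʳ k))))) (q^-shift k 1# 0))
      (proj₂ (ng k)))

    u^ : ∀ k → u ^ k ≈ q ^ (8 ℕ.* k)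
    u^ k = trans (^-congˡ k (solve 1 (λ q → let p = q :* q in q :* (q :* (p :* p :* p)) := q :^ 8) refl q)) (^-assocʳ q 8 k)

    ranks-0-4 : ∀ n → rank-even ≽ q ^ n → Σ ℕ λ k₀ → Σ ℕ λ k₄ → N0≡ (+ 0) 8 (suc n) k₀ × N0≡ (+ 4) 8 (suc n) k₄ × k₄ < k₀
    ranks-0-4 n h = _ , _ , count-is-N0 n 0 (s≤s z≤n) , count-is-N0 n 4 (s≤s (s≤s (s≤s (s≤s (s≤s z≤n))))) ,
      Rank.0-vs-4 n (symbol-list n) (total (enum-symbols n)) (positive-at n h) (natural-odd (suc n))

    ranks-1-3 : ∀ n → rank-odd ≽ q ^ suc n → Σ ℕ λ k₁ → Σ ℕ λ k₃ → N0≡ (+ 1) 8 (suc n) k₁ × N0≡ (+ 3) 8 (suc n) k₃ × k₃ < k₁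
    ranks-1-3 n h = _ , _ , count-is-N0 n 1 (s≤s (s≤s z≤n)) , count-5-is-N0-3 n ,
      Rank.1-vs-5 n (symbol-list n) (total (enum-symbols n)) (natural-even n) (positive-at (suc n) h)

    pu^ : ∀ k → p * u ^ k ≈ q ^ (2 ℕ.+ 8 ℕ.* k)
    pu^ k = trans (*-assoc q q _) (*-congˡ (*-congˡ (u^ k)))

  theorem : ((n r : ℕ) → (r ≡ 1 ⊎ r ≡ 3) →
      Σ ℕ λ k₀ → Σ ℕ λ k₄ → N0≡ (+ 0) 8 (8 ℕ.* n ℕ.+ r) k₀ × N0≡ (+ 4) 8 (8 ℕ.* n ℕ.+ r) k₄ × k₄ < k₀)
      × ((n : ℕ) →
      Σ ℕ λ k₁ → Σ ℕ λ k₃ → N0≡ (+ 1) 8 (8 ℕ.* n ℕ.+ 2) k₁ × N0≡ (+ 3) 8 (8 ℕ.* n ℕ.+ 2) k₃ × k₃ < k₁)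
      × ((n : ℕ) → n ≥ 1 →
      Σ ℕ λ k₁ → Σ ℕ λ k₃ → N0≡ (+ 1) 8 (8 ℕ.* n) k₁ × N0≡ (+ 3) 8 (8 ℕ.* n) k₃ × k₃ < k₁)
  theorem = part₁ , part₂ , part₃
    where
    part₁ : (n r : ℕ) → (r ≡ 1 ⊎ r ≡ 3) →
      Σ ℕ λ k₀ → Σ ℕ λ k₄ → N0≡ (+ 0) 8 (8 ℕ.* n ℕ.+ r) k₀ × N0≡ (+ 4) 8 (8 ℕ.* n ℕ.+ r) k₄ × k₄ < k₀
    part₁ n r (inj₁ ≡.refl) = ≡.subst (λ N → Σ ℕ λ k₀ → Σ ℕ λ k₄ → N0≡ (+ 0) 8 N k₀ × N0≡ (+ 4) 8 N k₄ × k₄ < k₀)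
      (ℕₚ.+-comm 1 (8 ℕ.* n)) (ranks-0-4 (8 ℕ.* n) (≽-trans (even≽u^k n) (≽-≈ (u^ n))))
    part₁ n r (inj₂ ≡.refl) = ≡.subst (λ N → Σ ℕ λ k₀ → Σ ℕ λ k₄ → N0≡ (+ 0) 8 N k₀ × N0≡ (+ 4) 8 N k₄ × k₄ < k₀)
      (ℕₚ.+-comm 3 (8 ℕ.* n)) (ranks-0-4 (2 ℕ.+ 8 ℕ.* n) (≽-trans (even≽pu^k n) (≽-≈ (pu^ n))))
    part₂ : (n : ℕ) → Σ ℕ λ k₁ → Σ ℕ λ k₃ → N0≡ (+ 1) 8 (8 ℕ.* n ℕ.+ 2) k₁ × N0≡ (+ 3) 8 (8 ℕ.* n ℕ.+ 2) k₃ × k₃ < k₁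
    part₂ n = ≡.subst (λ N → Σ ℕ λ k₁ → Σ ℕ λ k₃ → N0≡ (+ 1) 8 N k₁ × N0≡ (+ 3) 8 N k₃ × k₃ < k₁)
      (ℕₚ.+-comm 2 (8 ℕ.* n)) (ranks-1-3 (1 ℕ.+ 8 ℕ.* n) (≽-trans (odd≽pu^k n) (≽-≈ (pu^ n))))
    part₃ : (n : ℕ) → n ≥ 1 → Σ ℕ λ k₁ → Σ ℕ λ k₃ → N0≡ (+ 1) 8 (8 ℕ.* n) k₁ × N0≡ (+ 3) 8 (8 ℕ.* n) k₃ × k₃ < k₁
    part₃ (suc k) _ = ≡.subst (λ N → Σ ℕ λ k₁ → Σ ℕ λ k₃ → N0≡ (+ 1) 8 N k₁ × N0≡ (+ 3) 8 N k₃ × k₃ < k₁)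
      -- The size 8(k + 1) is the successor of 7 + 8k. The coefficient of `rank-odd` that is tested
      -- has the index 8(k + 1) itself, because of the factor q in front of √2.
      (≡.sym (ℕₚ.*-suc 8 k)) (ranks-1-3 (7 ℕ.+ 8 ℕ.* k) (≽-trans (odd≽u^k k) (≽-≈ (trans (u^ (suc k)) (reflexive (≡.cong (q ^_) (ℕₚ.*-suc 8 k)))))))

open import Data.Nat using (_+_; _*_)

theorem1p11 : ((n r : ℕ) → (r ≡ 1 ⊎ r ≡ 3) →
    Σ ℕ λ k₀ → Σ ℕ λ k₄ → N0≡ (+ 0) 8 (8 * n + r) k₀ × N0≡ (+ 4) 8 (8 * n + r) k₄ × k₄ < k₀)
    × ((n : ℕ) →
    Σ ℕ λ k₁ → Σ ℕ λ k₃ → N0≡ (+ 1) 8 (8 * n + 2) k₁ × N0≡ (+ 3) 8 (8 * n + 2) k₃ × k₃ < k₁)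
    × ((n : ℕ) → n ≥ 1 →
    Σ ℕ λ k₁ → Σ ℕ λ k₃ → N0≡ (+ 1) 8 (8 * n) k₁ × N0≡ (+ 3) 8 (8 * n) k₃ × k₃ < k₁)
theorem1p11 = RankDifferences.theorem Cyclotomic.ℤ[ζ]
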